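{- Let $L$ be an oriented non-split alternating link with consolidated Tait graphs $G_B^*$, $G_W^*$ and weighted adjacency matrices $\overline A_B$, $\overline A_W$, and let $X_B$, $X_W$ be diagonal matrices of independent commuting vertex variables of the corresponding sizes. Then $$\operatorname{sq}\Bigl(-\log\det\bigl(I-tX_B\overline A_B\bigr)\Bigr)\Big|_{t=1}=CB_2(w^2,r^2)+2\sum_{i>2}CB_i(w,r),$$ and the same identity holds with $B$ replaced by $W$ (i.e. with $X_W$, $\overline A_W$, $CW_2$, $CW_i$). Hence the unordered pair of these two evaluations is exactly the invariant $WRP(w,r)$ of $L$.
   Context: Tait graphs and $CWR$. Let $D$ be a reduced (no nugatory crossings) alternating diagram of an oriented non-split alternating link $L$. The regions of $D$ are checkerboard coloured black and white, so that regions sharing an edge have opposite colours; which class is called black is fixed once and for all by a local rule depending on the over/under pattern at crossings, the same rule for all diagrams (the statement holds for either choice of rule). The Tait graph $G_B$ has one vertex for each black region and one edge for each crossing, joining the black regions meeting at that crossing; $G_W$ is defined in the same way from white regions. Each edge $e$ gets weight $\operatorname{wg}(e)=w$ if the crossing is positive and $r$ if it is negative, where $w,r$ are commuting indeterminates. The consolidated Tait graph $G_B^*$ is the weighted simple graph obtained from $G_B$ by replacing all parallel edges joining the same pair of vertices by a single edge whose weight is the product of their weights; $G_W^*$ is obtained from $G_W$ likewise. For $i>2$, $CB_i(w,r)=\sum_C\prod_{e\in E(C)}\operatorname{wg}(e)$, summed over all unoriented simple cycles $C$ of length $i$ in $G_B^*$; $CB_2(w,r)=\sum_{e\in E(G_B^*)}\operatorname{wg}(e)$;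 $CW_i$ is defined analogously from $G_W^*$. It is a known theorem that the $CB_i$ and $CW_i$ do not depend on the chosen reduced alternating diagram $D$ of $L$. The $WRP$ invariant. From $G_B^*$ and $G_W^*$ form directed graphs $G_B'$ and $G_W'$ by replacing every edge by two oppositely oriented edges with the same weight. $WRP(w,r)$ is the unordered pair of polynomials obtained from $G_B'$ and $G_W'$ by summing, over all directed simple cycles (including the directed $2$-cycles formed by a pair of opposite edges; cycles are counted without a base point), the products of the edge weights. The weighted adjacency matrix of a simple loopless weighted graph has $(i,j)$ entry equal to the weight of the edge $v_iv_j$ if it exists, and $0$ otherwise. The logarithm is the formal one, $\log(1+u)=\sum_{j\ge1}(-1)^{j+1}u^j/j$, applied to $\det(I-tX\overline A)\in 1+t\,\mathbb{Z}[w,r][x_1,\dots,x_n][t]$. For $P=\sum_\alpha c_\alpha x^\alpha\in\mathbb{Q}[w,r][x_1,\ldots,x_n]$, $\operatorname{sq}(P)=\sum_{\alpha\in\{0,1\}^n}c_\alpha$ is the sum of the coefficients of the squarefree monomials, extended coefficientwise to power series in $t$. The series $\operatorname{sq}(-\log\det(I-tX\overline A))$ is a polynomial in $t$, so it may be evaluated at $t=1$. -}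

module Defs where

open import Algebra.Bundles.Raw using (RawRing)
import Algebra.Definitions.RawSemiring as RawSemiringDefs
open import Data.Bool.Base using (Bool; true; false; not; if_then_else_)
open import Data.Fin.Base as Fin using (Fin; zero; suc; toℕ; punchIn)
open import Data.Fin.Patterns using (0F; 1F; 2F; 3F)
import Data.Fin.Properties as Fin
import Data.Integer.Base as ℤ
open import Data.Empty using (⊥-elim)
open import Data.List.Base
  using (List; []; _∷_; _++_; map; filter; foldr; allFin; applyUpTo; cartesianProduct;
         cartesianProductWith; concatMap; deduplicate; drop; length; mapMaybe; reverse; take; zip)
open import Data.List.Membership.Propositional using (_∈_)
open import Data.List.Membership.Propositional.Properties
  using (∈-deduplicate⁺; ∈-allFin; ∈-concatMap⁺)
import Data.List.Membership.Setoid.Properties as Membership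
import Data.List.Membership.DecPropositional as DecMembership
open import Data.List.Properties using (filter-none; filter-≐; ≡-dec)
open import Data.List.Relation.Unary.All as All using (All)
open import Data.List.Relation.Unary.Any as Any using (here; there)
open import Data.List.Relation.Unary.Unique.Propositional using (Unique)
import Data.List.Relation.Unary.Unique.DecPropositional as DecUnique
open import Data.Maybe.Base using (Maybe; just; nothing; fromMaybe)
open import Data.Maybe using (Is-just)
import Data.Maybe.Relation.Unary.Any as MaybeAny
open import Data.Nat.Base as ℕ using (ℕ; zero; suc; _∸_)
import Data.Nat.Properties as ℕ
open import Data.Parity.Base using (Parity; 0ℙ; 1ℙ; _⁻¹)
open import Data.Product.Base using (∃; _×_; _,_; proj₁; proj₂; uncurry)
import Data.Product.Properties as Prod
open import Data.Rational.Base as ℚ using (ℚ)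
open import Data.Sign.Base as Sign using (Sign)
open import Data.Sum.Base as Sum using (_⊎_; inj₁; inj₂; swap)
open import Data.Unit.Base using (tt)
open import Data.Vec.Base as Vec using (Vec; []; _∷_)
import Data.Vec.Properties as Vec
open import Function.Base using (_∘_)
open import Function.Bundles using (Equivalence; _⇔_)
open import Relation.Binary.Construct.Closure.Equivalence using (EqClosure; gfold)
open import Relation.Binary.Construct.Closure.ReflexiveTransitive using (Star)
open import Relation.Binary.PropositionalEquality
  using (_≡_; _≢_; refl; sym; trans; cong; isEquivalence; setoid)
open import Relation.Nullary.Decidable using (does; yes; _×-dec_; _⊎-dec_)
open import Relation.Nullary.Negation using (¬_)
import Relation.Unary as Unary

------------------------------------------------------------------------
-- Oriented link diagrams

-- The four edge-ends (slots) at a crossing are numbered counterclockwise,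
-- slot 0 being the incoming end of the under-strand.  So the under-strand runs
-- from slot 0 to slot 2; the over-strand occupies slots 1 and 3, and runs
-- from 3 to 1 at a positive crossing and from 1 to 3 at a negative one.

Slot : Set
Slot = Fin 4

outgoing : Sign → Slot → Bool
outgoing s      0F = false
outgoing s      2F = true
outgoing Sign.+ 1F = true
outgoing Sign.+ 3F = false
outgoing Sign.- 1F = false
outgoing Sign.- 3F = true

-- 1ℙ for the ends of the over-strand, 0ℙ for those of the under-strand.
slotParity : Slot → Parity
slotParity 0F = 0ℙ
slotParity 1F = 1ℙ
slotParity 2F = 0ℙ
slotParity 3F = 1ℙ

clockwise : Slot → Slot
clockwise 0F = 3F
clockwise 1F = 0F
clockwise 2F = 1F
clockwise 3F = 2F

-- A connected oriented link diagram on the sphere with at least one crossing,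
-- as a combinatorial map.  A dart (c , i) is the edge-end in slot i of crossing
-- c; it also names the corner of c lying between slots i and i + 1
-- counterclockwise, i.e. to the left of the dart when looking away from c.
-- Connectedness is no restriction for non-split links: a disconnected diagram
-- always presents a split link.
record CrossedDiagram : Set where
  field
    crossings : ℕ

  Crossing : Set
  Crossing = Fin crossings

  Dart : Set
  Dart = Crossing × Slot

  -- A connected 4-valent map with n vertices has 2n edges, so it lies on the
  -- sphere exactly when it has n + 2 faces.
  Region : Set
  Region = Fin (2 ℕ.+ crossings)

  field
    sign            : Crossing → Sign
    join            : Dart → Dart
    join-involutive : ∀ d → join (join d) ≡ d

  isOut : Dart → Bool
  isOut d = outgoing (sign (proj₁ d)) (proj₂ d)

  Adjacent : Crossing → Crossing → Set
  Adjacent c c′ = ∃ λ i → proj₁ (join (c , i)) ≡ c′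

  -- Walk along the dart keeping its left-hand corner on the left; at the far
  -- end that region occupies the corner clockwise of the arrival slot.
  nextCorner : Dart → Dart
  nextCorner d = proj₁ (join d) , clockwise (proj₂ (join d))

  SameFace : Dart → Dart → Set
  SameFace = EqClosure (λ d d′ → nextCorner d ≡ d′)

  field
    join-oriented : ∀ d → isOut (join d) ≡ not (isOut d)
    connected     : ∀ c c′ → Star Adjacent c c′
    region        : Dart → Region
    region-face   : ∀ d d′ → region d ≡ region d′ ⇔ SameFace d d′
    region-onto   : ∀ ρ → ∃ λ d → region d ≡ ρ

  Alternates : Set
  Alternates = ∀ d → slotParity (proj₂ (join d)) ≢ slotParity (proj₂ d)

  Nugatory : Crossing → Set
  Nugatory c = region (c , 0F) ≡ region (c , 2F) ⊎ region (c , 1F) ≡ region (c , 3F)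

data Diagram : Set where
  circle  : Diagram                     -- the crossingless diagram of the unknot
  crossed : CrossedDiagram → Diagram

data Alternating : Diagram → Set where
  circle  : Alternating circle
  crossed : ∀ {D} → CrossedDiagram.Alternates D → Alternating (crossed D)

data Reduced : Diagram → Set where
  circle  : Reduced circle
  crossed : ∀ {D} → (∀ c → ¬ CrossedDiagram.Nugatory D c) → Reduced (crossed D)

record ReducedAlternatingDiagram : Set where
  field
    diagram     : Diagram
    alternating : Alternating diagram
    reduced     : Reduced diagram

------------------------------------------------------------------------
-- Checkerboard colouring

data Colour : Set where
  black white : Colour

-- Turning the over-strand counterclockwise sweeps the two corners numbered 1
-- and 3.  The rule 1ℙ declares the regions at these corners black, the rule 0ℙ
-- those at corners 0 and 2.
Rule : Set
Rule = Parity

colourParity : Rule → Colour → Parity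
colourParity p black = p
colourParity p white = p ⁻¹

cornersOf : Parity → Slot × Slot
cornersOf 0ℙ = 0F , 2F
cornersOf 1ℙ = 1F , 3F

-- The rule does colour regions, and does so in checkerboard fashion: corners of
-- the same region have equal parity, those on either side of an edge do not.
module _ (D : CrossedDiagram) (alternates : CrossedDiagram.Alternates D) where
  open CrossedDiagram D

  private
    cornerParity : Dart → Parity
    cornerParity (_ , i) = slotParity i

    clockwise-parity : ∀ i → slotParity (clockwise i) ≡ slotParity i ⁻¹
    clockwise-parity 0F = refl
    clockwise-parity 1F = refl
    clockwise-parity 2F = refl
    clockwise-parity 3F = refl

    ≢⇒⁻¹ : ∀ p q → p ≢ q → p ⁻¹ ≡ q
    ≢⇒⁻¹ 0ℙ 0ℙ p≢q = ⊥-elim (p≢q refl)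
    ≢⇒⁻¹ 0ℙ 1ℙ p≢q = refl
    ≢⇒⁻¹ 1ℙ 0ℙ p≢q = refl
    ≢⇒⁻¹ 1ℙ 1ℙ p≢q = ⊥-elim (p≢q refl)

    next-parity : ∀ d → cornerParity (nextCorner d) ≡ cornerParity d
    next-parity d = trans (clockwise-parity (proj₂ (join d))) (≢⇒⁻¹ _ _ (alternates d))

  region-coloured : ∀ d d′ → region d ≡ region d′ → slotParity (proj₂ d) ≡ slotParity (proj₂ d′)
  region-coloured d d′ e =
    gfold isEquivalence cornerParity (λ { {d} refl → sym (next-parity d) })
      (Equivalence.to (region-face d d′) e)

  -- (c , clockwise i) is the corner to the right of the dart (c , i).
  edge-coloured : ∀ c i → region (c , clockwise i) ≢ region (c , i)
  edge-coloured c i e = p⁻¹≢p _ (trans (sym (clockwise-parity i)) (region-coloured _ _ e))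
    where
      p⁻¹≢p : ∀ p → p ⁻¹ ≢ p
      p⁻¹≢p 0ℙ ()
      p⁻¹≢p 1ℙ ()

------------------------------------------------------------------------
-- Finite sums, products and determinants

module Sums {a ℓ} (R : RawRing a ℓ) where
  open RawRing R
  open RawSemiringDefs rawSemiring public using (_^_) renaming (_×_ to _·_)

  ∑ ∏ : List Carrier → Carrier
  ∑ = foldr _+_ 0#
  ∏ = foldr _*_ 1#

module Matrices {a ℓ} (R : RawRing a ℓ) where
  open RawRing R
  open Sums R

  Matrix : ℕ → Set a
  Matrix n = Fin n → Fin n → Carrier

  diag : ∀ {n} → (Fin n → Carrier) → Matrix n
  diag v i j = if does (i Fin.≟ j) then v i else 0#

  I : ∀ {n} → Matrix n
  I = diag (λ _ → 1#)

  infixl 6 _-ᴹ_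
  infixl 7 _*ᴹ_ _*ˢ_

  _-ᴹ_ _*ᴹ_ : ∀ {n} → Matrix n → Matrix n → Matrix n
  (M -ᴹ N) i j = M i j + - N i j
  (M *ᴹ N) i k = ∑ (map (λ j → M i j * N j k) (allFin _))

  _*ˢ_ : ∀ {n} → Carrier → Matrix n → Matrix n
  (s *ˢ M) i j = s * M i j

  -- Laplace expansion along the first row.
  det : ∀ {n} → Matrix n → Carrier
  det {zero}  M = 1#
  det {suc n} M =
    ∑ (map (λ j → (- 1#) ^ toℕ j * M zero j * det (λ i k → M (suc i) (punchIn j k))) (allFin _))

------------------------------------------------------------------------
-- Polynomials and power series

-- Polynomials in n variables over R, written as formal sums of terms (coefficient,
-- exponent vector).  Terms may repeat, so equality compares coefficients.
module Polynomials {a ℓ} (R : RawRing a ℓ) (n : ℕ) where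
  private module R = RawRing R

  Monomial : Set
  Monomial = Vec ℕ n

  Poly : Set a
  Poly = List (R.Carrier × Monomial)

  coeff : Poly → Monomial → R.Carrier
  coeff []            α = R.0#
  coeff ((c , β) ∷ p) α =
    if does (Vec.≡-dec ℕ._≟_ β α) then c R.+ coeff p α else coeff p α

  const : R.Carrier → Poly
  const c = (c , Vec.replicate n 0) ∷ []

  var : Fin n → Poly
  var i = (R.1# , Vec.replicate n 0 Vec.[ i ]≔ 1) ∷ []

  rawRing : RawRing a ℓ
  rawRing = record
    { Carrier = Poly
    ; _≈_     = λ p q → ∀ α → coeff p α R.≈ coeff q α
    ; _+_     = _++_
    ; _*_     = cartesianProductWith λ (c , α) (d , β) → c R.* d , Vec.zipWith ℕ._+_ α β
    ; -_      = map λ (c , α) → R.- c , α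
    ; 0#      = []
    ; 1#      = const R.1#
    }

  -- Substitution of the polynomials s i for the variables.
  _⟦_⟧ : Poly → (Fin n → Poly) → Poly
  p ⟦ s ⟧ = ∑ (map (λ (c , α) → const c * ∏ (map (λ i → s i ^ Vec.lookup α i) (allFin n))) p)
    where open RawRing rawRing
          open Sums rawRing

  zeroOneVectors : ∀ k → List (Vec ℕ k)
  zeroOneVectors zero    = [] ∷ []
  zeroOneVectors (suc k) = cartesianProductWith _∷_ (0 ∷ 1 ∷ []) (zeroOneVectors k)

  sq : Poly → R.Carrier
  sq p = Sums.∑ R (map (coeff p) (zeroOneVectors n))

module PowerSeries {a ℓ} (R : RawRing a ℓ) where
  private module R = RawRing R
  open Sums R using (∑)

  Series : Set a
  Series = ℕ → R.Carrier

  const : R.Carrier → Series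
  const c zero    = c
  const c (suc _) = R.0#

  t : Series
  t 1 = R.1#
  t _ = R.0#

  rawRing : RawRing a ℓ
  rawRing = record
    { Carrier = Series
    ; _≈_     = λ f g → ∀ m → f m R.≈ g m
    ; _+_     = λ f g m → f m R.+ g m
    ; _*_     = λ f g m → ∑ (applyUpTo (λ k → f k R.* g (m ∸ k)) (suc m))
    ; -_      = λ f m → R.- f m
    ; 0#      = const R.0#
    ; 1#      = const R.1#
    }

  -- f is a polynomial in t.
  Terminates : Series → Set ℓ
  Terminates f = ∃ λ N → ∀ m → N ℕ.< m → f m R.≈ R.0#

  atOne : (f : Series) → Terminates f → R.Carrier
  atOne f (N , _) = ∑ (applyUpTo f (suc N))

  -- log(1 + u) = ∑_{j ≥ 1} (-1)^(j+1) u^j / j for a series f = 1 + u with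
  -- constant term 1, where ι embeds ℚ in R.  As u has no constant term, only
  -- j ≤ m contribute to the coefficient of t^m; below j = suc k.
  module _ (ι : ℚ → R.Carrier) where
    log : Series → Series
    log f m =
      ∑ (applyUpTo (λ k → ι ((ℤ.-1ℤ ℤ.^ k) ℚ./ suc k) R.* (u ^ suc k) m) m)
      where
        open RawRing rawRing
        open Sums rawRing using (_^_)
        u : Series
        u = f + - 1#

-- ℚ[w,r]
module ℚ[w,r] where
  open Polynomials ℚ.+-*-rawRing 2 public
  open RawRing rawRing public using (Carrier; _≈_; _+_; _*_; 0#; 1#)
  open Sums rawRing public

  w r : Carrier
  w = var 0F
  r = var 1F

  infix 8 _[w²,r²]
  _[w²,r²] : Carrier → Carrier
  p [w²,r²] = p ⟦ (λ { 0F → w * w ; 1F → r * r }) ⟧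

Weight : Set
Weight = ℚ[w,r].Carrier

------------------------------------------------------------------------
-- Weighted graphs

-- Loops and parallel edges are allowed.
record MultiGraph : Set where
  field
    order size : ℕ
    ends       : Fin size → Fin order × Fin order
    wg         : Fin size → Weight

  Joins : Fin order → Fin order → Fin size → Set
  Joins u v e = ends e ≡ (u , v) ⊎ ends e ≡ (v , u)

  joins? : ∀ u v → Unary.Decidable (Joins u v)
  joins? u v e = (ends e ≟ (u , v)) ⊎-dec (ends e ≟ (v , u))
    where _≟_ = Prod.≡-dec Fin._≟_ Fin._≟_

  Loopless : Set
  Loopless = ∀ e → proj₁ (ends e) ≢ proj₂ (ends e)

-- weight u v is the weight of the edge uv, or nothing when u, v are not adjacent.
record SimpleGraph : Set where
  field
    order    : ℕ
    weight   : Fin order → Fin order → Maybe Weight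
    symm     : ∀ u v → weight u v ≡ weight v u
    loopless : ∀ u → weight u u ≡ nothing

record Digraph : Set where
  field
    order : ℕ
    arc   : Fin order → Fin order → Maybe Weight

parallelProduct : List Weight → Maybe Weight
parallelProduct []         = nothing
parallelProduct ws@(_ ∷ _) = just (ℚ[w,r].∏ ws)

consolidate : (G : MultiGraph) → MultiGraph.Loopless G → SimpleGraph
consolidate G loopless = record
  { order    = order
  ; weight   = λ u v → parallelProduct (map wg (filter (joins? u v) (allFin size)))
  ; symm     = λ u v → cong (parallelProduct ∘ map wg)
                 (filter-≐ (joins? u v) (joins? v u) (swap , swap) (allFin size))
  ; loopless = λ u → cong (parallelProduct ∘ map wg)
                 (filter-none (joins? u u) (All.universal (noLoop u) (allFin size)))
  }
  where
    open MultiGraph G hiding (Loopless)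
    noLoop : ∀ u e → ¬ Joins u u e
    noLoop u e j = loopless e (trans (cong proj₁ (Sum.reduce j)) (sym (cong proj₂ (Sum.reduce j))))

-- Each edge uv gives the two arcs u → v and v → u.
bidirect : SimpleGraph → Digraph
bidirect G = record { order = order ; arc = weight }
  where open SimpleGraph G

-- Closed sequences of vertices, the last vertex being followed by the first.
module Cycles {n : ℕ} (weight : Fin n → Fin n → Maybe Weight) where
  open ℚ[w,r]

  sequences : ℕ → List (List (Fin n))
  sequences zero    = [] ∷ []
  sequences (suc i) = cartesianProductWith _∷_ (allFin n) (sequences i)

  steps : List (Fin n) → List (Fin n × Fin n)
  steps c = zip c (drop 1 c ++ take 1 c)

  IsCycle : List (Fin n) → Set
  IsCycle c = Unique c × All (λ (u , v) → Is-just (weight u v)) (steps c)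

  isCycle? : Unary.Decidable IsCycle
  isCycle? c = DecUnique.unique? Fin._≟_ c
    ×-dec All.all? (λ (u , v) → MaybeAny.dec (λ _ → yes tt) (weight u v)) (steps c)

  basedCycles : ℕ → List (List (Fin n))
  basedCycles i = filter isCycle? (sequences i)

  rotations : List (Fin n) → List (List (Fin n))
  rotations c = applyUpTo (λ k → drop k c ++ take k c) (length c)

  _∈?_ = DecMembership._∈?_ (≡-dec (Fin._≟_ {n}))

  -- Directed cycles are identified up to rotation, unoriented ones also up to
  -- reversal; one representative of each class is kept.
  directedCycles undirectedCycles : ℕ → List (List (Fin n))
  directedCycles   i = deduplicate (λ c d → d ∈? rotations c) (basedCycles i)
  undirectedCycles i =
    deduplicate (λ c d → (d ∈? rotations c) ⊎-dec (d ∈? rotations (reverse c))) (basedCycles i)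

  cycleWeight : List (Fin n) → Weight
  cycleWeight c = ∏ (map (λ (u , v) → fromMaybe 0# (weight u v)) (steps c))

module _ (G : SimpleGraph) where
  open SimpleGraph G
  open ℚ[w,r]
  open Cycles weight

  edgeWeights : List Weight
  edgeWeights = mapMaybe (uncurry weight)
    (filter (λ (u , v) → u Fin.<? v) (cartesianProduct (allFin order) (allFin order)))

  -- Meaningful for i ≥ 2.
  cycleSum : ℕ → Weight
  cycleSum 2 = ∑ edgeWeights
  cycleSum i = ∑ (map cycleWeight (undirectedCycles i))

  -- The sum over i > 2 stops at i = order, the greatest length of a simple cycle.
  longCycleSum : Weight
  longCycleSum = ∑ (applyUpTo (λ k → cycleSum (3 ℕ.+ k)) (order ∸ 2))

directedCycleSum : Digraph → Weight
directedCycleSum G =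
  ∑ (applyUpTo (λ k → ∑ (map cycleWeight (directedCycles (suc k)))) order)
  where
    open Digraph G
    open ℚ[w,r]
    open Cycles arc

------------------------------------------------------------------------
-- Tait graphs and the invariants

tait : Rule → ReducedAlternatingDiagram → Colour → ∃ MultiGraph.Loopless
tait p record { diagram = circle } κ =
  record { order = 1 ; size = 0 ; ends = λ () ; wg = λ () } , λ ()
tait p record { diagram = crossed D ; reduced = crossed reduced } κ =
  record { order = length regions ; size = crossings
         ; ends  = λ c → Any.index (first∈ c) , Any.index (second∈ c)
         ; wg    = wg ∘ sign }
  , λ c → opposite≢ (colourParity p κ) c
          ∘ Membership.index-injective (setoid _) (first∈ c) (second∈ c)
  where
    open CrossedDiagram D
    i = proj₁ (cornersOf (colourParity p κ))
    j = proj₂ (cornersOf (colourParity p κ))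

    corners : Crossing → List Region
    corners c = region (c , i) ∷ region (c , j) ∷ []

    -- The κ-coloured regions.
    regions : List Region
    regions = deduplicate Fin._≟_ (concatMap corners (allFin crossings))

    first∈ : ∀ c → region (c , i) ∈ regions
    first∈ c = ∈-deduplicate⁺ Fin._≟_ (∈-concatMap⁺ corners (Any.map (λ { refl → here refl }) (∈-allFin c)))

    second∈ : ∀ c → region (c , j) ∈ regions
    second∈ c = ∈-deduplicate⁺ Fin._≟_ (∈-concatMap⁺ corners (Any.map (λ { refl → there (here refl) }) (∈-allFin c)))

    opposite≢ : ∀ q c → region (c , proj₁ (cornersOf q)) ≢ region (c , proj₂ (cornersOf q))
    opposite≢ 0ℙ c = reduced c ∘ inj₁
    opposite≢ 1ℙ c = reduced c ∘ inj₂

    wg : Sign → Weight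
    wg Sign.+ = ℚ[w,r].w
    wg Sign.- = ℚ[w,r].r

G* : Rule → ReducedAlternatingDiagram → Colour → SimpleGraph
G* p D κ = uncurry consolidate (tait p D κ)

CB CW : Rule → ReducedAlternatingDiagram → ℕ → Weight
CB p D = cycleSum (G* p D black)
CW p D = cycleSum (G* p D white)

∑CB>2 ∑CW>2 : Rule → ReducedAlternatingDiagram → Weight
∑CB>2 p D = longCycleSum (G* p D black)
∑CW>2 p D = longCycleSum (G* p D white)

WRP : Rule → ReducedAlternatingDiagram → Weight × Weight
WRP p D = directedCycleSum (bidirect (G* p D black)) , directedCycleSum (bidirect (G* p D white))

-- Equality of unordered pairs.
infix 4 _≈ᵘ_
_≈ᵘ_ : Weight × Weight → Weight × Weight → Set
(a , b) ≈ᵘ (c , d) = (a ≈ c × b ≈ d) ⊎ (a ≈ d × b ≈ c)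
  where open ℚ[w,r]

------------------------------------------------------------------------
-- The determinant side

module _ (G : SimpleGraph) where
  open SimpleGraph G
  private
    module ℚ[w,r][x]      = Polynomials ℚ[w,r].rawRing order
    module ℚ[w,r][x][[t]] = PowerSeries ℚ[w,r][x].rawRing
    open ℚ[w,r][x][[t]] using (Series; t)
    open RawRing ℚ[w,r][x][[t]].rawRing using (-_)
    open Matrices ℚ[w,r][x][[t]].rawRing

    log : Series → Series
    log = ℚ[w,r][x][[t]].log (ℚ[w,r][x].const ∘ ℚ[w,r].const)

  adjacency : Fin order → Fin order → Weight
  adjacency u v = fromMaybe ℚ[w,r].0# (weight u v)

  A̅ X : Matrix order
  A̅ u v = ℚ[w,r][x][[t]].const (ℚ[w,r][x].const (adjacency u v))
  X     = diag (λ v → ℚ[w,r][x][[t]].const (ℚ[w,r][x].var v))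

  -log-det : Series
  -log-det = - log (det (I -ᴹ t *ˢ (X *ᴹ A̅)))

  -- A power series in t over ℚ[w,r].
  sq[-log-det] : ℕ → Weight
  sq[-log-det] m = ℚ[w,r][x].sq (-log-det m)

open PowerSeries ℚ[w,r].rawRing public using (Terminates; atOne)

{-# OPTIONS --safe #-}
module Submission where

-- In K[x₁,…,xₙ]/(xᵢ²) adjoin the variable of the first vertex last, as a dual number ε.
-- Then det(I - tXA) = d + ε d h, where d belongs to the remaining vertices and
-- - h enumerates the closed walks through the first vertex that do not return to it in
-- between: eliminate the first row using that a determinant with a repeated row vanishes.
-- As log(d + ε d h) = log d + ε h, the sum of the squarefree coefficients of
-- - log det(I - tXA) is, by induction, the weighted number of simple directed cycles, each
-- cycle being counted at its least vertex.  Unoriented cycles of length at least three have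
-- exactly two orientations, and 2-cycles contribute the squares of the edge weights.

open import Defs
open import Algebra.Bundles using (CommutativeRing; AbelianGroup)
open import Algebra.Bundles.Raw using (RawRing)
import Algebra.Construct.DirectProduct as DirectProduct
import Algebra.Morphism.RingMonomorphism as RingMonomorphism
open import Algebra.Morphism.Structures using (IsRingMonomorphism)
import Algebra.Properties.CommutativeSemigroup as CommutativeSemigroupProperties
import Algebra.Properties.Ring as RingProperties
import Algebra.Properties.Semiring.Mult as Multiples
open import Algebra.Structures using (IsAbelianGroup)
open import Data.Bool.Base using (Bool; true; false; _∧_; if_then_else_)
open import Data.Empty using (⊥)
open import Data.Fin.Base as Fin using (Fin; zero; suc; toℕ; punchIn)
open import Data.Fin.Patterns using (0F; 1F)
import Data.Fin.Properties as Fin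
import Data.Integer.Base as ℤ
import Data.Integer.Properties as ℤ
import Data.Integer.Tactic.RingSolver as ℤ-Solver
open import Data.List.Base as List
  using (List; []; _∷_; _++_; map; filter; length; allFin; applyUpTo; upTo; drop; take; zip; reverse;
         mapMaybe; cartesianProduct; cartesianProductWith; deduplicate)
import Data.List.Membership.DecPropositional as DecMembership
open import Data.List.Membership.Propositional using (_∈_; _∉_)
open import Data.List.Membership.Propositional.Properties
  using (∈-allFin; ∈-applyUpTo⁺; ∈-applyUpTo⁻; ∈-cartesianProductWith⁺; ∈-cartesianProductWith⁻;
         ∈-deduplicate⁻; ∈-filter⁺; ∈-filter⁻; ∈-lookup)
import Data.List.Properties as List
open import Data.List.Relation.Binary.Permutation.Propositional as Perm using (_↭_; ↭-sym; ↭-trans; ↭-reflexive)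
import Data.List.Relation.Binary.Permutation.Propositional.Properties as Perm
import Data.List.Relation.Binary.Permutation.Setoid.Properties as PermSetoid
open import Data.List.Relation.Unary.All as All using (All; []; _∷_)
import Data.List.Relation.Unary.All.Properties as All
open import Data.List.Relation.Unary.AllPairs as AllPairs using (AllPairs; []; _∷_)
import Data.List.Relation.Unary.AllPairs.Properties as AllPairs
open import Data.List.Relation.Unary.Any as Any using (here; there)
import Data.List.Relation.Unary.Any.Properties as Any
import Data.List.Relation.Unary.Unique.DecPropositional as DecUnique
open import Data.List.Relation.Unary.Unique.Propositional using (Unique)
import Data.List.Relation.Unary.Unique.Propositional.Properties as Unique
import Data.List.Relation.Unary.Unique.Setoid.Properties as UniqueSetoid
open import Data.Maybe using (Is-just)
open import Data.Maybe.Base using (Maybe; just; nothing; maybe; fromMaybe)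
import Data.Maybe.Relation.Unary.Any as MaybeAny
open import Data.Nat.Base as ℕ using (ℕ; zero; suc; _∸_; z≤n; s≤s)
import Data.Nat.Properties as ℕ
open import Data.Product.Base using (∃; ∃₂; Σ-syntax; _×_; _,_; proj₁; proj₂; swap; uncurry)
open import Data.Product.Relation.Binary.Pointwise.NonDependent using (Pointwise)
open import Data.Rational.Base as ℚ using (ℚ)
import Data.Rational.Properties as ℚ
import Data.Rational.Unnormalised.Base as ℚᵘ
import Data.Rational.Unnormalised.Properties as ℚᵘ
import Data.Sign.Base as Sign
open import Data.Sum.Base as Sum using (_⊎_; inj₁; inj₂)
open import Data.Unit.Base using (tt)
open import Data.Vec.Base as Vec using (Vec; []; _∷_; lookup; replicate; _[_]≔_)
import Data.Vec.Properties as Vec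
open import Function.Base using (_∘_; id)
open import Function.Bundles using (mk⇔)
open import Level using (Level; _⊔_)
open import Relation.Binary.Core using (Rel)
import Relation.Binary.Definitions as Binary
open import Relation.Binary.Definitions using (tri<; tri≈; tri>; Symmetric; Transitive)
open import Relation.Binary.PropositionalEquality as ≡ using (_≡_)
import Relation.Binary.Reasoning.Setoid as SetoidReasoning
open import Relation.Nullary.Decidable using (Dec; does; yes; no; _×-dec_; _⊎-dec_; ¬?; does-⇔)
open import Relation.Nullary.Negation using (¬_; contradiction)
open import Relation.Unary using (Decidable)

-- Polynomials are lists of terms compared coefficientwise, so neither the ring in the vertex
-- variables nor the series over it comes with ring laws. For the vertex variables none are
-- established: `det` and `log` consist of ring operations and rational constants, hence can be
-- pushed along any map commuting with these (`RingLaws`), and the target, the squarefree quotient,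
-- is a commutative ring by construction. Nothing is lost, because `sq` factors through that
-- quotient. Only the coefficient ring in `w` and `r` needs laws of its own, and it takes them from
-- iterated power series.
--
-- Division is avoided twice. The multipliers clearing the row of the first vertex are written down
-- explicitly as walk series, so d is never inverted. The denominators of the logarithm occur only
-- as (k + 1) times the coefficient with denominator k + 1, the factor k + 1 coming from the ε-part
-- of a power.
--
-- On the combinatorial side, the representatives kept by `deduplicate` depend on the order of a
-- list, whereas the determinant singles out the cycle written from its least vertex. Double
-- counting along the rotation relation reconciles the two.

private
  variable
    a b c ℓ ℓ′ p : Level
    A B : Set a

-- Finite sums and maps of rings

module SumProperties (R : CommutativeRing c ℓ) where
  open CommutativeRing R hiding (zero)
  open Sums rawRing
  open RingProperties ring public
    using (-‿distribˡ-*; -‿distribʳ-*; -‿+-comm; -0#≈0#; -‿involutive; -1*x≈-x)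
  open CommutativeSemigroupProperties +-commutativeSemigroup public
    using () renaming (interchange to +-interchange)
  open CommutativeSemigroupProperties *-commutativeSemigroup public
    using () renaming (interchange to *-interchange; x∙yz≈y∙xz to *-swapˡ)
  open Multiples semiring public using (×-congʳ; ×-comm-*; ×-assoc-*)
  open SetoidReasoning setoid

  ∑-cong-All : ∀ {f g : A → Carrier} {xs} → All (λ x → f x ≈ g x) xs → ∑ (map f xs) ≈ ∑ (map g xs)
  ∑-cong-All []       = refl
  ∑-cong-All (e ∷ es) = +-cong e (∑-cong-All es)

  ∑-cong : ∀ {f g : A → Carrier} xs → (∀ x → f x ≈ g x) → ∑ (map f xs) ≈ ∑ (map g xs)
  ∑-cong xs e = ∑-cong-All (All.universal e xs)

  ∑-zero : ∀ {f : A → Carrier} xs → (∀ x → f x ≈ 0#) → ∑ (map f xs) ≈ 0#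
  ∑-zero []       e = refl
  ∑-zero (x ∷ xs) e = trans (+-cong (e x) (∑-zero xs e)) (+-identityˡ 0#)

  ∑-+ : ∀ (f g : A → Carrier) xs → ∑ (map (λ x → f x + g x) xs) ≈ ∑ (map f xs) + ∑ (map g xs)
  ∑-+ f g []       = sym (+-identityˡ 0#)
  ∑-+ f g (x ∷ xs) = trans (+-congˡ (∑-+ f g xs)) (+-interchange _ _ _ _)

  ∑-*ˡ : ∀ k (f : A → Carrier) xs → k * ∑ (map f xs) ≈ ∑ (map (λ x → k * f x) xs)
  ∑-*ˡ k f []       = zeroʳ k
  ∑-*ˡ k f (x ∷ xs) = trans (distribˡ k _ _) (+-congˡ (∑-*ˡ k f xs))

  ∑-*ʳ : ∀ k (f : A → Carrier) xs → ∑ (map f xs) * k ≈ ∑ (map (λ x → f x * k) xs)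
  ∑-*ʳ k f []       = zeroˡ k
  ∑-*ʳ k f (x ∷ xs) = trans (distribʳ k _ _) (+-congˡ (∑-*ʳ k f xs))

  ∑-neg : ∀ (f : A → Carrier) xs → - ∑ (map f xs) ≈ ∑ (map (λ x → - f x) xs)
  ∑-neg f []       = -0#≈0#
  ∑-neg f (x ∷ xs) = trans (sym (-‿+-comm _ _)) (+-congˡ (∑-neg f xs))

  ∑-swap : ∀ (f : A → B → Carrier) xs ys →
    ∑ (map (λ x → ∑ (map (f x) ys)) xs) ≈ ∑ (map (λ y → ∑ (map (λ x → f x y) xs)) ys)
  ∑-swap f []       ys = sym (∑-zero ys (λ _ → refl))
  ∑-swap f (x ∷ xs) ys = trans (+-congˡ (∑-swap f xs ys)) (sym (∑-+ _ _ ys))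

  ∑-++ : ∀ xs ys → ∑ (xs ++ ys) ≈ ∑ xs + ∑ ys
  ∑-++ []       ys = sym (+-identityˡ _)
  ∑-++ (x ∷ xs) ys = trans (+-congˡ (∑-++ xs ys)) (sym (+-assoc _ _ _))

  ∑-map-∘ : ∀ (f : B → Carrier) (g : A → B) xs → ∑ (map f (map g xs)) ≡ ∑ (map (f ∘ g) xs)
  ∑-map-∘ f g xs = ≡.cong ∑ (≡.sym (List.map-∘ xs))

  ∑-allFin : ∀ {n} (f : Fin (suc n) → Carrier) →
    ∑ (map f (allFin (suc n))) ≡ f zero + ∑ (map (f ∘ suc) (allFin n))
  ∑-allFin f = ≡.cong (λ xs → f zero + ∑ xs)
    (≡.trans (List.map-tabulate suc f) (≡.sym (List.map-tabulate id (f ∘ suc))))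

  ∏-allFin : ∀ {n} (f : Fin (suc n) → Carrier) →
    ∏ (map f (allFin (suc n))) ≡ f zero * ∏ (map (f ∘ suc) (allFin n))
  ∏-allFin f = ≡.cong (λ xs → f zero * ∏ xs)
    (≡.trans (List.map-tabulate suc f) (≡.sym (List.map-tabulate id (f ∘ suc))))

  ∑-cartesianProductWith : ∀ {C : Set p} (F : C → Carrier) (g : A → B → C) xs ys →
    ∑ (map F (cartesianProductWith g xs ys)) ≈ ∑ (map (λ x → ∑ (map (F ∘ g x) ys)) xs)
  ∑-cartesianProductWith F g []       ys = refl
  ∑-cartesianProductWith F g (x ∷ xs) ys = begin
    ∑ (map F (map (g x) ys ++ cartesianProductWith g xs ys))
      ≡⟨ ≡.cong ∑ (List.map-++ F (map (g x) ys) _) ⟩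
    ∑ (map F (map (g x) ys) ++ map F (cartesianProductWith g xs ys))
      ≈⟨ ∑-++ (map F (map (g x) ys)) _ ⟩
    ∑ (map F (map (g x) ys)) + ∑ (map F (cartesianProductWith g xs ys))
      ≈⟨ +-cong (reflexive (∑-map-∘ F (g x) ys)) (∑-cartesianProductWith F g xs ys) ⟩
    _ ∎

  ∑-filter : ∀ {P : A → Set p} (P? : Decidable P) (f : A → Carrier) xs →
    ∑ (map f (filter P? xs)) ≈ ∑ (map (λ x → if does (P? x) then f x else 0#) xs)
  ∑-filter P? f [] = refl
  ∑-filter P? f (x ∷ xs) with does (P? x)
  ... | true  = +-congˡ (∑-filter P? f xs)
  ... | false = trans (∑-filter P? f xs) (sym (+-identityˡ _))

  ∑-mapMaybe : ∀ (f : B → Carrier) (g : A → Maybe B) xs → ∑ (map f (mapMaybe g xs)) ≈ ∑ (map (maybe f 0# ∘ g) xs)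
  ∑-mapMaybe f g []       = refl
  ∑-mapMaybe f g (x ∷ xs) with g x
  ... | just y  = +-congˡ (∑-mapMaybe f g xs)
  ... | nothing = trans (∑-mapMaybe f g xs) (sym (+-identityˡ _))

  ∑-const-count : ∀ {P : A → Set p} (P? : Decidable P) k xs →
    ∑ (map (λ x → if does (P? x) then k else 0#) xs) ≈ length (filter P? xs) · k
  ∑-const-count P? k [] = refl
  ∑-const-count P? k (x ∷ xs) with does (P? x)
  ... | true  = +-congˡ (∑-const-count P? k xs)
  ... | false = trans (+-identityˡ _) (∑-const-count P? k xs)

  ∑-applyUpTo-cong : ∀ (f g : ℕ → Carrier) n → (∀ k → k ℕ.< n → f k ≈ g k) →
    ∑ (applyUpTo f n) ≈ ∑ (applyUpTo g n)
  ∑-applyUpTo-cong f g zero    e = refl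
  ∑-applyUpTo-cong f g (suc n) e = +-cong (e 0 (s≤s z≤n)) (∑-applyUpTo-cong (f ∘ suc) (g ∘ suc) n (λ k k<n → e (suc k) (s≤s k<n)))

  ∑-applyUpTo-zero : ∀ (f : ℕ → Carrier) n → (∀ k → k ℕ.< n → f k ≈ 0#) → ∑ (applyUpTo f n) ≈ 0#
  ∑-applyUpTo-zero f zero    e = refl
  ∑-applyUpTo-zero f (suc n) e =
    trans (+-cong (e 0 (s≤s z≤n)) (∑-applyUpTo-zero (f ∘ suc) n (λ k k<n → e (suc k) (s≤s k<n)))) (+-identityˡ 0#)

  ∑-applyUpTo-last : ∀ (f : ℕ → Carrier) n → ∑ (applyUpTo f (suc n)) ≈ ∑ (applyUpTo f n) + f n
  ∑-applyUpTo-last f zero    = +-comm _ _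
  ∑-applyUpTo-last f (suc n) = trans (+-congˡ (∑-applyUpTo-last (f ∘ suc) n)) (sym (+-assoc _ _ _))

  sign-suc : ∀ k → (- 1#) ^ suc k ≈ - ((- 1#) ^ k)
  sign-suc k = -1*x≈-x _

  ^-cong : ∀ {x y} k → x ≈ y → x ^ k ≈ y ^ k
  ^-cong zero    e = refl
  ^-cong (suc k) e = *-cong e (^-cong k e)

module RingKit (R : CommutativeRing c ℓ) where
  open CommutativeRing R public hiding (zero)
  open Sums rawRing public
  open SumProperties R public
  open SetoidReasoning setoid public

-- Laws of a map out of a raw ring whose equality it need not respect.
record RingLaws (R : RawRing a ℓ) (S : CommutativeRing c ℓ′) (φ : RawRing.Carrier R → CommutativeRing.Carrier S)
  : Set (a ⊔ ℓ′) where
  private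
    module R = RawRing R
    module S = CommutativeRing S
  field
    0#-homo : φ R.0# S.≈ S.0#
    1#-homo : φ R.1# S.≈ S.1#
    +-homo  : ∀ x y → φ (x R.+ y) S.≈ φ x S.+ φ y
    *-homo  : ∀ x y → φ (x R.* y) S.≈ φ x S.* φ y
    -‿homo  : ∀ x → φ (R.- x) S.≈ S.- φ x

module RingLawsProperties
  {R : RawRing a ℓ} {S : CommutativeRing c ℓ′} {φ : RawRing.Carrier R → CommutativeRing.Carrier S}
  (laws : RingLaws R S φ) where
  private
    module R = RawRing R
    module R∑ = Sums R
    module S = RingKit S
    module Rᴹ = Matrices R
    module Sᴹ = Matrices S.rawRing
  open RingLaws laws

  ∑-homo : ∀ xs → φ (R∑.∑ xs) S.≈ S.∑ (map φ xs)
  ∑-homo []       = 0#-homo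
  ∑-homo (x ∷ xs) = S.trans (+-homo x _) (S.+-congˡ (∑-homo xs))

  ∑-map-homo : ∀ (f : A → R.Carrier) xs → φ (R∑.∑ (map f xs)) S.≈ S.∑ (map (φ ∘ f) xs)
  ∑-map-homo f xs = S.trans (∑-homo (map f xs)) (S.reflexive (S.∑-map-∘ φ f xs))

  ^-homo : ∀ x k → φ (x R∑.^ k) S.≈ φ x S.^ k
  ^-homo x zero    = 1#-homo
  ^-homo x (suc k) = S.trans (*-homo x _) (S.*-congˡ (^-homo x k))

  sign-homo : ∀ k → φ ((R.- R.1#) R∑.^ k) S.≈ (S.- S.1#) S.^ k
  sign-homo k = S.trans (^-homo (R.- R.1#) k) (S.^-cong k (S.trans (-‿homo R.1#) (S.-‿cong 1#-homo)))

  ×-homo : ∀ k x → φ (k R∑.· x) S.≈ k S.· φ x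
  ×-homo zero    x = 0#-homo
  ×-homo (suc k) x = S.trans (+-homo x _) (S.+-congˡ (×-homo k x))

  det-homo : ∀ {n} (M : Rᴹ.Matrix n) → φ (Rᴹ.det M) S.≈ Sᴹ.det (λ i j → φ (M i j))
  det-homo {zero}  M = 1#-homo
  det-homo {suc n} M = S.trans (∑-map-homo _ (allFin (suc n))) (S.∑-cong (allFin (suc n)) λ j →
    S.trans (*-homo _ _) (S.*-cong (S.trans (*-homo _ _) (S.*-congʳ (sign-homo (toℕ j))))
      (det-homo (λ i k → M (suc i) (punchIn j k)))))

-- Determinants

module Determinants (R : CommutativeRing c ℓ) where
  open RingKit R
  open Matrices rawRing

  sgn : ∀ {n} → Fin n → Carrier
  sgn j = (- 1#) ^ toℕ j

  minor : ∀ {n} → (Fin n → Fin (suc n) → Carrier) → Fin (suc n) → Carrier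
  minor B j = det (λ i l → B i (punchIn j l))

  det-cong : ∀ {n} {M N : Matrix n} → (∀ i j → M i j ≈ N i j) → det M ≈ det N
  det-cong {zero}  e = refl
  det-cong {suc n} e = ∑-cong (allFin (suc n)) λ j →
    *-cong (*-congˡ (e zero j)) (det-cong (λ i k → e (suc i) (punchIn j k)))

  -- Setting ε to 0 turns the row of the first vertex into a unit row; this is the step that
  -- descends to the remaining vertices.
  det-collapse : ∀ {n} (M : Matrix (suc n)) → M zero zero ≈ 1# → (∀ j → M zero (suc j) ≈ 0#) →
    det M ≈ det (λ i k → M (suc i) (suc k))
  det-collapse {n} M e₁ e₀ = begin
    det M
      ≡⟨ ∑-allFin (λ j → sgn j * M zero j * minor (M ∘ suc) j) ⟩
    1# * M zero zero * det M′ + ∑ (map (λ j → sgn (suc j) * M zero (suc j) * minor (M ∘ suc) (suc j)) (allFin n))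
      ≈⟨ +-cong (*-congʳ (trans (*-identityˡ _) e₁)) (∑-zero (allFin n) λ j →
           trans (*-congʳ (trans (*-congˡ (e₀ j)) (zeroʳ _))) (zeroˡ _)) ⟩
    1# * det M′ + 0#
      ≈⟨ trans (+-identityʳ _) (*-identityˡ _) ⟩
    det M′ ∎
    where M′ = λ i k → M (suc i) (suc k)

  det-I : ∀ n → det (I {n}) ≈ 1#
  det-I zero    = refl
  det-I (suc n) = trans (det-collapse (I {suc n}) refl (λ _ → refl)) (det-I n)

  -- The double Laplace expansion: removing columns p < q in either order gives
  -- the same minor with opposite signs.
  symmetric-cancels : ∀ n (ω : Fin (2 ℕ.+ n) → Fin (2 ℕ.+ n) → Carrier) → (∀ p q → ω p q ≈ ω q p) →
    (G : (Fin n → Fin (2 ℕ.+ n)) → Carrier) → (∀ {g h} → (∀ l → g l ≡ h l) → G g ≈ G h) →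
    ∑ (map (λ j → ∑ (map (λ k →
        sgn j * sgn k * (ω j (punchIn j k) * G (λ l → punchIn j (punchIn k l)))) (allFin (suc n))))
      (allFin (2 ℕ.+ n))) ≈ 0#
  symmetric-cancels n ω ω-sym G G-ext = begin
    ∑ (map (λ j → ∑ (map (H j) (allFin (suc n)))) (allFin (2 ℕ.+ n)))
      ≡⟨ ∑-allFin (λ j → ∑ (map (H j) (allFin (suc n)))) ⟩
    ∑ (map (H zero) (allFin (suc n))) + ∑ (map (λ j → ∑ (map (H (suc j)) (allFin (suc n)))) (allFin (suc n)))
      ≈⟨ +-congˡ (trans (∑-cong (allFin (suc n)) (λ j → reflexive (∑-allFin (H (suc j)))))
                        (∑-+ _ _ (allFin (suc n)))) ⟩
    ∑ (map (H zero) (allFin (suc n))) + (∑ (map (λ j → H (suc j) zero) (allFin (suc n))) + rest n ω ω-sym G G-ext)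
      ≈⟨ +-assoc _ _ _ ⟨
    ∑ (map (H zero) (allFin (suc n))) + ∑ (map (λ j → H (suc j) zero) (allFin (suc n))) + rest n ω ω-sym G G-ext
      ≈⟨ +-cong (trans (sym (∑-+ _ _ (allFin (suc n)))) (∑-zero (allFin (suc n)) pair))
                (rest≈0 n ω ω-sym G G-ext) ⟩
    0# + 0#
      ≈⟨ +-identityˡ 0# ⟩
    0# ∎
    where
      H : Fin (2 ℕ.+ n) → Fin (suc n) → Carrier
      H j k = sgn j * sgn k * (ω j (punchIn j k) * G (λ l → punchIn j (punchIn k l)))

      -- Removing column zero first or second leaves the same columns; the position of the other
      -- column drops by one in between, whence the opposite signs.
      pair : ∀ k → H zero k + H (suc k) zero ≈ 0#
      pair k = begin
        1# * sgn k * (ω zero (suc k) * g) + sgn (suc k) * 1# * (ω (suc k) zero * g)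
          ≈⟨ +-cong (*-congʳ (*-identityˡ _))
                    (*-cong (trans (*-identityʳ _) (sign-suc (toℕ k))) (*-congʳ (ω-sym _ _))) ⟩
        sgn k * (ω zero (suc k) * g) + - sgn k * (ω zero (suc k) * g)
          ≈⟨ distribʳ _ _ _ ⟨
        (sgn k + - sgn k) * (ω zero (suc k) * g)
          ≈⟨ trans (*-congʳ (-‿inverseʳ _)) (zeroˡ _) ⟩
        0# ∎
        where g = G (λ l → suc (punchIn k l))

      -- Both removed columns are nonzero here. The data are arguments again so that `rest≈0` can
      -- split on the number of columns and recurse.
      rest : ∀ n (ω : Fin (2 ℕ.+ n) → Fin (2 ℕ.+ n) → Carrier) → (∀ p q → ω p q ≈ ω q p) →
        (G : (Fin n → Fin (2 ℕ.+ n)) → Carrier) → (∀ {g h} → (∀ l → g l ≡ h l) → G g ≈ G h) → Carrier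
      rest n ω _ G _ = ∑ (map (λ j → ∑ (map (λ k →
        sgn (suc j) * sgn (suc k) * (ω (suc j) (punchIn (suc j) (suc k)) *
          G (λ l → punchIn (suc j) (punchIn (suc k) l)))) (allFin n))) (allFin (suc n)))

      rest≈0 : ∀ n ω ω-sym G (G-ext : ∀ {g h} → (∀ l → g l ≡ h l) → G g ≈ G h) → rest n ω ω-sym G G-ext ≈ 0#
      rest≈0 zero    ω ω-sym G G-ext = ∑-zero (allFin 1) (λ _ → refl)
      rest≈0 (suc n) ω ω-sym G G-ext =
        trans (∑-cong (allFin (2 ℕ.+ n)) λ j → ∑-cong (allFin (suc n)) λ k →
                 *-cong (signs j k) (*-congˡ (G-ext λ { zero → ≡.refl ; (suc l) → ≡.refl })))
          (symmetric-cancels n (λ p q → ω (suc p) (suc q)) (λ p q → ω-sym _ _)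
            -- Column zero is kept by all these minors, so a choice among the later columns is
            -- extended by fixing zero. The two selections agree only pointwise, which is why G is
            -- assumed extensional.
            (λ g → G (λ { zero → zero ; (suc l) → suc (g l) }))
            (λ e → G-ext (λ { zero → ≡.refl ; (suc l) → ≡.cong suc (e l) })))
        where
          signs : ∀ (j : Fin (2 ℕ.+ n)) (k : Fin (suc n)) → sgn (suc j) * sgn (suc k) ≈ sgn j * sgn k
          signs j k = begin
            sgn (suc j) * sgn (suc k)   ≈⟨ *-cong (sign-suc (toℕ j)) (sign-suc (toℕ k)) ⟩
            - sgn j * - sgn k           ≈⟨ -‿distribˡ-* _ _ ⟨
            - (sgn j * - sgn k)         ≈⟨ -‿cong (-‿distribʳ-* _ _) ⟨
            - - (sgn j * sgn k)         ≈⟨ -‿involutive _ ⟩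
            sgn j * sgn k               ∎

  private
    expand : ∀ {n} (u v : Fin (2 ℕ.+ n) → Carrier) (D : Fin (2 ℕ.+ n) → Fin (suc n) → Carrier) →
      ∑ (map (λ j → sgn j * u j * ∑ (map (λ k → sgn k * v (punchIn j k) * D j k) (allFin (suc n)))) (allFin (2 ℕ.+ n)))
      ≈ ∑ (map (λ j → ∑ (map (λ k → sgn j * sgn k * (u j * v (punchIn j k) * D j k)) (allFin (suc n)))) (allFin (2 ℕ.+ n)))
    expand {n} u v D = ∑-cong (allFin (2 ℕ.+ n)) λ j → trans (∑-*ˡ _ _ (allFin (suc n)))
      (∑-cong (allFin (suc n)) λ k → begin
        sgn j * u j * (sgn k * v (punchIn j k) * D j k)    ≈⟨ *-assoc _ _ _ ⟨
        sgn j * u j * (sgn k * v (punchIn j k)) * D j k    ≈⟨ *-congʳ (*-interchange _ _ _ _) ⟩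
        sgn j * sgn k * (u j * v (punchIn j k)) * D j k    ≈⟨ *-assoc _ _ _ ⟩
        sgn j * sgn k * (u j * v (punchIn j k) * D j k)    ∎)

  -- The sum is the determinant of B with a copy of row k put on top. Expanding along the two top
  -- rows u and v weights the columns p and q by `u p * v q`, and `symmetric-cancels` applies as
  -- soon as this is symmetric, as it is for k = 0.
  repeated-row : ∀ {n} (B : Fin n → Fin (suc n) → Carrier) k →
    ∑ (map (λ j → sgn j * B k j * minor B j) (allFin (suc n))) ≈ 0#
  repeated-row {suc n} B zero = trans (expand (B zero) (B zero) D)
    (symmetric-cancels n (λ p q → B zero p * B zero q) (λ p q → *-comm _ _)
      (λ g → det (λ i l → B (suc i) (g l)))
      (λ e → det-cong (λ i l → reflexive (≡.cong (B (suc i)) (e l)))))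
    where
      D : Fin (2 ℕ.+ n) → Fin (suc n) → Carrier
      D j k = det (λ i l → B (suc i) (punchIn j (punchIn k l)))
  repeated-row {suc n} B (suc k) = begin
    E (B (suc k)) (B zero)
      ≈⟨ +-identityʳ _ ⟨
    E (B (suc k)) (B zero) + 0#
      -- For other k the weight is not symmetric. Adding the expansion with the two rows exchanged
      -- makes it so, and that expansion is zero: its inner sums repeat row k of a smaller matrix.
      ≈⟨ +-congˡ (∑-zero (allFin (2 ℕ.+ n)) (λ j →
           trans (*-congˡ (repeated-row (λ i l → B (suc i) (punchIn j l)) k)) (zeroʳ _))) ⟨
    E (B (suc k)) (B zero) + E (B zero) (B (suc k))
      ≈⟨ +-cong (expand (B (suc k)) (B zero) D) (expand (B zero) (B (suc k)) D) ⟩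
    _
      ≈⟨ trans (∑-cong (allFin (2 ℕ.+ n)) (λ j → trans (∑-cong (allFin (suc n)) λ l →
                  trans (*-congˡ (distribʳ _ _ _)) (distribˡ _ _ _)) (∑-+ _ _ (allFin (suc n)))))
               (∑-+ _ _ (allFin (2 ℕ.+ n))) ⟨
    _
      ≈⟨ symmetric-cancels n (λ p q → B (suc k) p * B zero q + B zero p * B (suc k) q)
           (λ p q → trans (+-cong (*-comm _ _) (*-comm _ _)) (+-comm _ _))
           (λ g → det (λ i l → B (suc i) (g l)))
           (λ e → det-cong (λ i l → reflexive (≡.cong (B (suc i)) (e l)))) ⟩
    0# ∎
    where
      D : Fin (2 ℕ.+ n) → Fin (suc n) → Carrier
      D j k = det (λ i l → B (suc i) (punchIn j (punchIn k l)))

      E : (u v : Fin (2 ℕ.+ n) → Carrier) → Carrier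
      E u v = ∑ (map (λ j → sgn j * u j *
        ∑ (map (λ k → sgn k * v (punchIn j k) * D j k) (allFin (suc n)))) (allFin (2 ℕ.+ n)))

  -- The top row ρ is e times the first unit row plus the combination y of the rows below. The
  -- combination contributes determinants with a repeated row, so only the pivot e survives.
  eliminated-row : ∀ {n} (B : Fin n → Fin (suc n) → Carrier) (ρ : Fin (suc n) → Carrier) (y : Fin n → Carrier) e →
    (ρ zero ≈ e + ∑ (map (λ k → y k * B k zero) (allFin n))) →
    (∀ l → ρ (suc l) ≈ ∑ (map (λ k → y k * B k (suc l)) (allFin n))) →
    ∑ (map (λ j → sgn j * ρ j * minor B j) (allFin (suc n))) ≈ e * minor B zero
  eliminated-row {n} B ρ y e ρ₀ ρₛ = begin
    ∑ (map (λ j → sgn j * ρ j * minor B j) (allFin (suc n)))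
      ≡⟨ ∑-allFin (λ j → sgn j * ρ j * minor B j) ⟩
    1# * ρ zero * minor B zero + ∑ (map (λ l → sgn (suc l) * ρ (suc l) * minor B (suc l)) (allFin n))
      ≈⟨ +-cong (trans (*-congʳ (trans (*-congˡ ρ₀) (trans (distribˡ _ _ _) (+-congʳ (*-identityˡ _)))))
                       (distribʳ _ _ _))
                (∑-cong (allFin n) λ l → *-congʳ (*-congˡ (ρₛ l))) ⟩
    e * minor B zero + T zero + ∑ (map (T ∘ suc) (allFin n))
      ≈⟨ +-assoc _ _ _ ⟩
    e * minor B zero + (T zero + ∑ (map (T ∘ suc) (allFin n)))
      ≡⟨ ≡.cong (e * minor B zero +_) (∑-allFin T) ⟨
    e * minor B zero + ∑ (map T (allFin (suc n)))
      ≈⟨ +-congˡ (begin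
        ∑ (map T (allFin (suc n)))
          ≈⟨ ∑-cong (allFin (suc n)) (λ j → trans (*-congʳ (∑-*ˡ _ _ (allFin n))) (trans (∑-*ʳ _ _ (allFin n))
               (∑-cong (allFin n) λ k → trans (*-congʳ (*-swapˡ _ _ _)) (*-assoc _ _ _)))) ⟩
        ∑ (map (λ j → ∑ (map (λ k → y k * (sgn j * B k j * minor B j)) (allFin n))) (allFin (suc n)))
          ≈⟨ ∑-swap (λ j k → y k * (sgn j * B k j * minor B j)) (allFin (suc n)) (allFin n) ⟩
        ∑ (map (λ k → ∑ (map (λ j → y k * (sgn j * B k j * minor B j)) (allFin (suc n)))) (allFin n))
          ≈⟨ ∑-zero (allFin n) (λ k → trans (sym (∑-*ˡ _ _ (allFin (suc n))))
               (trans (*-congˡ (repeated-row B k)) (zeroʳ _))) ⟩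
        0# ∎) ⟩
    e * minor B zero + 0#
      ≈⟨ +-identityʳ _ ⟩
    e * minor B zero ∎
    where
      T : Fin (suc n) → Carrier
      T j = sgn j * ∑ (map (λ k → y k * B k j) (allFin n)) * minor B j

-- Dual numbers and power series

module Dual (R : CommutativeRing c ℓ) where
  open RingKit R hiding (isCommutativeRing)

  -- R[ε] with ε² = 0; (a , b) stands for a + b ε.
  dualRing : CommutativeRing c ℓ
  dualRing = record
    { Carrier = Carrier × Carrier
    ; _≈_     = Pointwise _≈_ _≈_
    ; _+_     = λ (a , b) (c , d) → a + c , b + d
    ; _*_     = λ (a , b) (c , d) → a * c , a * d + b * c
    ; -_      = λ (a , b) → - a , - b
    ; 0#      = 0# , 0#
    ; 1#      = 1# , 0#
    ; isCommutativeRing = record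
      { isRing = record
        { +-isAbelianGroup = +-AbelianGroup.isAbelianGroup
        ; *-cong     = λ (e , f) (g , h) → *-cong e g , +-cong (*-cong e h) (*-cong f g)
        ; *-assoc    = λ (a , b) (c , d) (e , f) → *-assoc a c e , (begin
            a * c * f + (a * d + b * c) * e        ≈⟨ +-cong (*-assoc _ _ _) (distribʳ _ _ _) ⟩
            a * (c * f) + (a * d * e + b * c * e)  ≈⟨ +-assoc _ _ _ ⟨
            a * (c * f) + a * d * e + b * c * e    ≈⟨ +-cong (+-congˡ (*-assoc _ _ _)) (*-assoc _ _ _) ⟩
            a * (c * f) + a * (d * e) + b * (c * e) ≈⟨ +-congʳ (distribˡ _ _ _) ⟨
            a * (c * f + d * e) + b * (c * e)      ∎)
        ; *-identity = (λ (a , b) → *-identityˡ a , trans (+-cong (*-identityˡ b) (zeroˡ a)) (+-identityʳ b))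
                     , (λ (a , b) → *-identityʳ a , trans (+-cong (zeroʳ a) (*-identityʳ b)) (+-identityˡ b))
        ; distrib    = (λ (a , b) (c , d) (e , f) → distribˡ a c e ,
                          trans (+-cong (distribˡ _ _ _) (distribˡ _ _ _)) (+-interchange _ _ _ _))
                     , (λ (a , b) (c , d) (e , f) → distribʳ a c e ,
                          trans (+-cong (distribʳ _ _ _) (distribʳ _ _ _)) (+-interchange _ _ _ _))
        }
      ; *-comm = λ (a , b) (c , d) → *-comm a c , trans (+-comm _ _) (+-cong (*-comm b c) (*-comm a d))
      }
    }
    where
      module +-AbelianGroup = AbelianGroup (DirectProduct.abelianGroup +-abelianGroup +-abelianGroup)

  proj₁-laws : RingLaws (CommutativeRing.rawRing dualRing) R proj₁
  proj₁-laws = record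
    { 0#-homo = refl ; 1#-homo = refl ; +-homo = λ _ _ → refl ; *-homo = λ _ _ → refl ; -‿homo = λ _ → refl }

  inj : Carrier → Carrier × Carrier
  inj a = a , 0#

  inj-laws : RingLaws rawRing dualRing inj
  inj-laws = record
    { 0#-homo = refl , refl
    ; 1#-homo = refl , refl
    ; +-homo  = λ _ _ → refl , sym (+-identityˡ 0#)
    ; *-homo  = λ _ _ → refl , sym (trans (+-cong (zeroʳ _) (zeroˡ _)) (+-identityˡ 0#))
    ; -‿homo  = λ _ → refl , sym -0#≈0#
    }

module Series (R : CommutativeRing c ℓ) where
  open RingKit R
  open PowerSeries rawRing using (Series)
  private
    module P = RawRing (PowerSeries.rawRing rawRing)
    module PS = PowerSeries rawRing

  -- By definition `(f * g) (suc m)` unfolds to `f 0 * g (suc m) + (tail f * g) m`. The laws of the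
  -- Cauchy product are inductions along this recursion.
  tail : Series → Series
  tail f m = f (suc m)

  private
    0-at : ∀ m → P.0# m ≈ 0#
    0-at zero    = refl
    0-at (suc m) = refl

    *-at-0 : ∀ f g → (f P.* g) 0 ≈ f 0 * g 0
    *-at-0 f g = +-identityʳ _

    *-cong′ : ∀ {f f′ g g′} → f P.≈ f′ → g P.≈ g′ → f P.* g P.≈ f′ P.* g′
    *-cong′ {f} {f′} {g} {g′} e e′ m =
      ∑-applyUpTo-cong (λ k → f k * g (m ∸ k)) (λ k → f′ k * g′ (m ∸ k)) (suc m) (λ k _ → *-cong (e k) (e′ (m ∸ k)))

    distribˡ′ : ∀ f g h → f P.* (g P.+ h) P.≈ (f P.* g) P.+ (f P.* h)
    distribˡ′ f g h zero    = trans (+-identityʳ _) (trans (distribˡ _ _ _) (sym (+-cong (+-identityʳ _) (+-identityʳ _))))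
    distribˡ′ f g h (suc m) = trans (+-cong (distribˡ _ _ _) (distribˡ′ (tail f) g h m)) (+-interchange _ _ _ _)

    distribʳ′ : ∀ f g h → (g P.+ h) P.* f P.≈ (g P.* f) P.+ (h P.* f)
    distribʳ′ f g h zero    = trans (+-identityʳ _) (trans (distribʳ _ _ _) (sym (+-cong (+-identityʳ _) (+-identityʳ _))))
    distribʳ′ f g h (suc m) = trans (+-cong (distribʳ _ _ _) (distribʳ′ f (tail g) (tail h) m)) (+-interchange _ _ _ _)

    scale-* : ∀ k f g m → ((λ i → k * f i) P.* g) m ≈ k * (f P.* g) m
    scale-* k f g zero    = trans (+-cong (*-assoc _ _ _) (sym (zeroʳ k))) (sym (distribˡ _ _ _))
    scale-* k f g (suc m) = trans (+-cong (*-assoc _ _ _) (scale-* k (tail f) g m)) (sym (distribˡ _ _ _))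

    *-assoc′ : ∀ f g h → (f P.* g) P.* h P.≈ f P.* (g P.* h)
    *-assoc′ f g h zero = begin
      (f P.* g) 0 * h 0 + 0#   ≈⟨ +-congʳ (*-congʳ (*-at-0 f g)) ⟩
      f 0 * g 0 * h 0 + 0#     ≈⟨ +-congʳ (*-assoc _ _ _) ⟩
      f 0 * (g 0 * h 0) + 0#   ≈⟨ +-congʳ (*-congˡ (*-at-0 g h)) ⟨
      f 0 * (g P.* h) 0 + 0#   ∎
    *-assoc′ f g h (suc m) = begin
      (f P.* g) 0 * h (suc m) + (((λ i → f 0 * tail g i) P.+ (tail f P.* g)) P.* h) m
        ≈⟨ +-cong (trans (*-congʳ (*-at-0 f g)) (*-assoc _ _ _)) (distribʳ′ h (λ i → f 0 * tail g i) (tail f P.* g) m) ⟩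
      f 0 * (g 0 * h (suc m)) + (((λ i → f 0 * tail g i) P.* h) m + ((tail f P.* g) P.* h) m)
        ≈⟨ +-congˡ (+-cong (scale-* (f 0) (tail g) h m) (*-assoc′ (tail f) g h m)) ⟩
      f 0 * (g 0 * h (suc m)) + (f 0 * (tail g P.* h) m + (tail f P.* (g P.* h)) m)
        ≈⟨ +-assoc _ _ _ ⟨
      f 0 * (g 0 * h (suc m)) + f 0 * (tail g P.* h) m + (tail f P.* (g P.* h)) m
        ≈⟨ +-congʳ (distribˡ _ _ _) ⟨
      f 0 * (g P.* h) (suc m) + (tail f P.* (g P.* h)) m ∎

    -- The mirror image of the defining recursion, splitting off the head of the right factor;
    -- comparing the two gives commutativity.
    *-tailʳ : ∀ f g m → (f P.* g) (suc m) ≈ f (suc m) * g 0 + (f P.* tail g) m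
    *-tailʳ f g zero    = begin
      f 0 * g 1 + (f 1 * g 0 + 0#)  ≈⟨ +-cong (sym (+-identityʳ _)) (+-identityʳ _) ⟩
      f 0 * g 1 + 0# + f 1 * g 0    ≈⟨ +-comm _ _ ⟩
      f 1 * g 0 + (f 0 * g 1 + 0#)  ∎
    *-tailʳ f g (suc m) = begin
      f 0 * g (2 ℕ.+ m) + (tail f P.* g) (suc m)
        ≈⟨ +-congˡ (*-tailʳ (tail f) g m) ⟩
      f 0 * g (2 ℕ.+ m) + (f (2 ℕ.+ m) * g 0 + (tail f P.* tail g) m)
        ≈⟨ +-assoc _ _ _ ⟨
      f 0 * g (2 ℕ.+ m) + f (2 ℕ.+ m) * g 0 + (tail f P.* tail g) m
        ≈⟨ +-congʳ (+-comm _ _) ⟩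
      f (2 ℕ.+ m) * g 0 + f 0 * g (2 ℕ.+ m) + (tail f P.* tail g) m
        ≈⟨ +-assoc _ _ _ ⟩
      f (2 ℕ.+ m) * g 0 + (f P.* tail g) (suc m) ∎

    *-comm′ : ∀ f g → f P.* g P.≈ g P.* f
    *-comm′ f g zero    = +-congʳ (*-comm _ _)
    *-comm′ f g (suc m) = begin
      f 0 * g (suc m) + (tail f P.* g) m  ≈⟨ +-cong (*-comm _ _) (*-comm′ (tail f) g m) ⟩
      g (suc m) * f 0 + (g P.* tail f) m  ≈⟨ *-tailʳ g f m ⟨
      (g P.* f) (suc m)                   ∎

    identityˡ′ : ∀ f → P.1# P.* f P.≈ f
    identityˡ′ f zero    = trans (+-identityʳ _) (*-identityˡ _)
    identityˡ′ f (suc m) = trans (+-cong (*-identityˡ _)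
      (∑-applyUpTo-zero (λ k → 0# * f (m ∸ k)) (suc m) (λ k _ → zeroˡ _))) (+-identityʳ _)

    +-isAbelianGroup′ : IsAbelianGroup P._≈_ P._+_ P.0# P.-_
    +-isAbelianGroup′ = record
      { isGroup = record
        { isMonoid = record
          { isSemigroup = record
            { isMagma = record
              { isEquivalence = record
                { refl  = λ _ → refl
                ; sym   = λ e m → sym (e m)
                ; trans = λ e e′ m → trans (e m) (e′ m)
                }
              ; ∙-cong = λ e e′ m → +-cong (e m) (e′ m)
              }
            ; assoc = λ f g h m → +-assoc (f m) (g m) (h m)
            }
          ; identity = (λ f m → trans (+-congʳ (0-at m)) (+-identityˡ _))
                     , (λ f m → trans (+-congˡ (0-at m)) (+-identityʳ _))
          }
        ; inverse = (λ f m → trans (-‿inverseˡ (f m)) (sym (0-at m)))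
                  , (λ f m → trans (-‿inverseʳ (f m)) (sym (0-at m)))
        ; ⁻¹-cong = λ e m → -‿cong (e m)
        }
      ; comm = λ f g m → +-comm (f m) (g m)
      }

  seriesRing : CommutativeRing c ℓ
  seriesRing = record
    { isCommutativeRing = record
      { isRing = record
        { +-isAbelianGroup = +-isAbelianGroup′
        ; *-cong           = *-cong′
        ; *-assoc          = *-assoc′
        ; *-identity       = identityˡ′ , (λ f m → trans (*-comm′ f P.1# m) (identityˡ′ f m))
        ; distrib          = distribˡ′ , distribʳ′
        }
      ; *-comm = *-comm′
      }
    }

  private module S∑ = Sums (CommutativeRing.rawRing seriesRing)

  ∑-at : ∀ fs m → S∑.∑ fs m ≈ ∑ (map (λ f → f m) fs)
  ∑-at []       m = 0-at m
  ∑-at (f ∷ fs) m = +-congˡ (∑-at fs m)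

  ∑-map-at : ∀ (F : A → Series) xs m → S∑.∑ (map F xs) m ≈ ∑ (map (λ x → F x m) xs)
  ∑-map-at F xs m = trans (∑-at (map F xs) m) (reflexive (∑-map-∘ (λ f → f m) F xs))

  ×-at : ∀ k f m → (k S∑.· f) m ≈ k · f m
  ×-at zero    f m = 0-at m
  ×-at (suc k) f m = +-congˡ (×-at k f m)

  const-* : ∀ k f m → (PS.const k P.* f) m ≈ k * f m
  const-* k f zero    = +-identityʳ _
  const-* k f (suc m) = trans (+-congˡ (∑-applyUpTo-zero (λ k → 0# * f (m ∸ k)) (suc m) (λ k _ → zeroˡ _))) (+-identityʳ _)

  const-laws : RingLaws rawRing seriesRing PS.const
  const-laws = record
    { 0#-homo = λ _ → refl
    ; 1#-homo = λ _ → refl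
    ; +-homo  = λ { x y zero → refl ; x y (suc m) → sym (+-identityˡ 0#) }
    ; *-homo  = λ { x y zero → sym (const-* x (PS.const y) 0)
                  ; x y (suc m) → sym (trans (const-* x (PS.const y) (suc m)) (zeroʳ x)) }
    ; -‿homo  = λ { x zero → refl ; x (suc m) → sym -0#≈0# }
    }

  t-*-0 : ∀ f → (PS.t P.* f) 0 ≈ 0#
  t-*-0 f = trans (+-identityʳ _) (zeroˡ _)

  t-*-suc : ∀ f m → (PS.t P.* f) (suc m) ≈ f m
  t-*-suc f m = begin
    0# * f (suc m) + (tail PS.t P.* f) m   ≈⟨ +-cong (zeroˡ _) (*-cong′ {g = f} {f} tail-t (λ _ → refl) m) ⟩
    0# + (P.1# P.* f) m                    ≈⟨ trans (+-identityˡ _) (identityˡ′ f m) ⟩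
    f m                                    ∎
    where
      tail-t : tail PS.t P.≈ P.1#
      tail-t zero    = refl
      tail-t (suc m) = refl

  at-0-laws : RingLaws (CommutativeRing.rawRing seriesRing) R (λ f → f 0)
  at-0-laws = record
    { 0#-homo = refl ; 1#-homo = refl ; +-homo = λ _ _ → refl ; *-homo = *-at-0 ; -‿homo = λ _ → refl }

  private
    *-vanish : ∀ u g m → u 0 ≈ 0# → (∀ j → j ℕ.≤ m → g j ≈ 0#) → ∀ j → j ℕ.≤ suc m → (u P.* g) j ≈ 0#
    *-vanish u g m u₀ e zero    _         = trans (+-identityʳ _) (trans (*-congʳ u₀) (zeroˡ _))
    *-vanish u g m u₀ e (suc j) (s≤s j≤m) = trans (+-cong (trans (*-congʳ u₀) (zeroˡ _))
      (∑-applyUpTo-zero (λ k → u (suc k) * g (j ∸ k)) (suc j) λ k _ →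
        trans (*-congˡ (e (j ∸ k) (ℕ.≤-trans (ℕ.m∸n≤m j k) j≤m))) (zeroʳ _))) (+-identityˡ 0#)

  -- Each factor u raises the order of vanishing by one, starting from order one for g. This
  -- disposes of the remainder of the telescoping sum in the logarithm.
  ^-*-vanish : ∀ u g m → u 0 ≈ 0# → g 0 ≈ 0# → ∀ j → j ℕ.≤ m → ((u S∑.^ m) P.* g) j ≈ 0#
  ^-*-vanish u g zero    u₀ g₀ .0 z≤n = trans (identityˡ′ g 0) g₀
  ^-*-vanish u g (suc m) u₀ g₀ j j≤m = trans (*-assoc′ u (u S∑.^ m) g j)
    (*-vanish u ((u S∑.^ m) P.* g) m u₀ (^-*-vanish u g m u₀ g₀) j j≤m)

-- Carrying power series and logarithms along ring maps

module SeriesLift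
  {R : RawRing a ℓ} {S : CommutativeRing c ℓ′} {φ : RawRing.Carrier R → CommutativeRing.Carrier S}
  (laws : RingLaws R S φ) where
  private
    module R = RawRing R
    module S = RingKit S
    module RP = PowerSeries R
    module SP = PowerSeries S.rawRing
  open RingLaws laws
  open RingLawsProperties laws
  open Series S using (seriesRing)

  applyUpTo-homo : ∀ (f : ℕ → R.Carrier) n → φ (Sums.∑ R (applyUpTo f n)) S.≈ S.∑ (applyUpTo (φ ∘ f) n)
  applyUpTo-homo f zero    = 0#-homo
  applyUpTo-homo f (suc n) = S.trans (+-homo _ _) (S.+-congˡ (applyUpTo-homo (f ∘ suc) n))

  const-homo : ∀ x m → φ (RP.const x m) S.≈ SP.const (φ x) m
  const-homo x zero    = S.refl
  const-homo x (suc m) = 0#-homo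

  t-homo : ∀ m → φ (RP.t m) S.≈ SP.t m
  t-homo 0             = 0#-homo
  t-homo 1             = 1#-homo
  t-homo (suc (suc m)) = 0#-homo

  series-laws : RingLaws RP.rawRing seriesRing (φ ∘_)
  series-laws = record
    { 0#-homo = λ { zero → 0#-homo ; (suc m) → 0#-homo }
    ; 1#-homo = λ { zero → 1#-homo ; (suc m) → 0#-homo }
    ; +-homo  = λ f g m → +-homo (f m) (g m)
    ; *-homo  = λ f g m → S.trans (applyUpTo-homo (λ k → f k R.* g (m ∸ k)) (suc m))
        (S.∑-applyUpTo-cong (λ k → φ (f k R.* g (m ∸ k))) (λ k → φ (f k) S.* φ (g (m ∸ k))) (suc m) (λ k _ → *-homo (f k) (g (m ∸ k))))
    ; -‿homo  = λ f m → -‿homo (f m)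
    }

-- All that log requires of the map ι : ℚ → R.
LogScalars : (R : CommutativeRing c ℓ) → (ℚ → CommutativeRing.Carrier R) → Set ℓ
LogScalars R ι = ∀ k → suc k · ι ((ℤ.-1ℤ ℤ.^ k) ℚ./ suc k) ≈ (- 1#) ^ k
  where
    open CommutativeRing R
    open Sums rawRing

module _ (R : CommutativeRing c ℓ) (ι : ℚ → CommutativeRing.Carrier R) where
  open RingKit R
  open PowerSeries rawRing using (Series; log)
  private
    module P where
      open RingKit (Series.seriesRing R) public

  log-cong : ∀ {f g : Series} → f P.≈ g → log ι f P.≈ log ι g
  log-cong {f} {g} e m = ∑-applyUpTo-cong
    (λ k → ι ((ℤ.-1ℤ ℤ.^ k) ℚ./ suc k) * ((f P.+ P.- P.1#) P.^ suc k) m)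
    (λ k → ι ((ℤ.-1ℤ ℤ.^ k) ℚ./ suc k) * ((g P.+ P.- P.1#) P.^ suc k) m) m
    (λ k _ → *-congˡ (P.^-cong {f P.+ P.- P.1#} {g P.+ P.- P.1#} (suc k) (λ i → +-congʳ (e i)) m))

module LogLift
  {R : RawRing a ℓ} {S : CommutativeRing c ℓ′} {φ : RawRing.Carrier R → CommutativeRing.Carrier S}
  (laws : RingLaws R S φ) where
  private
    module R = RawRing R
    module S = RingKit S
    module RP where
      open PowerSeries R public
      open RawRing rawRing public using (_+_; -_; 1#)
      open Sums (PowerSeries.rawRing R) public using (_^_)
    module SP where
      open PowerSeries S.rawRing public using (log)
      open RingKit (Series.seriesRing S) public
  open RingLaws laws
  open SeriesLift laws

  log-homo : ∀ (ι : ℚ → R.Carrier) (ι′ : ℚ → S.Carrier) → (∀ q → φ (ι q) S.≈ ι′ q) →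
    ∀ f → (φ ∘ RP.log ι f) SP.≈ SP.log ι′ (φ ∘ f)
  log-homo ι ι′ e f m = S.trans (applyUpTo-homo (λ k → ι (coef k) R.* (u RP.^ suc k) m) m)
    (S.∑-applyUpTo-cong (λ k → φ (ι (coef k) R.* (u RP.^ suc k) m)) (λ k → ι′ (coef k) S.* (u′ SP.^ suc k) m) m
      (λ k _ → S.trans (*-homo _ _) (S.*-cong (e (coef k))
        (SP.trans {φ ∘ (u RP.^ suc k)} {(φ ∘ u) SP.^ suc k} {u′ SP.^ suc k} (L.^-homo u (suc k))
          (SP.^-cong {φ ∘ u} {u′} (suc k) φu≈u′) m))))
    where
      module L = RingLawsProperties series-laws
      coef : ℕ → ℚ
      coef k = (ℤ.-1ℤ ℤ.^ k) ℚ./ suc k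
      u : RP.Series
      u = f RP.+ RP.- RP.1#
      u′ : SP.Carrier
      u′ = (φ ∘ f) SP.+ SP.- SP.1#
      φu≈u′ : (φ ∘ u) SP.≈ u′
      φu≈u′ i = S.trans (+-homo _ _) (S.+-congˡ (S.trans (-‿homo _) (S.-‿cong (RingLaws.1#-homo series-laws i))))

-- The logarithm over the dual numbers

module DualSeries (R : CommutativeRing c ℓ) where
  open RingKit R
  open Dual R
  private
    module D = CommutativeRing dualRing
    module P where
      open RingKit (Series.seriesRing R) public
      open Series R public
    module DP where
      open RingKit (Series.seriesRing dualRing) public

  π₁ π₂ : DP.Carrier → P.Carrier
  π₁ f m = proj₁ (f m)
  π₂ f m = proj₂ (f m)

  π₁-laws : RingLaws DP.rawRing P.seriesRing π₁
  π₁-laws = SeriesLift.series-laws proj₁-laws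
  private module π₁ where
    open RingLaws π₁-laws public
    open RingLawsProperties π₁-laws public

  -- Since ε² = 0, taking the ε-part is a derivation over `π₁`.
  π₂-* : ∀ f g → π₂ (f DP.* g) P.≈ π₁ f P.* π₂ g P.+ π₂ f P.* π₁ g
  π₂-* f g zero    = trans (+-identityʳ _) (sym (+-cong (+-identityʳ _) (+-identityʳ _)))
  π₂-* f g (suc m) = trans (+-congˡ (π₂-* (f ∘ suc) g m)) (+-interchange _ _ _ _)

  π₂-∑ : ∀ (F : A → DP.Carrier) xs → π₂ (DP.∑ (map F xs)) P.≈ P.∑ (map (π₂ ∘ F) xs)
  π₂-∑ F []       zero    = refl
  π₂-∑ F []       (suc m) = refl
  π₂-∑ F (x ∷ xs) m       = +-congˡ (π₂-∑ F xs m)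

  module _ (ι : ℚ → Carrier) (scalars : LogScalars R ι) where

    private
      -- The power rule for this derivation. Its factor k + 1 meets the denominator k + 1 of the
      -- logarithm, and `LogScalars` cancels them.
      π₂-^ : ∀ u k → π₂ (u DP.^ suc k) P.≈ suc k P.· (π₁ u P.^ k P.* π₂ u)
      π₂-^ u zero m = begin
        π₂ (u DP.* DP.1#) m                ≈⟨ proj₂ (DP.*-identityʳ u m) ⟩
        π₂ u m                             ≈⟨ P.*-identityˡ (π₂ u) m ⟨
        (P.1# P.* π₂ u) m                  ≈⟨ P.+-identityʳ (P.1# P.* π₂ u) m ⟨
        (1 P.· (P.1# P.* π₂ u)) m          ∎
      π₂-^ u (suc k) = P.begin
        π₂ (u DP.* u DP.^ suc k)
          P.≈⟨ π₂-* u (u DP.^ suc k) ⟩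
        π₁ u P.* π₂ (u DP.^ suc k) P.+ π₂ u P.* π₁ (u DP.^ suc k)
          P.≈⟨ P.+-cong (P.*-congˡ {π₁ u} (π₂-^ u k)) (P.*-congˡ {π₂ u} (π₁.^-homo u (suc k))) ⟩
        π₁ u P.* (suc k P.· (π₁ u P.^ k P.* π₂ u)) P.+ π₂ u P.* π₁ u P.^ suc k
          P.≈⟨ P.+-cong (P.trans (P.×-comm-* (suc k) (π₁ u) (π₁ u P.^ k P.* π₂ u))
                                 (P.×-congʳ (suc k) (P.sym (P.*-assoc (π₁ u) (π₁ u P.^ k) (π₂ u)))))
                        (P.*-comm (π₂ u) (π₁ u P.^ suc k)) ⟩
        suc k P.· (π₁ u P.^ suc k P.* π₂ u) P.+ π₁ u P.^ suc k P.* π₂ u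
          P.≈⟨ P.+-comm (suc k P.· (π₁ u P.^ suc k P.* π₂ u)) (π₁ u P.^ suc k P.* π₂ u) ⟩
        (2 ℕ.+ k) P.· (π₁ u P.^ suc k P.* π₂ u) P.∎

      -- With v₂ = (1 + v₁) h the partial sums of ∑ (-1)^k v₁^k v₂ telescope.
      telescope : ∀ v₁ v₂ h → v₂ P.≈ h P.+ v₁ P.* h → ∀ n m →
        ∑ (applyUpTo (λ k → (- 1#) ^ k * (v₁ P.^ k P.* v₂) m) n) ≈ h m + - ((- 1#) ^ n * (v₁ P.^ n P.* h) m)
      telescope v₁ v₂ h e zero m = begin
        0#                                  ≈⟨ -‿inverseʳ (h m) ⟨
        h m + - h m                         ≈⟨ +-congˡ (-‿cong (trans (*-identityˡ _) (P.*-identityˡ h m))) ⟨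
        h m + - (1# * (P.1# P.* h) m)       ∎
      telescope v₁ v₂ h e (suc n) m = begin
        ∑ (applyUpTo (λ k → (- 1#) ^ k * (v₁ P.^ k P.* v₂) m) (suc n))
          ≈⟨ ∑-applyUpTo-last (λ k → (- 1#) ^ k * (v₁ P.^ k P.* v₂) m) n ⟩
        ∑ (applyUpTo (λ k → (- 1#) ^ k * (v₁ P.^ k P.* v₂) m) n) + s * (v₁ P.^ n P.* v₂) m
          ≈⟨ +-cong (telescope v₁ v₂ h e n m) (trans (*-congˡ split) (distribˡ _ _ _)) ⟩
        h m + - (s * x) + (s * x + s * y)
          ≈⟨ trans (+-assoc _ _ _) (+-congˡ (sym (+-assoc _ _ _))) ⟩
        h m + (- (s * x) + s * x + s * y)
          ≈⟨ +-congˡ (trans (+-congʳ (-‿inverseˡ _)) (+-identityˡ _)) ⟩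
        h m + s * y
          ≈⟨ +-congˡ (trans (sym (-‿involutive _)) (-‿cong (trans (-‿distribˡ-* _ _) (*-congʳ (sym (sign-suc n)))))) ⟩
        h m + - ((- 1#) ^ suc n * y) ∎
        where
          s = (- 1#) ^ n
          x = (v₁ P.^ n P.* h) m
          y = (v₁ P.^ suc n P.* h) m
          split : (v₁ P.^ n P.* v₂) m ≈ x + y
          split = P.trans (P.*-congˡ {v₁ P.^ n} e) (P.trans (P.distribˡ (v₁ P.^ n) h (v₁ P.* h))
            (P.+-congˡ {v₁ P.^ n P.* h} (P.trans (P.sym (P.*-assoc (v₁ P.^ n) v₁ h))
              (P.*-congʳ {h} (P.*-comm (v₁ P.^ n) v₁))))) m

    -- log(a + a h ε) = log a + h ε.
    π₂-log : ∀ f h → proj₁ (f 0) ≈ 1# → h 0 ≈ 0# → π₂ f P.≈ π₁ f P.* h →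
      π₂ (PowerSeries.log D.rawRing (inj ∘ ι) f) P.≈ h
    π₂-log f h f₀ h₀ f₂ m = begin
      proj₂ (PowerSeries.log D.rawRing (inj ∘ ι) f m)
        ≈⟨ proj₂-∑ (λ k → inj (ι (coef k)) D.* (u DP.^ suc k) m) m ⟩
      ∑ (applyUpTo (λ k → ι (coef k) * π₂ (u DP.^ suc k) m + 0# * π₁ (u DP.^ suc k) m) m)
        ≈⟨ ∑-applyUpTo-cong (λ k → ι (coef k) * π₂ (u DP.^ suc k) m + 0# * π₁ (u DP.^ suc k) m)
             (λ k → (- 1#) ^ k * (π₁ u P.^ k P.* π₂ u) m) m (λ k _ → term k) ⟩
      ∑ (applyUpTo (λ k → (- 1#) ^ k * (π₁ u P.^ k P.* π₂ u) m) m)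
        ≈⟨ telescope (π₁ u) (π₂ u) h u₂ m m ⟩
      h m + - ((- 1#) ^ m * (π₁ u P.^ m P.* h) m)
        -- The coefficient of t^m uses m terms of the logarithm, leaving a remainder with m factors
        -- u and one factor h. None of them has a constant term, so its order exceeds m.
        ≈⟨ +-congˡ (trans (-‿cong (trans (*-congˡ (P.^-*-vanish (π₁ u) h m u₁₀ h₀ m ℕ.≤-refl)) (zeroʳ _))) -0#≈0#) ⟩
      h m + 0#
        ≈⟨ +-identityʳ _ ⟩
      h m ∎
      where
        coef : ℕ → ℚ
        coef k = (ℤ.-1ℤ ℤ.^ k) ℚ./ suc k
        u : DP.Carrier
        u = f DP.+ DP.- DP.1#

        proj₂-∑ : ∀ (F : ℕ → D.Carrier) n → proj₂ (Sums.∑ D.rawRing (applyUpTo F n)) ≈ ∑ (applyUpTo (proj₂ ∘ F) n)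
        proj₂-∑ F zero    = refl
        proj₂-∑ F (suc n) = +-congˡ (proj₂-∑ (F ∘ suc) n)

        u₁₀ : π₁ u 0 ≈ 0#
        u₁₀ = trans (+-congʳ f₀) (-‿inverseʳ 1#)

        u₁ : π₁ u P.≈ π₁ f P.+ P.- P.1#
        u₁ = P.trans {π₁ u} (λ _ → refl) (P.+-congˡ {π₁ f} (P.-‿cong {π₁ DP.1#} π₁.1#-homo))

        u₂ : π₂ u P.≈ h P.+ π₁ u P.* h
        u₂ = P.begin
          π₂ u                                  P.≈⟨ (λ { zero → trans (+-congˡ -0#≈0#) (+-identityʳ _)
                                                        ; (suc i) → trans (+-congˡ -0#≈0#) (+-identityʳ _) }) ⟩
          π₂ f                                  P.≈⟨ f₂ ⟩
          π₁ f P.* h                            P.≈⟨ P.*-congʳ {h} f₁ ⟩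
          (P.1# P.+ π₁ u) P.* h                 P.≈⟨ P.distribʳ h P.1# (π₁ u) ⟩
          P.1# P.* h P.+ π₁ u P.* h             P.≈⟨ P.+-congʳ {π₁ u P.* h} (P.*-identityˡ h) ⟩
          h P.+ π₁ u P.* h                      P.∎
          where
            f₁ : π₁ f P.≈ P.1# P.+ π₁ u
            f₁ = P.begin
              π₁ f                              P.≈⟨ P.+-identityˡ (π₁ f) ⟨
              P.0# P.+ π₁ f                     P.≈⟨ P.+-congʳ {π₁ f} (P.-‿inverseʳ P.1#) ⟨
              P.1# P.+ P.- P.1# P.+ π₁ f        P.≈⟨ P.+-assoc P.1# (P.- P.1#) (π₁ f) ⟩
              P.1# P.+ (P.- P.1# P.+ π₁ f)      P.≈⟨ P.+-congˡ {P.1#} (P.+-comm (P.- P.1#) (π₁ f)) ⟩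
              P.1# P.+ (π₁ f P.+ P.- P.1#)      P.≈⟨ P.+-congˡ {P.1#} u₁ ⟨
              P.1# P.+ π₁ u                     P.∎

        term : ∀ k → ι (coef k) * π₂ (u DP.^ suc k) m + 0# * π₁ (u DP.^ suc k) m ≈
          (- 1#) ^ k * (π₁ u P.^ k P.* π₂ u) m
        term k = begin
          ι (coef k) * π₂ (u DP.^ suc k) m + 0# * π₁ (u DP.^ suc k) m
            ≈⟨ trans (+-congˡ (zeroˡ _)) (+-identityʳ _) ⟩
          ι (coef k) * π₂ (u DP.^ suc k) m
            ≈⟨ *-congˡ (trans (π₂-^ u k m) (P.×-at (suc k) (π₁ u P.^ k P.* π₂ u) m)) ⟩
          ι (coef k) * (suc k · x)
            ≈⟨ trans (×-comm-* (suc k) _ _) (sym (×-assoc-* (suc k) _ _)) ⟩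
          (suc k · ι (coef k)) * x
            ≈⟨ *-congʳ (scalars k) ⟩
          (- 1#) ^ k * x ∎
          where x = (π₁ u P.^ k P.* π₂ u) m

-- Squarefree parts of polynomials

module Evaluation
  {R : RawRing a ℓ} {S : CommutativeRing c ℓ′} {σ : RawRing.Carrier R → CommutativeRing.Carrier S}
  (laws : RingLaws R S σ) where
  private
    module R = RawRing R
  open RingKit S
  open RingLaws laws

  power : ∀ {n} → (Fin n → Carrier) → Vec ℕ n → Carrier
  power x []      = 1#
  power x (k ∷ α) = x zero ^ k * power (x ∘ suc) α

  power≈∏ : ∀ {n} (x : Fin n → Carrier) α → power x α ≈ ∏ (map (λ i → x i ^ lookup α i) (allFin n))
  power≈∏ x []      = refl
  power≈∏ x (k ∷ α) = trans (*-congˡ (power≈∏ (x ∘ suc) α))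
    (reflexive (≡.sym (∏-allFin (λ i → x i ^ lookup (k ∷ α) i))))

  power-replicate : ∀ {n} (x : Fin n → Carrier) → power x (replicate n 0) ≈ 1#
  power-replicate {zero}  x = refl
  power-replicate {suc n} x = trans (*-identityˡ _) (power-replicate (x ∘ suc))

  power-unit : ∀ {n} (x : Fin n → Carrier) i → power x (replicate n 0 [ i ]≔ 1) ≈ x i
  power-unit x zero    = trans (*-cong (*-identityʳ _) (power-replicate (x ∘ suc))) (*-identityʳ _)
  power-unit x (suc i) = trans (*-identityˡ _) (power-unit (x ∘ suc) i)

  ^-+ : ∀ x k l → x ^ (k ℕ.+ l) ≈ x ^ k * x ^ l
  ^-+ x zero    l = sym (*-identityˡ _)
  ^-+ x (suc k) l = trans (*-congˡ (^-+ x k l)) (sym (*-assoc _ _ _))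

  power-+ : ∀ {n} (x : Fin n → Carrier) α β → power x (Vec.zipWith ℕ._+_ α β) ≈ power x α * power x β
  power-+ x []      []      = sym (*-identityˡ 1#)
  power-+ x (k ∷ α) (l ∷ β) = trans (*-cong (^-+ (x zero) k l) (power-+ (x ∘ suc) α β)) (*-interchange _ _ _ _)

  module _ {n} (x : Fin n → Carrier) where
    private module P where
      open Polynomials R n public
      open RawRing (Polynomials.rawRing R n) public

    term : R.Carrier × Vec ℕ n → Carrier
    term (k , α) = σ k * power x α

    eval : P.Poly → Carrier
    eval p = ∑ (map term p)

    eval-const : ∀ k → eval (P.const k) ≈ σ k
    eval-const k = trans (+-identityʳ _) (trans (*-congˡ (power-replicate x)) (*-identityʳ _))

    eval-var : ∀ i → eval (P.var i) ≈ x i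
    eval-var i = trans (+-identityʳ _) (trans (*-cong 1#-homo (power-unit x i)) (*-identityˡ _))

    eval-laws : RingLaws P.rawRing S eval
    eval-laws = record
      { 0#-homo = refl
      ; 1#-homo = trans (eval-const R.1#) 1#-homo
      ; +-homo  = λ p q → trans (reflexive (≡.cong ∑ (List.map-++ term p q))) (∑-++ (map term p) (map term q))
      ; *-homo  = λ p q → begin
          eval (p P.* q)
            ≈⟨ ∑-cartesianProductWith term _ p q ⟩
          ∑ (map (λ (k , α) → ∑ (map (λ (l , β) → σ (k R.* l) * power x (Vec.zipWith ℕ._+_ α β)) q)) p)
            ≈⟨ ∑-cong p (λ (k , α) → trans
                 (∑-cong q λ (l , β) → trans (*-cong (*-homo k l) (power-+ x α β)) (*-interchange _ _ _ _))
                 (sym (∑-*ˡ (term (k , α)) term q))) ⟩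
          ∑ (map (λ u → term u * eval q) p)
            ≈⟨ ∑-*ʳ (eval q) term p ⟨
          eval p * eval q ∎
      ; -‿homo  = λ p → begin
          eval (P.- p)
            ≡⟨ ∑-map-∘ term _ p ⟩
          ∑ (map (λ (k , α) → σ (R.- k) * power x α) p)
            ≈⟨ ∑-cong p (λ (k , α) → trans (*-congʳ (-‿homo k)) (sym (-‿distribˡ-* _ _))) ⟩
          ∑ (map (λ u → - term u) p)
            ≈⟨ ∑-neg term p ⟨
          - eval p ∎
      }

module Squarefree (K : CommutativeRing c ℓ) where
  private module K = RingKit K

  -- K[x₁,…,xₙ]/(x₁²,…,xₙ²), so that every variable is adjoined as a dual number.
  SF : ℕ → CommutativeRing c ℓ
  SF zero    = K
  SF (suc n) = Dual.dualRing (SF n)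

  module SF (n : ℕ) = RingKit (SF n)

  scalar : ∀ n → K.Carrier → SF.Carrier n
  scalar zero    k = k
  scalar (suc n) k = Dual.inj (SF n) (scalar n k)

  gen : ∀ {n} → Fin n → SF.Carrier n
  gen {suc n} zero    = SF.0# n , SF.1# n
  gen {suc n} (suc i) = Dual.inj (SF n) (gen i)

  -- The linear functional with value 1 on each of the 2^n squarefree monomials.
  total : ∀ n → SF.Carrier n → K.Carrier
  total zero    x       = x
  total (suc n) (x , y) = total n x K.+ total n y

  scalar-laws : ∀ n → RingLaws K.rawRing (SF n) (scalar n)
  scalar-laws zero    = record
    { 0#-homo = K.refl ; 1#-homo = K.refl ; +-homo = λ _ _ → K.refl ; *-homo = λ _ _ → K.refl ; -‿homo = λ _ → K.refl }
  scalar-laws (suc n) = record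
    { 0#-homo = 0#-homo , S.refl
    ; 1#-homo = 1#-homo , S.refl
    ; +-homo  = λ x y → +-homo x y , S.sym (S.+-identityˡ _)
    ; *-homo  = λ x y → *-homo x y , S.sym (S.trans (S.+-cong (S.zeroʳ _) (S.zeroˡ _)) (S.+-identityˡ _))
    ; -‿homo  = λ x → -‿homo x , S.sym S.-0#≈0#
    }
    where
      module S = SF n
      open RingLaws (scalar-laws n)

  total-cong : ∀ n {x y} → SF._≈_ n x y → total n x K.≈ total n y
  total-cong zero    e       = e
  total-cong (suc n) (e , f) = K.+-cong (total-cong n e) (total-cong n f)

  total-0 : ∀ n → total n (SF.0# n) K.≈ K.0#
  total-0 zero    = K.refl
  total-0 (suc n) = K.trans (K.+-cong (total-0 n) (total-0 n)) (K.+-identityˡ _)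

  total-+ : ∀ n x y → total n (SF._+_ n x y) K.≈ total n x K.+ total n y
  total-+ zero    x y = K.refl
  total-+ (suc n) (x , x′) (y , y′) = K.trans (K.+-cong (total-+ n x y) (total-+ n x′ y′)) (K.+-interchange _ _ _ _)

  total-∑ : ∀ n (f : A → SF.Carrier n) xs → total n (SF.∑ n (map f xs)) K.≈ K.∑ (map (total n ∘ f) xs)
  total-∑ n f []       = total-0 n
  total-∑ n f (x ∷ xs) = K.trans (total-+ n _ _) (K.+-congˡ (total-∑ n f xs))

  private module Ev (n : ℕ) = Evaluation (scalar-laws n)

  reduce : ∀ n → Polynomials.Poly K.rawRing n → SF.Carrier n
  reduce n = Ev.eval n gen

  module _ (n : ℕ) where
    private module S = SF n
    open Dual (SF n) using (inj; inj-laws)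
    private module D = SF (suc n)

    power-inj : ∀ {m} (x : Fin m → S.Carrier) α → Ev.power (suc n) (inj ∘ x) α D.≈ inj (Ev.power n x α)
    power-inj x []      = D.refl
    power-inj x (k ∷ α) = D.trans (D.*-cong (D.sym (RingLawsProperties.^-homo inj-laws (x zero) k)) (power-inj (x ∘ suc) α))
      (D.sym (RingLaws.*-homo inj-laws _ _))

    gen²≈0 : ∀ x → (S.0# , S.1#) D.* ((S.0# , S.1#) D.* x) D.≈ D.0#
    gen²≈0 (x , y) = S.zeroˡ _ , S.trans (S.+-cong (S.zeroˡ _) (S.trans (S.*-identityˡ _) (S.zeroˡ _))) (S.+-identityˡ _)

  -- The exponent of the first variable decides: with 0 the term lies in the first coordinate of the
  -- dual number, with 1 in the second, and from 2 on it dies with ε². The right-hand side splits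
  -- likewise by the first entry of the zero-one vector.
  total-term : ∀ n k (α : Vec ℕ n) → total n (Ev.term n (gen {n}) (k , α)) K.≈
    K.∑ (map (λ β → if does (Vec.≡-dec ℕ._≟_ α β) then k else K.0#) (Polynomials.zeroOneVectors K.rawRing n n))
  total-term zero    k []      = K.trans (K.*-identityʳ _) (K.sym (K.+-identityʳ _))
  total-term (suc n) k (l ∷ α) = begin
    total (suc n) (scalar (suc n) k D.* (gen {suc n} zero D.^ l D.* Ev.power (suc n) (gen ∘ suc) α))
      ≈⟨ total-cong (suc n) (D.*-congˡ (D.*-congˡ (power-inj n (gen {n}) α))) ⟩
    total (suc n) (scalar (suc n) k D.* (gen {suc n} zero D.^ l D.* inj (Ev.power n (gen {n}) α)))
      ≈⟨ coordinates l ⟩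
    ∑ (map (λ β → test (0 ∷ β)) Z) + (∑ (map (λ β → test (1 ∷ β)) Z) + 0#)
      ≈⟨ ∑-cartesianProductWith test _∷_ (0 ∷ 1 ∷ []) Z ⟨
    ∑ (map test (Polynomials.zeroOneVectors K.rawRing (suc n) (suc n))) ∎
    where
      open RingKit K
      open Dual (SF n) using (inj)
      module D = SF (suc n)
      module S = SF n

      Z : List (Vec ℕ n)
      Z = Polynomials.zeroOneVectors K.rawRing (suc n) n

      test : Vec ℕ (suc n) → Carrier
      test β = if does (Vec.≡-dec ℕ._≟_ (l ∷ α) β) then k else 0#

      -- The induction hypothesis takes `zeroOneVectors` from the module for n variables, the goal
      -- from the one for n + 1.
      Z≡ : ∀ m → Polynomials.zeroOneVectors K.rawRing n m ≡ Polynomials.zeroOneVectors K.rawRing (suc n) m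
      Z≡ zero    = ≡.refl
      Z≡ (suc m) = ≡.cong (cartesianProductWith _∷_ (0 ∷ 1 ∷ [])) (Z≡ m)

      IH : total n (Ev.term n (gen {n}) (k , α)) ≈ ∑ (map (λ β → if does (Vec.≡-dec ℕ._≟_ α β) then k else 0#) Z)
      IH = trans (total-term n k α) (reflexive (≡.cong (∑ ∘ map _) (Z≡ n)))

      x : S.Carrier
      x = Ev.power n (gen {n}) α

      coordinates : ∀ l → total (suc n) (scalar (suc n) k D.* (gen {suc n} zero D.^ l D.* inj x)) ≈
        ∑ (map (λ β → if does (Vec.≡-dec ℕ._≟_ (l ∷ α) (0 ∷ β)) then k else 0#) Z) +
        (∑ (map (λ β → if does (Vec.≡-dec ℕ._≟_ (l ∷ α) (1 ∷ β)) then k else 0#) Z) + 0#)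
      coordinates zero = +-cong
        (trans (total-cong n (S.*-congˡ (S.*-identityˡ x))) IH)
        (trans (trans (total-cong n (S.trans (S.+-cong
          (S.trans (S.*-congˡ (S.trans (S.+-cong (S.zeroʳ _) (S.zeroˡ _)) (S.+-identityˡ _))) (S.zeroʳ _))
          (S.zeroˡ _)) (S.+-identityˡ _))) (total-0 n))
          (sym (trans (+-identityʳ _) (∑-zero Z (λ _ → refl)))))
      coordinates 1 = +-cong
        (trans (trans (total-cong n (S.trans (S.*-congˡ (S.trans (S.*-congʳ (S.zeroˡ _)) (S.zeroˡ _))) (S.zeroʳ _))) (total-0 n))
          (sym (∑-zero Z (λ _ → refl))))
        (trans (trans (total-cong n (S.trans (S.+-cong (S.*-congˡ (S.trans (S.+-cong (S.zeroʳ _)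
          (S.trans (S.*-congʳ (S.trans (S.+-cong (S.zeroˡ _) (S.*-identityˡ _)) (S.+-identityˡ _))) (S.*-identityˡ x)))
          (S.+-identityˡ _))) (S.zeroˡ _)) (S.+-identityʳ _))) IH)
          (sym (+-identityʳ _)))
      coordinates (suc (suc l)) = trans
        (trans (total-cong (suc n) (D.trans (D.*-congˡ (D.trans (D.*-congʳ (gen²≈0 n (gen {suc n} zero D.^ l))) (D.zeroˡ _)))
          (D.zeroʳ _))) (total-0 (suc n)))
        (sym (trans (+-cong (∑-zero Z (λ _ → refl)) (trans (+-identityʳ _) (∑-zero Z (λ _ → refl)))) (+-identityˡ _)))

  -- Both sides are additive along the list of terms, so repeated monomials need no collecting and
  -- `total-term` settles each entry.
  sq≈total : ∀ n p → Polynomials.sq K.rawRing n p K.≈ total n (reduce n p)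
  sq≈total n [] = K.trans (K.∑-zero (Polynomials.zeroOneVectors K.rawRing n n) (λ _ → K.refl)) (K.sym (total-0 n))
  sq≈total n ((k , α) ∷ p) = begin
    ∑ (map (coeff ((k , α) ∷ p)) Z)
      ≈⟨ ∑-cong Z (λ β → split (does (Vec.≡-dec ℕ._≟_ α β))) ⟩
    ∑ (map (λ β → (if does (Vec.≡-dec ℕ._≟_ α β) then k else 0#) + coeff p β) Z)
      ≈⟨ ∑-+ _ _ Z ⟩
    ∑ (map (λ β → if does (Vec.≡-dec ℕ._≟_ α β) then k else 0#) Z) + ∑ (map (coeff p) Z)
      ≈⟨ +-cong (sym (total-term n k α)) (sq≈total n p) ⟩
    total n (Ev.term n (gen {n}) (k , α)) + total n (reduce n p)
      ≈⟨ total-+ n _ _ ⟨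
    total n (reduce n ((k , α) ∷ p)) ∎
    where
      open RingKit K
      open Polynomials K.rawRing n using (coeff)
      Z = Polynomials.zeroOneVectors K.rawRing n n

      split : ∀ b {x} → (if b then k + x else x) ≈ (if b then k else 0#) + x
      split true  = refl
      split false = sym (+-identityˡ _)

-- The determinant of I - tXA

module Diagonal (R : CommutativeRing c ℓ) where
  open RingKit R

  ∑-diagʳ : ∀ {n} (f : Fin n → Carrier) l →
    ∑ (map (λ k → f k * (if does (k Fin.≟ l) then 1# else 0#)) (allFin n)) ≈ f l
  ∑-diagʳ {suc n} f zero    = trans
    (reflexive (∑-allFin (λ k → f k * (if does (k Fin.≟ zero) then 1# else 0#))))
    (trans (+-cong (*-identityʳ _) (∑-zero (allFin n) (λ k → zeroʳ _))) (+-identityʳ _))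
  ∑-diagʳ {suc n} f (suc l) = trans
    (reflexive (∑-allFin (λ k → f k * (if does (k Fin.≟ suc l) then 1# else 0#))))
    (trans (+-cong (zeroʳ _) (∑-diagʳ (f ∘ suc) l)) (+-identityˡ _))

  ∑-diagˡ : ∀ {n} v (f : Fin n → Carrier) i →
    ∑ (map (λ k → (if does (i Fin.≟ k) then v else 0#) * f k) (allFin n)) ≈ v * f i
  ∑-diagˡ {suc n} v f zero    = trans
    (reflexive (∑-allFin (λ k → (if does (zero Fin.≟ k) then v else 0#) * f k)))
    (trans (+-congˡ (∑-zero (allFin n) (λ k → zeroˡ _))) (+-identityʳ _))
  ∑-diagˡ {suc n} v f (suc i) = trans
    (reflexive (∑-allFin (λ k → (if does (suc i Fin.≟ k) then v else 0#) * f k)))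
    (trans (+-cong (zeroˡ _) (∑-diagˡ v (f ∘ suc) i)) (+-identityˡ _))

-- The series p + q t, given by coefficients so that matrix entries compute by cases on the degree.
linear : (R : CommutativeRing c ℓ) (p q : CommutativeRing.Carrier R) → ℕ → CommutativeRing.Carrier R
linear R p q 0             = p
linear R p q 1             = q
linear R p q (suc (suc m)) = CommutativeRing.0# R

module _ (R : CommutativeRing c ℓ) where
  open RingKit R
  private module P = RingKit (Series.seriesRing R)

  *-linear-suc : ∀ y p q m → (y P.* linear R p q) (suc m) ≈ y (suc m) * p + y m * q
  *-linear-suc y p q m = begin
    (y P.* linear R p q) (suc m)
      ≈⟨ P.*-comm y (linear R p q) (suc m) ⟩
    p * y (suc m) + ((λ i → linear R p q (suc i)) P.* y) m
      ≈⟨ +-congˡ (P.*-congʳ {y} {λ i → linear R p q (suc i)} {PowerSeries.const rawRing q} (λ { zero → refl ; (suc i) → refl }) m) ⟩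
    p * y (suc m) + (PowerSeries.const rawRing q P.* y) m
      ≈⟨ +-cong (*-comm _ _) (trans (Series.const-* R q y m) (*-comm _ _)) ⟩
    y (suc m) * p + y m * q ∎

module LogDet (K : CommutativeRing c ℓ) (ι : ℚ → CommutativeRing.Carrier K) (scalars : LogScalars K ι) where
  private module K = RingKit K
  open Squarefree K

  scalar-cong : ∀ n {x y} → x K.≈ y → SF._≈_ n (scalar n x) (scalar n y)
  scalar-cong zero    e = e
  scalar-cong (suc n) e = scalar-cong n e , SF.refl n

  SF-scalars : ∀ n → LogScalars (SF n) (scalar n ∘ ι)
  SF-scalars n k = S.trans (S.sym (L.×-homo (suc k) _)) (S.trans (scalar-cong n (scalars k)) (L.sign-homo k))
    where
      module S = SF n
      module L = RingLawsProperties (scalar-laws n)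

  module PSF (n : ℕ) = RingKit (Series.seriesRing (SF n))

  -- The product of X and A is already multiplied out; `reduce-entry` identifies this with the image
  -- of the original matrix.
  I-tXA : ∀ n → (Fin n → Fin n → K.Carrier) → Fin n → Fin n → PSF.Carrier n
  I-tXA n a i j = linear (SF n) (if does (i Fin.≟ j) then S.1# else S.0#) (S.- (gen i S.* scalar n (a i j)))
    where module S = SF n

  logdet : ∀ n → (Fin n → Fin n → K.Carrier) → PSF.Carrier n
  logdet n a = PowerSeries.log (SF.rawRing n) (scalar n ∘ ι) (Matrices.det (PSF.rawRing n) (I-tXA n a))

  module _ (n : ℕ) (a : Fin (suc n) → Fin (suc n) → K.Carrier) where
    open RingKit (SF n)
    open Dual (SF n) using (inj; inj-laws; proj₁-laws)
    open DualSeries (SF n)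
    private
      module P where
        open RingKit (Series.seriesRing (SF n)) public
        open Series (SF n) public
        open Determinants (Series.seriesRing (SF n)) public
      module D = RingKit (SF (suc n))
      module DP where
        open RingKit (Series.seriesRing (SF (suc n))) public
        open Determinants (Series.seriesRing (SF (suc n))) public
      Inj-laws = SeriesLift.series-laws inj-laws
      module Inj = RingLawsProperties Inj-laws
      module Π₁ = RingLawsProperties π₁-laws

    -- The squarefree generating function of walks from i to j of length suc m
    -- whose inner vertices avoid zero.
    walks : ℕ → Fin (suc n) → Fin (suc n) → Carrier
    walks zero    i j = scalar n (a i j)
    walks (suc m) i j = ∑ (map (λ k → scalar n (a i (suc k)) * (gen k * walks m (suc k) j)) (allFin n))

    -- `walks` splits off the first step, but the elimination equation multiplies by the matrix on
    -- the right and needs the last step split off.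
    walks-last : ∀ m i j →
      walks (suc m) i j ≈ ∑ (map (λ k → walks m i (suc k) * (gen k * scalar n (a (suc k) j))) (allFin n))
    walks-last zero    i j = refl
    walks-last (suc m) i j = begin
      ∑ (map (λ k → scalar n (a i (suc k)) * (gen k * walks (suc m) (suc k) j)) (allFin n))
        ≈⟨ ∑-cong (allFin n) (λ k → trans (*-congˡ (trans (*-congˡ (walks-last m (suc k) j)) (∑-*ˡ _ _ (allFin n))))
             (∑-*ˡ _ _ (allFin n))) ⟩
      ∑ (map (λ k → ∑ (map (λ l → scalar n (a i (suc k)) * (gen k *
        (walks m (suc k) (suc l) * (gen l * scalar n (a (suc l) j))))) (allFin n))) (allFin n))
        ≈⟨ ∑-swap _ (allFin n) (allFin n) ⟩
      ∑ (map (λ l → ∑ (map (λ k → scalar n (a i (suc k)) * (gen k *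
        (walks m (suc k) (suc l) * (gen l * scalar n (a (suc l) j))))) (allFin n))) (allFin n))
        ≈⟨ ∑-cong (allFin n) (λ l → trans (∑-cong (allFin n) λ k → trans (*-congˡ (sym (*-assoc _ _ _))) (sym (*-assoc _ _ _)))
             (sym (∑-*ʳ _ _ (allFin n)))) ⟩
      ∑ (map (λ l → walks (suc m) i (suc l) * (gen l * scalar n (a (suc l) j))) (allFin n)) ∎

    private
      N : Fin (suc n) → Fin (suc n) → DP.Carrier
      N = I-tXA (suc n) a

      f : DP.Carrier
      f = Matrices.det DP.rawRing N

      a′ : Fin n → Fin n → K.Carrier
      a′ i j = a (suc i) (suc j)

      d : P.Carrier
      d = Matrices.det P.rawRing (I-tXA n a′)

      proj₁-if : ∀ b → proj₁ (if b then D.1# else D.0#) ≈ (if b then 1# else 0#)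
      proj₁-if true  = refl
      proj₁-if false = refl

      proj₂-if : ∀ b → proj₂ (if b then D.1# else D.0#) ≈ 0#
      proj₂-if true  = refl
      proj₂-if false = refl

      -- The rows of the remaining vertices. They contain no ε (`π₂-N`), so passing to constant
      -- parts keeps all of their content.
      C : Fin n → Fin (suc n) → P.Carrier
      C i l = π₁ (N (suc i) l)

      q : Fin n → Fin (suc n) → Carrier
      q k j = - (gen k * scalar n (a (suc k) j))

      B-linear : ∀ i l → C i l P.≈ linear (SF n) (if does (suc i Fin.≟ l) then 1# else 0#) (q i l)
      B-linear i l 0             = proj₁-if (does (suc i Fin.≟ l))
      B-linear i l 1             = refl
      B-linear i l (suc (suc m)) = refl

      π₂-N : ∀ i l m → π₂ (N (suc i) l) m ≈ 0#
      π₂-N i l 0             = proj₂-if (does (suc i Fin.≟ l))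
      π₂-N i l 1             = trans (-‿cong (trans (+-cong (zeroʳ _) (zeroˡ _)) (+-identityˡ _))) -0#≈0#
      π₂-N i l (suc (suc m)) = refl

      minor-B-0 : P.minor C zero P.≈ d
      minor-B-0 = P.det-cong λ i j → P.trans {C i (suc j)} (B-linear i (suc j)) (λ _ → refl)

      -- The variable of the first vertex has constant part 0, so the constant part of row zero is
      -- the unit row.
      π₁-f : π₁ f P.≈ d
      π₁-f = P.trans {π₁ f} (Π₁.det-homo N) (P.trans
        (P.det-collapse (λ i j → π₁ (N i j))
          (λ { 0 → refl
             ; 1 → trans (-‿cong (zeroˡ _)) -0#≈0#
             ; (suc (suc m)) → refl })
          (λ { j 0 → refl
             ; j 1 → trans (-‿cong (zeroˡ _)) -0#≈0#
             ; j (suc (suc m)) → refl }))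
        minor-B-0)

      d₀ : d 0 ≈ 1#
      d₀ = trans (RingLawsProperties.det-homo P.at-0-laws (I-tXA n a′)) (Determinants.det-I (SF n) n)

      ρ : Fin (suc n) → P.Carrier
      ρ j = π₂ (N zero j)

      sgn-inj : ∀ (j : Fin (suc n)) → DP.sgn j DP.≈ inj ∘ P.sgn j
      sgn-inj j = DP.sym {inj ∘ P.sgn j} {DP.sgn j} (Inj.sign-homo (toℕ j))

      minor-inj : ∀ j → DP.minor (N ∘ suc) j DP.≈ inj ∘ P.minor C j
      minor-inj j = DP.trans {DP.minor (N ∘ suc) j}
        (DP.det-cong {M = λ i l → N (suc i) (punchIn j l)} {λ i l → inj ∘ C i (punchIn j l)}
          (λ i l m → refl , π₂-N i (punchIn j l) m))
        (DP.sym {inj ∘ P.minor C j} (Inj.det-homo (λ i l → C i (punchIn j l))))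

      π₂-inj-* : ∀ x y g → x DP.≈ inj ∘ g → π₂ (x DP.* y) P.≈ g P.* π₂ y
      π₂-inj-* x y g e = P.begin
        π₂ (x DP.* y)                         P.≈⟨ π₂-* x y ⟩
        π₁ x P.* π₂ y P.+ π₂ x P.* π₁ y       P.≈⟨ P.+-cong (P.*-congʳ {π₂ y} {π₁ x} {g} (λ m → proj₁ (e m)))
                                                    (P.trans {π₂ x P.* π₁ y} (P.*-congʳ {π₁ y} {π₂ x} {P.0#}
                                                      (λ { zero → proj₂ (e 0) ; (suc m) → proj₂ (e (suc m)) })) (P.zeroˡ (π₁ y))) ⟩
        g P.* π₂ y P.+ P.0#                   P.≈⟨ P.+-identityʳ (g P.* π₂ y) ⟩
        g P.* π₂ y                            P.∎

      π₂-*-inj : ∀ x y g → y DP.≈ inj ∘ g → π₂ (x DP.* y) P.≈ π₂ x P.* g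
      π₂-*-inj x y g e = P.trans {π₂ (x DP.* y)} (λ m → proj₂ (DP.*-comm x y m))
        (P.trans (π₂-inj-* y x g e) (P.*-comm g (π₂ x)))

      -- In the expansion along row zero the signs and minors are free of ε, so only the entries of
      -- row zero are differentiated: the ε-part is a determinant again, with ρ as its top row.
      π₂-f-rows : π₂ f P.≈ P.∑ (map (λ j → P.sgn j P.* ρ j P.* P.minor C j) (allFin (suc n)))
      π₂-f-rows = P.trans {π₂ f}
        (π₂-∑ (λ j → DP.sgn j DP.* N zero j DP.* DP.minor (N ∘ suc) j) (allFin (suc n)))
        (P.∑-cong (allFin (suc n)) λ j → P.trans {π₂ (DP.sgn j DP.* N zero j DP.* DP.minor (N ∘ suc) j)}
          (π₂-*-inj (DP.sgn j DP.* N zero j) (DP.minor (N ∘ suc) j) (P.minor C j) (minor-inj j))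
          (P.*-congʳ {P.minor C j} (π₂-inj-* (DP.sgn j) (N zero j) (P.sgn j) (sgn-inj j))))

      -- Eliminating row 0 against the others amounts to solving y (I - t X A) = - t a₀.
      y : Fin (suc n) → P.Carrier
      y j zero    = 0#
      y j (suc m) = - walks m zero j

      -- In degree 1 both sides are `- a zero j`, because y has no constant term. In higher degrees
      -- ρ is 0 and `walks-last` makes the two terms on the right cancel.
      ρ-suc : ∀ j m → ρ j (suc m) ≈ y j (suc m) + ∑ (map (λ k → y (suc k) m * q k j) (allFin n))
      ρ-suc j zero    = trans (-‿cong (trans (+-cong (zeroˡ _) (*-identityˡ _)) (+-identityˡ _)))
        (sym (trans (+-congˡ (∑-zero (allFin n) (λ k → zeroˡ _))) (+-identityʳ _)))
      ρ-suc j (suc m) = sym (begin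
        - walks (suc m) zero j + ∑ (map (λ k → - walks m zero (suc k) * q k j) (allFin n))
          ≈⟨ +-cong (-‿cong (walks-last m zero j)) (∑-cong (allFin n) λ k →
               trans (sym (-‿distribˡ-* _ _)) (trans (-‿cong (sym (-‿distribʳ-* _ _))) (-‿involutive _))) ⟩
        - W + W
          ≈⟨ -‿inverseˡ _ ⟩
        0# ∎)
        where W = ∑ (map (λ k → walks m zero (suc k) * (gen k * scalar n (a (suc k) j))) (allFin n))

      y*B-0 : ∀ j → P.∑ (map (λ k → y (suc k) P.* C k j) (allFin n)) 0 ≈ 0#
      y*B-0 j = trans (P.∑-map-at (λ k → y (suc k) P.* C k j) (allFin n) 0)
        (∑-zero (allFin n) (λ k → trans (+-identityʳ _) (zeroˡ _)))

      y*B-suc : ∀ j m → P.∑ (map (λ k → y (suc k) P.* C k j) (allFin n)) (suc m) ≈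
        ∑ (map (λ k → y (suc k) (suc m) * (if does (suc k Fin.≟ j) then 1# else 0#)) (allFin n)) +
        ∑ (map (λ k → y (suc k) m * q k j) (allFin n))
      y*B-suc j m = trans (P.∑-map-at (λ k → y (suc k) P.* C k j) (allFin n) (suc m))
        (trans (∑-cong (allFin n) λ k → trans (P.*-congˡ {y (suc k)} (B-linear k j) (suc m))
                 (*-linear-suc (SF n) (y (suc k)) _ (q k j) m))
               (∑-+ _ _ (allFin n)))

      -- Column zero of `C` lies off the diagonal of the identity, so no row multiple supplies
      -- `y zero`: it is left over as the pivot. In the other columns the diagonal entry absorbs the
      -- corresponding term.
      ρ-zero : ρ zero P.≈ y zero P.+ P.∑ (map (λ k → y (suc k) P.* C k zero) (allFin n))
      ρ-zero zero    = sym (trans (+-identityˡ _) (y*B-0 zero))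
      ρ-zero (suc m) = trans (ρ-suc zero m) (+-congˡ (sym (trans (y*B-suc zero m)
        (trans (+-congʳ (∑-zero (allFin n) (λ k → zeroʳ _))) (+-identityˡ _)))))

      ρ-suc-l : ∀ l → ρ (suc l) P.≈ P.∑ (map (λ k → y (suc k) P.* C k (suc l)) (allFin n))
      ρ-suc-l l zero    = sym (y*B-0 (suc l))
      ρ-suc-l l (suc m) = trans (ρ-suc (suc l) m)
        (sym (trans (y*B-suc (suc l) m) (+-congʳ (Diagonal.∑-diagʳ (SF n) (λ k → y (suc k) (suc m)) l))))

      -- Elimination leaves the pivot times the minor of column zero. That minor is d, which is also
      -- the constant part of f, so `y zero` is the logarithmic ε-derivative that `π₂-log` asks for.
      π₂-f : π₂ f P.≈ π₁ f P.* y zero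
      π₂-f = P.begin
        π₂ f                                                               P.≈⟨ π₂-f-rows ⟩
        P.∑ (map (λ j → P.sgn j P.* ρ j P.* P.minor C j) (allFin (suc n)))
          P.≈⟨ P.eliminated-row C ρ (y ∘ suc) (y zero) ρ-zero ρ-suc-l ⟩
        y zero P.* P.minor C zero                                          P.≈⟨ P.*-comm (y zero) (P.minor C zero) ⟩
        P.minor C zero P.* y zero                                          P.≈⟨ P.*-congʳ {y zero} (P.trans minor-B-0 (P.sym π₁-f)) ⟩
        π₁ f P.* y zero                                                    P.∎

    π₁-logdet : ∀ m → proj₁ (logdet (suc n) a m) ≈ logdet n a′ m
    π₁-logdet m = trans
      (LogLift.log-homo proj₁-laws (inj ∘ scalar n ∘ ι) (scalar n ∘ ι) (λ _ → refl) f m)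
      (log-cong (SF n) (scalar n ∘ ι) π₁-f m)

    π₂-logdet : ∀ m → proj₂ (logdet (suc n) a (suc m)) ≈ - walks m zero zero
    π₂-logdet m = π₂-log (scalar n ∘ ι) (SF-scalars n) f (y zero) (trans (π₁-f 0) d₀) refl π₂-f (suc m)

-- Sums over words

words : ∀ n → ℕ → List (List (Fin n))
words n zero    = [] ∷ []
words n (suc m) = cartesianProductWith _∷_ (allFin n) (words n m)

module _ {n : ℕ} where
  open DecUnique (Fin._≟_ {n}) public using (unique?)

  -- The rotation of a cycle that starts at its least vertex.
  Canonical : List (Fin n) → Set
  Canonical []      = ⊥
  Canonical (v ∷ s) = All (v Fin.<_) s × Unique s

  canonical? : Decidable Canonical
  canonical? []      = no λ ()
  canonical? (v ∷ s) = All.all? (v Fin.<?_) s ×-dec unique? s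

module WordSums (K : CommutativeRing c ℓ) where
  open RingKit K

  path : ∀ {n} → (Fin n → Fin n → Carrier) → Fin n → List (Fin n) → Fin n → Carrier
  path a i []      j = a i j
  path a i (k ∷ s) j = a i k * path a k s j

  cyclic : ∀ {n} → (Fin n → Fin n → Carrier) → List (Fin n) → Carrier
  cyclic a []      = 1#
  cyclic a (v ∷ s) = path a v s v

  canonicalSum : ∀ n → (Fin n → Fin n → Carrier) → ℕ → Carrier
  canonicalSum n a m = ∑ (map (λ s → if does (canonical? s) then cyclic a s else 0#) (words n m))

  ∑-words : ∀ {n} (F : List (Fin n) → Carrier) m →
    ∑ (map F (words n (suc m))) ≈ ∑ (map (λ v → ∑ (map (λ s → F (v ∷ s)) (words n m))) (allFin n))
  ∑-words {n} F m = ∑-cartesianProductWith F _∷_ (allFin n) (words n m)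

  -- A letter zero anywhere kills the term, so the surviving words are relabelled words over one
  -- letter fewer. Both halves of `canonicalSum-suc` shed the first vertex in this way.
  ∑-words-positive : ∀ {n} (F : List (Fin (suc n)) → Carrier) →
    (∀ s → ¬ All (zero {n} Fin.<_) s → F s ≈ 0#) → ∀ m →
    ∑ (map F (words (suc n) m)) ≈ ∑ (map (F ∘ map suc) (words n m))
  ∑-words-positive F F₀ zero    = refl
  ∑-words-positive {n} F F₀ (suc m) = begin
    ∑ (map F (words (suc n) (suc m)))
      ≈⟨ ∑-words F m ⟩
    ∑ (map (λ v → ∑ (map (λ s → F (v ∷ s)) (words (suc n) m))) (allFin (suc n)))
      ≡⟨ ∑-allFin (λ v → ∑ (map (λ s → F (v ∷ s)) (words (suc n) m))) ⟩
    ∑ (map (λ s → F (zero ∷ s)) (words (suc n) m)) +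
    ∑ (map (λ v → ∑ (map (λ s → F (suc v ∷ s)) (words (suc n) m))) (allFin n))
      ≈⟨ +-cong (∑-zero (words (suc n) m) (λ s → F₀ (zero ∷ s) λ { (() ∷ _) }))
                (∑-cong (allFin n) λ v → ∑-words-positive (λ s → F (suc v ∷ s))
                  (λ s ¬p → F₀ (suc v ∷ s) λ { (_ ∷ p) → ¬p p }) m) ⟩
    0# + ∑ (map (λ v → ∑ (map (λ s → F (suc v ∷ map suc s)) (words n m))) (allFin n))
      ≈⟨ +-identityˡ _ ⟩
    ∑ (map (λ v → ∑ (map (λ s → F (suc v ∷ map suc s)) (words n m))) (allFin n))
      ≈⟨ ∑-words (F ∘ map suc) m ⟨
    ∑ (map (F ∘ map suc) (words n (suc m))) ∎

  path-suc : ∀ {n} (a : Fin (suc n) → Fin (suc n) → Carrier) i s j →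
    path (λ u v → a (suc u) (suc v)) i s j ≡ path a (suc i) (map suc s) (suc j)
  path-suc a i []      j = ≡.refl
  path-suc a i (k ∷ s) j = ≡.cong (a (suc i) (suc k) *_) (path-suc a k s j)

  private
    if-false : ∀ {P : Set p} (P? : Dec P) {x : Carrier} → ¬ P → (if does P? then x else 0#) ≈ 0#
    if-false (yes p) ¬p = contradiction p ¬p
    if-false (no _)  ¬p = refl

    unique-suc : ∀ {n} {s : List (Fin n)} → Unique s → Unique (map Fin.suc s)
    unique-suc = Unique.map⁺ Fin.suc-injective

    unique-suc⁻ : ∀ {n} {s : List (Fin n)} → Unique (map Fin.suc s) → Unique s
    unique-suc⁻ = Unique.map⁻

    canonical-zero : ∀ {n} (s : List (Fin n)) → does (canonical? (zero ∷ map suc s)) ≡ does (unique? s)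
    canonical-zero s = does-⇔ (mk⇔ (λ (_ , u) → unique-suc⁻ u)
      (λ u → All.map⁺ (All.universal (λ _ → s≤s z≤n) s) , unique-suc u)) (canonical? (zero ∷ map suc s)) (unique? s)

    canonical-suc : ∀ {n} v (s : List (Fin n)) → does (canonical? (suc v ∷ map suc s)) ≡ does (canonical? (v ∷ s))
    canonical-suc v s = does-⇔ (mk⇔ (λ (l , u) → All.map (λ { (s≤s l) → l }) (All.map⁻ l) , unique-suc⁻ u)
      (λ (l , u) → All.map⁺ (All.map s≤s l) , unique-suc u)) (canonical? (suc v ∷ map suc s)) (canonical? (v ∷ s))

  -- A canonical word starts at zero, followed by any repetition-free word of positive letters, or
  -- at some `suc v`, which being least excludes zero from the rest. The two summands answer to
  -- `π₁-logdet` and `π₂-logdet`.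
  canonicalSum-suc : ∀ n a m → canonicalSum (suc n) a (suc m) ≈
    canonicalSum n (λ u v → a (suc u) (suc v)) (suc m) +
    ∑ (map (λ s → if does (unique? s) then path a zero (map suc s) zero else 0#) (words n m))
  canonicalSum-suc n a m = begin
    canonicalSum (suc n) a (suc m)
      ≈⟨ ∑-words F m ⟩
    ∑ (map (λ v → ∑ (map (λ s → F (v ∷ s)) (words (suc n) m))) (allFin (suc n)))
      ≡⟨ ∑-allFin (λ v → ∑ (map (λ s → F (v ∷ s)) (words (suc n) m))) ⟩
    ∑ (map (λ s → F (zero ∷ s)) (words (suc n) m)) +
    ∑ (map (λ v → ∑ (map (λ s → F (suc v ∷ s)) (words (suc n) m))) (allFin n))
      ≈⟨ +-cong
           (trans (∑-words-positive (λ s → F (zero ∷ s)) (λ s ¬p → if-false (canonical? (zero ∷ s)) (¬p ∘ proj₁)) m)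
                  (∑-cong (words n m) λ s → if-cong (canonical-zero s)))
           (∑-cong (allFin n) λ v → trans
             (∑-words-positive (λ s → F (suc v ∷ s))
               (λ s ¬p → if-false (canonical? (suc v ∷ s)) (¬p ∘ All.map (ℕ.≤-trans (s≤s z≤n)) ∘ proj₁)) m)
             (∑-cong (words n m) λ s → trans (if-cong (canonical-suc v s))
               (reflexive (≡.cong (λ x → if does (canonical? (v ∷ s)) then x else 0#) (≡.sym (path-suc a v s v)))))) ⟩
    ∑ (map (λ s → if does (unique? s) then path a zero (map suc s) zero else 0#) (words n m)) +
    ∑ (map (λ v → ∑ (map (λ s → if does (canonical? (v ∷ s)) then path _ v s v else 0#) (words n m))) (allFin n))
      ≈⟨ +-comm _ _ ⟩
    _ ≈⟨ +-congʳ (∑-words F′ m) ⟨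
    _ ∎
    where
      F′ : List (Fin n) → Carrier
      F′ s = if does (canonical? s) then cyclic (λ u v → a (suc u) (suc v)) s else 0#
      F : List (Fin (suc n)) → Carrier
      F s = if does (canonical? s) then cyclic a s else 0#
      if-cong : ∀ {b b′ x} → b ≡ b′ → (if b then x else 0#) ≈ (if b′ then x else 0#)
      if-cong ≡.refl = refl

module SquarefreeWords (K : CommutativeRing c ℓ) where
  private module K = RingKit K
  open Squarefree K
  open WordSums K

  -- The squarefree monomial of a set of vertices, the set being given by its characteristic vector.
  basis : ∀ {n} → Vec Bool n → SF.Carrier n
  basis []          = K.1#
  basis {suc n} (false ∷ S) = basis S , SF.0# n
  basis {suc n} (true  ∷ S) = SF.0# n , basis S

  total-basis : ∀ n (S : Vec Bool n) k → total n (SF._*_ n (basis S) (scalar n k)) K.≈ k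
  total-basis zero    []          k = K.*-identityˡ k
  total-basis (suc n) (false ∷ S) k = K.trans (K.+-cong (total-basis n S k)
    (K.trans (total-cong n (S.trans (S.+-cong (S.zeroʳ _) (S.zeroˡ _)) (S.+-identityˡ _))) (total-0 n))) (K.+-identityʳ k)
    where module S = SF n
  total-basis (suc n) (true ∷ S)  k = K.trans (K.+-cong
    (K.trans (total-cong n (S.zeroˡ _)) (total-0 n))
    (K.trans (total-cong n (S.trans (S.+-congʳ (S.zeroˡ _)) (S.+-identityˡ _))) (total-basis n S k))) (K.+-identityˡ k)
    where module S = SF n

  gen-basis : ∀ n i (S : Vec Bool n) → lookup S i ≡ false →
    SF._≈_ n (SF._*_ n (gen i) (basis S)) (basis (S [ i ]≔ true))
  gen-basis (suc n) zero    (false ∷ S) e = S.zeroˡ _ , S.trans (S.+-cong (S.zeroˡ _) (S.*-identityˡ _)) (S.+-identityˡ _)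
    where module S = SF n
  gen-basis (suc n) (suc i) (false ∷ S) e = gen-basis n i S e , S.trans (S.+-cong (S.zeroʳ _) (S.zeroˡ _)) (S.+-identityˡ _)
    where module S = SF n
  gen-basis (suc n) (suc i) (true ∷ S)  e = S.zeroʳ _ , S.trans (S.+-cong (gen-basis n i S e) (S.zeroˡ _)) (S.+-identityʳ _)
    where module S = SF n

  basis-∅ : ∀ n → SF._≈_ n (basis (replicate n false)) (SF.1# n)
  basis-∅ zero    = K.refl
  basis-∅ (suc n) = basis-∅ n , SF.refl n

  gen² : ∀ n (i : Fin n) → SF._≈_ n (SF._*_ n (gen i) (gen i)) (SF.0# n)
  gen² (suc n) zero    = S.zeroˡ _ , S.trans (S.+-cong (S.zeroˡ _) (S.zeroʳ _)) (S.+-identityˡ _)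
    where module S = SF n
  gen² (suc n) (suc i) = gen² n i , S.trans (S.+-cong (S.zeroʳ _) (S.zeroˡ _)) (S.+-identityˡ _)
    where module S = SF n

  module _ (n : ℕ) where
    open RingKit (SF n)

    gen-repeated : ∀ {i : Fin n} {s} → i ∈ s → gen i * ∏ (map gen s) ≈ 0#
    gen-repeated (here ≡.refl) = trans (sym (*-assoc _ _ _)) (trans (*-congʳ (gen² n _)) (zeroˡ _))
    gen-repeated (there i∈s)   = trans (*-swapˡ _ _ _) (trans (*-congˡ (gen-repeated i∈s)) (zeroʳ _))

    -- Recording that letters outside s are outside S is what the induction needs: the next letter
    -- is fresh, and `gen-basis` can multiply it in.
    ∏-gen-unique : ∀ {s : List (Fin n)} → Unique s →
      Σ[ S ∈ Vec Bool n ] (∏ (map gen s) ≈ basis S × (∀ i → i ∉ s → lookup S i ≡ false))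
    ∏-gen-unique [] = replicate n false , sym (basis-∅ n) , λ i _ → Vec.lookup-replicate i false
    ∏-gen-unique {i ∷ s} (i∉s ∷ u) with ∏-gen-unique u
    ... | S , e , ∉S = S [ i ]≔ true
                     , trans (*-congˡ e) (gen-basis n i S (∉S i (All.All¬⇒¬Any i∉s)))
                     , λ j j∉ → ≡.trans (Vec.lookup∘updateAt′ j i (j∉ ∘ here) S) (∉S j (j∉ ∘ there))

    ∏-gen-¬unique : ∀ (s : List (Fin n)) → ¬ Unique s → ∏ (map gen s) ≈ 0#
    ∏-gen-¬unique []      ¬u = contradiction [] ¬u
    ∏-gen-¬unique (i ∷ s) ¬u with Any.any? (i Fin.≟_) s
    ... | yes i∈s = gen-repeated i∈s
    ... | no  i∉s = trans (*-congˡ (∏-gen-¬unique s (λ u → ¬u (All.¬Any⇒All¬ s i∉s ∷ u)))) (zeroʳ _)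

    -- Here walks become simple: a repeated vertex produces the square of its variable, which is 0,
    -- and any other word gives a squarefree monomial, on which `total` is 1.
    total-∏-gen : ∀ (s : List (Fin n)) k → total n (∏ (map gen s) * scalar n k) K.≈ (if does (unique? s) then k else K.0#)
    total-∏-gen s k with unique? s
    ... | yes u = let S , e , _ = ∏-gen-unique u in K.trans (total-cong n (*-congʳ e)) (total-basis n S k)
    ... | no ¬u = K.trans (total-cong n (trans (*-congʳ (∏-gen-¬unique s ¬u)) (zeroˡ _))) (total-0 n)

module LogDetTotal (K : CommutativeRing c ℓ) (ι : ℚ → CommutativeRing.Carrier K) (scalars : LogScalars K ι) where
  private module K = RingKit K
  open Squarefree K
  open WordSums K
  open SquarefreeWords K
  open LogDet K ι scalars

  -- Expanding the recursion collects the vertex variables on one side and the edge weights on the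
  -- other, the form that `total-∏-gen` evaluates.
  walks≈∑ : ∀ n a m i j → SF._≈_ n (walks n a m i j)
    (SF.∑ n (map (λ s → SF._*_ n (SF.∏ n (map gen s)) (scalar n (path a i (map suc s) j))) (words n m)))
  walks≈∑ n a zero    i j = sym (trans (+-identityʳ _) (*-identityˡ _))
    where open RingKit (SF n)
  walks≈∑ n a (suc m) i j = begin
    ∑ (map (λ k → scalar n (a i (suc k)) * (gen k * walks n a m (suc k) j)) (allFin n))
      ≈⟨ ∑-cong (allFin n) (λ k → trans (*-swapˡ _ _ _) (trans
           (*-congˡ (trans (*-congˡ (walks≈∑ n a m (suc k) j)) (∑-*ˡ _ _ (words n m)))) (∑-*ˡ _ _ (words n m)))) ⟩
    ∑ (map (λ k → ∑ (map (λ s → gen k * (scalar n (a i (suc k)) *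
      (∏ (map gen s) * scalar n (path a (suc k) (map suc s) j)))) (words n m))) (allFin n))
      ≈⟨ ∑-cong (allFin n) (λ k → ∑-cong (words n m) λ s → trans (*-congˡ (trans (*-swapˡ _ _ _)
           (*-congˡ (sym (RingLaws.*-homo (scalar-laws n) _ _))))) (sym (*-assoc _ _ _))) ⟩
    ∑ (map (λ k → ∑ (map (λ s → gen k * ∏ (map gen s) *
      scalar n (path a i (suc k ∷ map suc s) j)) (words n m))) (allFin n))
      ≈⟨ ∑-cartesianProductWith (λ s → ∏ (map gen s) * scalar n (path a i (map suc s) j)) _∷_ (allFin n) (words n m) ⟨
    _ ∎
    where open RingKit (SF n)

  total-walks : ∀ n a m i j → total n (walks n a m i j) K.≈
    K.∑ (map (λ s → if does (unique? s) then path a i (map suc s) j else K.0#) (words n m))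
  total-walks n a m i j = K.trans (total-cong n (walks≈∑ n a m i j))
    (K.trans (total-∑ n _ (words n m)) (K.∑-cong (words n m) λ s → total-∏-gen n s _))

  total-logdet : ∀ n a m → total n (SF.-_ n (logdet n a (suc m))) K.≈ canonicalSum n a (suc m)
  total-logdet zero a m = trans
    -- Without vertices the determinant is 1, so the logarithm is a combination of positive powers
    -- of 1 - 1.
    (-‿cong (∑-applyUpTo-zero (λ k → ι ((ℤ.-1ℤ ℤ.^ k) ℚ./ suc k) * ((P.1# P.+ P.- P.1#) P.^ suc k) (suc m)) (suc m) λ k _ →
      trans (*-congˡ (P.trans (P.*-congʳ {x = (P.1# P.+ P.- P.1#) P.^ k} {P.1# P.+ P.- P.1#} {P.0#} (P.-‿inverseʳ P.1#))
        (P.zeroˡ ((P.1# P.+ P.- P.1#) P.^ k)) (suc m))) (zeroʳ _)))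
    -0#≈0#
    where
      open RingKit K
      module P = RingKit (Series.seriesRing K)
  total-logdet (suc n) a m = begin
    total n (SF.-_ n (proj₁ (logdet (suc n) a (suc m)))) + total n (SF.-_ n (proj₂ (logdet (suc n) a (suc m))))
      ≈⟨ +-cong
           (trans (total-cong n (SF.-‿cong n (π₁-logdet n a (suc m)))) (total-logdet n _ m))
           (total-cong n (SF.trans n (SF.-‿cong n (π₂-logdet n a m)) (SF.-‿involutive n _))) ⟩
    canonicalSum n (λ u v → a (suc u) (suc v)) (suc m) + total n (walks n a m zero zero)
      ≈⟨ +-congˡ (total-walks n a m zero zero) ⟩
    _ ≈⟨ canonicalSum-suc n a m ⟨
    canonicalSum (suc n) a (suc m) ∎
    where open RingKit K

-- Counting in filtered and deduplicated lists

module _ {A : Set a} {P : A → Set p} (P? : Decidable P) where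

  length-filter-0 : ∀ {xs} → All (¬_ ∘ P) xs → length (filter P? xs) ≡ 0
  length-filter-0 ¬ps = ≡.cong length (List.filter-none P? ¬ps)

  length-filter-1 : ∀ {xs} → AllPairs (λ x y → ¬ (P x × P y)) xs → Any.Any P xs → length (filter P? xs) ≡ 1
  length-filter-1 {x ∷ xs} (ds ∷ dss) any with P? x | any
  ... | yes px | _         = ≡.cong suc (length-filter-0 (All.map (λ d py → d (px , py)) ds))
  ... | no ¬px | here px   = contradiction px ¬px
  ... | no _   | there any′ = length-filter-1 dss any′

  length-filter-unique : ∀ {xs} → Unique xs → (∀ {x y} → x ∈ xs → y ∈ xs → P x → P y → x ≡ y) →
    Any.Any P xs → length (filter P? xs) ≡ 1
  length-filter-unique u inj = length-filter-1 (pairs u inj)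
    where
      pairs : ∀ {xs} → Unique xs → (∀ {x y} → x ∈ xs → y ∈ xs → P x → P y → x ≡ y) →
        AllPairs (λ x y → ¬ (P x × P y)) xs
      pairs []       inj = []
      pairs (n ∷ u) inj = All.tabulate (λ y∈ (px , py) → All.lookup n y∈ (inj (here ≡.refl) (there y∈) px py))
        ∷ pairs u (λ x∈ y∈ → inj (there x∈) (there y∈))

  length-filter-⊎ : ∀ {Q : A → Set p} (Q? : Decidable Q) → (∀ x → P x → ¬ Q x) → ∀ xs →
    length (filter (λ x → P? x ⊎-dec Q? x) xs) ≡ length (filter P? xs) ℕ.+ length (filter Q? xs)
  length-filter-⊎ Q? disjoint []       = ≡.refl
  length-filter-⊎ Q? disjoint (x ∷ xs) with P? x | Q? x
  ... | yes px | yes qx = contradiction qx (disjoint x px)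
  ... | yes px | no  _  = ≡.cong suc (length-filter-⊎ Q? disjoint xs)
  ... | no  _  | yes qx = ≡.trans (≡.cong suc (length-filter-⊎ Q? disjoint xs)) (≡.sym (ℕ.+-suc _ _))
  ... | no  _  | no  _  = length-filter-⊎ Q? disjoint xs

module _ {A : Set a} {R : Rel A p} (R? : Binary.Decidable R) where

  deduplicate-pairs : ∀ xs → AllPairs (λ x y → ¬ R x y) (deduplicate R? xs)
  deduplicate-pairs []       = []
  deduplicate-pairs (x ∷ xs) = All.all-filter (¬? ∘ R? x) (deduplicate R? xs)
    ∷ AllPairs.filter⁺ (¬? ∘ R? x) (deduplicate-pairs xs)

  -- When y does not represent x, filtering by y cannot drop a representative d of x: otherwise y
  -- would be related to d and, by transitivity, to x.
  deduplicate-represents : Transitive R → ∀ {x} xs → R x x → x ∈ xs → Any.Any (λ d → R d x) (deduplicate R? xs)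
  deduplicate-represents R-trans (y ∷ xs) r (here ≡.refl) = here r
  deduplicate-represents R-trans {x} (y ∷ xs) r (there x∈xs) with R? y x
  ... | yes Ryx = here Ryx
  ... | no ¬Ryx = there (keep (deduplicate-represents R-trans xs r x∈xs))
    where
      keep : ∀ {ds} → Any.Any (λ d → R d x) ds → Any.Any (λ d → R d x) (filter (¬? ∘ R? y) ds)
      keep {d ∷ ds} any with R? y d | any
      ... | yes Ryd | here Rdx   = contradiction (R-trans Ryd Rdx) ¬Ryx
      ... | yes Ryd | there any′ = keep any′
      ... | no  _   | here Rdx   = here Rdx
      ... | no  _   | there any′ = there (keep any′)

module _ (K : CommutativeRing c ℓ) where
  open RingKit K

  -- Both sides sum the common weight over all related pairs, once by rows and once by columns. It
  -- serves with k = l = 1 for rotations and with k = 1, l = 2 for orientations.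
  ∑-double-count : ∀ {A : Set a} {B : Set b} {R : A → B → Set p} (R? : ∀ x y → Dec (R x y))
    {f : A → Carrier} {g : B → Carrier} → (∀ {x y} → R x y → f x ≈ g y) → ∀ k l {xs ys} →
    (∀ {x} → x ∈ xs → length (filter (R? x) ys) ≡ k) → (∀ {y} → y ∈ ys → length (filter (λ x → R? x y) xs) ≡ l) →
    k · ∑ (map f xs) ≈ l · ∑ (map g ys)
  ∑-double-count {R = R} R? {f} {g} fg k l {xs} {ys} rows columns = begin
    k · ∑ (map f xs)
      ≈⟨ ×-∑ k f xs ⟩
    ∑ (map (λ x → k · f x) xs)
      ≈⟨ ∑-cong-All (All.tabulate λ {x} x∈xs → trans (reflexive (≡.cong (_· f x) (≡.sym (rows x∈xs))))
           (sym (∑-const-count (R? x) (f x) ys))) ⟩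
    ∑ (map (λ x → ∑ (map (λ y → if does (R? x y) then f x else 0#) ys)) xs)
      ≈⟨ ∑-cong xs (λ x → ∑-cong ys λ y → transport (R? x y)) ⟩
    ∑ (map (λ x → ∑ (map (λ y → if does (R? x y) then g y else 0#) ys)) xs)
      ≈⟨ ∑-swap _ xs ys ⟩
    ∑ (map (λ y → ∑ (map (λ x → if does (R? x y) then g y else 0#) xs)) ys)
      ≈⟨ ∑-cong-All (All.tabulate λ {y} y∈ys → trans (∑-const-count (λ x → R? x y) (g y) xs)
           (reflexive (≡.cong (_· g y) (columns y∈ys)))) ⟩
    ∑ (map (λ y → l · g y) ys)
      ≈⟨ ×-∑ l g ys ⟨
    l · ∑ (map g ys) ∎
    where
      ×-∑ : ∀ {q} {C : Set q} k (f : C → Carrier) xs → k · ∑ (map f xs) ≈ ∑ (map (λ x → k · f x) xs)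
      ×-∑ zero    f xs = sym (∑-zero xs (λ _ → refl))
      ×-∑ (suc k) f xs = trans (+-congˡ (×-∑ k f xs)) (sym (∑-+ _ _ xs))
      transport : ∀ {x y} (d : Dec (R x y)) → (if does d then f x else 0#) ≈ (if does d then g y else 0#)
      transport (yes r) = fg r
      transport (no _)  = refl

-- Rotations of cyclic sequences

-- Unlike membership in `rotationList`, which is empty at `[]`, this relation is reflexive
-- everywhere, and its symmetry is visible.
Rotation : ∀ {A : Set a} → List A → List A → Set a
Rotation c d = ∃₂ λ xs ys → c ≡ xs ++ ys × d ≡ ys ++ xs

rotate : ∀ {A : Set a} → List A → List A
rotate []       = []
rotate (x ∷ xs) = xs ++ x ∷ []

rotationList : ∀ {A : Set a} → List A → List (List A)
rotationList c = applyUpTo (λ k → drop k c ++ take k c) (length c)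

module _ {A : Set a} where

  rotation-refl : ∀ (c : List A) → Rotation c c
  rotation-refl c = [] , c , ≡.refl , ≡.sym (List.++-identityʳ c)

  rotation-sym : ∀ {c d : List A} → Rotation c d → Rotation d c
  rotation-sym (xs , ys , p , q) = ys , xs , q , p

  -- Carrying the prefix to the back letter by letter iterates `rotate`, so invariance has to be
  -- checked for a single step only.
  rotation-induction : ∀ {P : List A → Set p} → (∀ d → P d → P (rotate d)) → ∀ {c d} → Rotation c d → P c → P d
  rotation-induction {P = P} step (xs , ys , ≡.refl , ≡.refl) = go xs ys
    where
      go : ∀ xs ys → P (xs ++ ys) → P (ys ++ xs)
      go []       ys p = ≡.subst P (≡.sym (List.++-identityʳ ys)) p
      go (x ∷ xs) ys p = ≡.subst P (List.++-assoc ys (x ∷ []) xs)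
        (go xs (ys ++ x ∷ []) (≡.subst P (List.++-assoc xs ys (x ∷ [])) (step _ p)))

  rotation-rotate : ∀ {c : List A} d → Rotation c d → Rotation c (rotate d)
  rotation-rotate ._ ([]     , []     , ≡.refl , ≡.refl) = rotation-refl []
  rotation-rotate ._ (x ∷ xs , []     , ≡.refl , ≡.refl) = x ∷ [] , xs , List.++-identityʳ (x ∷ xs) , ≡.refl
  rotation-rotate ._ (xs     , y ∷ ys , ≡.refl , ≡.refl) =
    xs ++ y ∷ [] , ys , ≡.sym (List.++-assoc xs (y ∷ []) ys) , List.++-assoc ys xs (y ∷ [])

  rotation-trans : ∀ {c d e : List A} → Rotation c d → Rotation d e → Rotation c e
  rotation-trans r s = rotation-induction {P = Rotation _} rotation-rotate s r

  rotation-reverse : ∀ {c d : List A} → Rotation c d → Rotation (reverse c) (reverse d)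
  rotation-reverse (xs , ys , ≡.refl , ≡.refl) = reverse ys , reverse xs , List.reverse-++ xs ys , List.reverse-++ ys xs

  rotation-reverse-∷ : ∀ (v : A) s → Rotation (reverse (v ∷ s)) (v ∷ reverse s)
  rotation-reverse-∷ v s = reverse s , v ∷ [] , List.unfold-reverse v s , ≡.refl

  rotation-↭ : ∀ {c d : List A} → Rotation c d → c ↭ d
  rotation-↭ (xs , ys , ≡.refl , ≡.refl) = Perm.++-comm xs ys

  ∈-rotationList⁻ : ∀ {c d : List A} → d ∈ rotationList c → Rotation c d
  ∈-rotationList⁻ {c} d∈ with ∈-applyUpTo⁻ (λ k → drop k c ++ take k c) d∈
  ... | k , _ , d≡ = take k c , drop k c , ≡.sym (List.take++drop≡id k c) , d≡

  ∈-rotationList⁺ : ∀ {c d : List A} → ¬ c ≡ [] → Rotation c d → d ∈ rotationList c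
  ∈-rotationList⁺ {[]}    c≢[] _ = contradiction ≡.refl c≢[]
  -- A cut at the very end has index `length c`, just outside the enumerated range; it gives the
  -- same list as the cut at 0.
  ∈-rotationList⁺ {x ∷ c} c≢[] (xs , [] , p , ≡.refl) = here (≡.trans (≡.trans (≡.sym (List.++-identityʳ xs)) (≡.sym p))
    (≡.sym (List.++-identityʳ (x ∷ c))))
  ∈-rotationList⁺ {c@(_ ∷ _)} c≢[] (xs , y ∷ ys , p , ≡.refl) =
    ≡.subst (_∈ rotationList c) (≡.trans (≡.cong (λ c → drop (length xs) c ++ take (length xs) c) p)
      (≡.cong₂ _++_ (drop-length xs) (take-length xs)))
      (∈-applyUpTo⁺ (λ k → drop k c ++ take k c) (≡.subst (length xs ℕ.<_) (≡.sym (≡.trans (≡.cong length p) (List.length-++ xs)))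
        (ℕ.m<m+n (length xs) (s≤s z≤n))))
    where
      drop-length : ∀ xs {ys : List A} → drop (length xs) (xs ++ ys) ≡ ys
      drop-length []       = ≡.refl
      drop-length (_ ∷ xs) = drop-length xs
      take-length : ∀ xs {ys : List A} → take (length xs) (xs ++ ys) ≡ xs
      take-length []       = ≡.refl
      take-length (x ∷ xs) = ≡.cong (x ∷_) (take-length xs)

  unique-↭ : ∀ {xs ys : List A} → xs ↭ ys → Unique xs → Unique ys
  unique-↭ p = PermSetoid.Unique-resp-↭ (≡.setoid A) (Perm.↭⇒↭ₛ p)

  cyclicSteps : List A → List (A × A)
  cyclicSteps c = zip c (drop 1 c ++ take 1 c)

  trail : A → List A → A → List (A × A)
  trail u []      w = (u , w) ∷ []
  trail u (k ∷ s) w = (u , k) ∷ trail k s w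

  cyclicSteps-∷ : ∀ v s → cyclicSteps (v ∷ s) ≡ trail v s v
  cyclicSteps-∷ v s = go v s
    where
      go : ∀ u s → zip (u ∷ s) (s ++ v ∷ []) ≡ trail u s v
      go u []      = ≡.refl
      go u (k ∷ s) = ≡.cong ((u , k) ∷_) (go k s)

  trail-++ : ∀ u s v w → trail u (s ++ v ∷ []) w ≡ trail u s v ++ (v , w) ∷ []
  trail-++ u []      v w = ≡.refl
  trail-++ u (k ∷ s) v w = ≡.cong ((u , k) ∷_) (trail-++ k s v w)

  cyclicSteps-rotation : ∀ {c d} → Rotation c d → cyclicSteps c ↭ cyclicSteps d
  cyclicSteps-rotation {c} r = rotation-induction {P = λ d → cyclicSteps c ↭ cyclicSteps d}
    (λ d p → ↭-trans p (step d)) r Perm.refl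
    where
      step : ∀ d → cyclicSteps d ↭ cyclicSteps (rotate d)
      step []          = Perm.refl
      step (v ∷ [])    = Perm.refl
      step (v ∷ k ∷ s) = ↭-trans (↭-reflexive (cyclicSteps-∷ v (k ∷ s))) (↭-trans (Perm.∷↭∷ʳ (v , k) (trail k s v))
        (↭-reflexive (≡.sym (≡.trans (cyclicSteps-∷ k (s ++ v ∷ [])) (trail-++ k s v k)))))

  trail-reverse : ∀ u s w → trail w (reverse s) u ↭ map swap (trail u s w)
  trail-reverse u []      w = Perm.refl
  trail-reverse u (k ∷ s) w = ↭-trans
    (↭-reflexive (≡.trans (≡.cong (λ r → trail w r u) (List.unfold-reverse k s)) (trail-++ w (reverse s) k u)))
    (↭-trans (↭-sym (Perm.∷↭∷ʳ (k , u) (trail w (reverse s) k))) (Perm.prep (k , u) (trail-reverse k s w)))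

  cyclicSteps-reverse : ∀ c → cyclicSteps (reverse c) ↭ map swap (cyclicSteps c)
  cyclicSteps-reverse []      = Perm.refl
  cyclicSteps-reverse (v ∷ s) = ↭-trans (cyclicSteps-rotation (rotation-reverse-∷ v s))
    (↭-trans (↭-reflexive (cyclicSteps-∷ v (reverse s)))
    (↭-trans (trail-reverse v s v) (↭-reflexive (≡.cong (map swap) (≡.sym (cyclicSteps-∷ v s))))))

  -- The head of the reversal comes from the nonempty tail, which does not contain x.
  reverse-head : ∀ {x y : A} {s} → Unique (x ∷ y ∷ s) → ¬ x ∷ y ∷ s ≡ reverse (x ∷ y ∷ s)
  reverse-head {x} {y} {s} (x∉ ∷ _) e with reverse (y ∷ s) in eq
  ... | []    = contradiction (≡.trans (≡.sym (List.length-reverse (y ∷ s))) (≡.cong length eq)) λ ()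
  ... | z ∷ r = All.lookup x∉ (Perm.∈-resp-↭ (Perm.↭-reverse (y ∷ s)) (≡.subst (z ∈_) (≡.sym eq) (here ≡.refl)))
    (List.∷-injectiveˡ (≡.trans e (≡.trans (List.unfold-reverse x (y ∷ s)) (≡.cong (_++ x ∷ []) eq))))

module _ {n : ℕ} where

  -- Cut just before the least letter. `least` finds it by comparing the head with the least letter
  -- of the rest, equality being excluded by uniqueness.
  canonical-exists : ∀ {c : List (Fin n)} → ¬ c ≡ [] → Unique c → ∃ λ e → Rotation c e × Canonical e
  canonical-exists {[]}    c≢[] u = contradiction ≡.refl c≢[]
  canonical-exists {v ∷ s} c≢[] u with least v s u
    where
      least : ∀ v (s : List (Fin n)) → Unique (v ∷ s) →
        Σ[ xs ∈ List (Fin n) ] Σ[ m ∈ Fin n ] Σ[ ys ∈ List (Fin n) ]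
        (v ∷ s ≡ xs ++ m ∷ ys × All (m Fin.<_) (ys ++ xs))
      least v []      u = [] , v , [] , ≡.refl , []
      least v (k ∷ s) (v∉ ∷ u) with least k s u
      ... | xs , m , ys , e , m< with Fin.<-cmp v m
      ... | tri< v<m _ _ = [] , v , k ∷ s , ≡.refl , ≡.subst (All (v Fin.<_)) (≡.sym (List.++-identityʳ (k ∷ s)))
              (≡.subst (All (v Fin.<_)) (≡.sym e) (All.++⁺ (All.++⁻ʳ ys v<all) (v<m ∷ All.++⁻ˡ ys v<all)))
        where v<all = All.map (Fin.<-trans v<m) m<
      ... | tri≈ _ v≡m _ = contradiction v≡m (All.lookup v∉ (≡.subst (m ∈_) (≡.sym e) (Any.++⁺ʳ xs (here ≡.refl))))
      ... | tri> _ _ m<v = v ∷ xs , m , ys , ≡.cong (v ∷_) e , All.++⁺ (All.++⁻ˡ ys m<) (m<v ∷ All.++⁻ʳ ys m<)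
  ... | xs , m , ys , e , m< = m ∷ ys ++ xs , r , m< , AllPairs.tail (unique-↭ (rotation-↭ r) u)
    where
      r : Rotation (v ∷ s) (m ∷ ys ++ xs)
      r = xs , m ∷ ys , e , ≡.refl

  -- After a proper cut each of the two heads would occur behind the other and hence be strictly
  -- larger than it.
  canonical-unique : ∀ {d e : List (Fin n)} → Canonical d → Canonical e → Rotation d e → d ≡ e
  canonical-unique _ _ ([] , ys , ≡.refl , ≡.refl) = ≡.sym (List.++-identityʳ ys)
  canonical-unique _ _ (x ∷ xs , [] , ≡.refl , ≡.refl) = List.++-identityʳ (x ∷ xs)
  canonical-unique (x< , _) (y< , _) (x ∷ xs , y ∷ ys , ≡.refl , ≡.refl) = contradiction
    (All.lookup x< (Any.++⁺ʳ xs (here ≡.refl))) (Fin.<-asym (All.lookup y< (Any.++⁺ʳ ys (here ≡.refl))))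

  -- Normalise c to the canonical `v ∷ s`. Its reversal rotates to `v ∷ reverse s`, again canonical,
  -- so uniqueness would force `s ≡ reverse s`. With at least two distinct letters in s this fails;
  -- a cycle of length two does coincide with its reversal.
  chiral : ∀ {c : List (Fin n)} → 3 ℕ.≤ length c → Unique c → ¬ Rotation c (reverse c)
  chiral {c} 3≤ u r with canonical-exists {c} (λ { ≡.refl → contradiction 3≤ λ () }) u
  ... | v ∷ s , r′ , can@(v< , us) = reversed s us (≡.subst (3 ℕ.≤_) (Perm.↭-length (rotation-↭ r′)) 3≤)
    (List.∷-injectiveʳ (canonical-unique can (Perm.All-resp-↭ (↭-sym (Perm.↭-reverse s)) v< , unique-↭ (↭-sym (Perm.↭-reverse s)) us)
      (rotation-trans (rotation-sym r′) (rotation-trans r (rotation-trans (rotation-reverse r′) (rotation-reverse-∷ v s))))))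
    where
      reversed : ∀ s → Unique s → 3 ℕ.≤ suc (length s) → ¬ s ≡ reverse s
      reversed (x ∷ [])    _ (s≤s (s≤s ()))
      reversed (x ∷ y ∷ s) u _ = reverse-head u

-- Polynomial rings

module PolynomialRing (R : CommutativeRing c ℓ) where
  private module R = RingKit R

  -- A commutative ring in which every exponent vector has one definite coefficient; the list
  -- polynomials embed in it and inherit its laws.
  MultiSeries : ℕ → CommutativeRing c ℓ
  MultiSeries zero    = R
  MultiSeries (suc n) = Series.seriesRing (MultiSeries n)

  private module S (n : ℕ) = RingKit (MultiSeries n)

  scalarSeries : ∀ n → R.Carrier → S.Carrier n
  scalarSeries zero    k = k
  scalarSeries (suc n) k = PowerSeries.const (S.rawRing n) (scalarSeries n k)

  indeterminate : ∀ {n} → Fin n → S.Carrier n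
  indeterminate {suc n} zero    = PowerSeries.t (S.rawRing n)
  indeterminate {suc n} (suc i) = PowerSeries.const (S.rawRing n) (indeterminate i)

  coefficient : ∀ n → S.Carrier n → Vec ℕ n → R.Carrier
  coefficient zero    x []      = x
  coefficient (suc n) f (k ∷ α) = coefficient n (f k) α

  coefficient-cong : ∀ n {x y} → S._≈_ n x y → ∀ α → coefficient n x α R.≈ coefficient n y α
  coefficient-cong zero    e []      = e
  coefficient-cong (suc n) e (k ∷ α) = coefficient-cong n (e k) α

  coefficient-ext : ∀ n {x y} → (∀ α → coefficient n x α R.≈ coefficient n y α) → S._≈_ n x y
  coefficient-ext zero    e   = e []
  coefficient-ext (suc n) e k = coefficient-ext n (λ α → e (k ∷ α))

  coefficient-+ : ∀ n x y α → coefficient n (S._+_ n x y) α R.≈ coefficient n x α R.+ coefficient n y α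
  coefficient-+ zero    x y []      = R.refl
  coefficient-+ (suc n) f g (k ∷ α) = coefficient-+ n (f k) (g k) α

  coefficient-0 : ∀ n α → coefficient n (S.0# n) α R.≈ R.0#
  coefficient-0 zero    []            = R.refl
  coefficient-0 (suc n) (zero ∷ α)    = coefficient-0 n α
  coefficient-0 (suc n) ((suc k) ∷ α) = coefficient-0 n α

  scalarSeries-laws : ∀ n → RingLaws R.rawRing (MultiSeries n) (scalarSeries n)
  scalarSeries-laws zero    = record
    { 0#-homo = R.refl ; 1#-homo = R.refl ; +-homo = λ _ _ → R.refl ; *-homo = λ _ _ → R.refl ; -‿homo = λ _ → R.refl }
  scalarSeries-laws (suc n) = record
    { 0#-homo = P.trans (cong′ L.0#-homo) C.0#-homo
    ; 1#-homo = P.trans (cong′ L.1#-homo) C.1#-homo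
    ; +-homo  = λ x y → P.trans (cong′ (L.+-homo x y)) (C.+-homo _ _)
    ; *-homo  = λ x y → P.trans (cong′ (L.*-homo x y)) (C.*-homo _ _)
    ; -‿homo  = λ x → P.trans (cong′ (L.-‿homo x)) (C.-‿homo _)
    }
    where
      module L = RingLaws (scalarSeries-laws n)
      module C = RingLaws (Series.const-laws (MultiSeries n))
      module P = S (suc n)
      cong′ : ∀ {x y} → S._≈_ n x y → PowerSeries.const (S.rawRing n) x P.≈ PowerSeries.const (S.rawRing n) y
      cong′ e zero    = e
      cong′ e (suc m) = S.refl n

  private module Ev (n : ℕ) = Evaluation (scalarSeries-laws n)

  private
    module _ (n : ℕ) where
      private
        module P = S (suc n)
        module S′ = S n
        open PowerSeries S′.rawRing using (const; t)
        module C = RingLaws (Series.const-laws (MultiSeries n))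

      power-const : ∀ {m} (x : Fin m → S′.Carrier) α → Ev.power (suc n) (const ∘ x) α P.≈ const (Ev.power n x α)
      power-const x []      = P.refl
      power-const x (k ∷ α) = P.trans
        (P.*-cong {const (x zero) P.^ k} {const (x zero S′.^ k)} {Ev.power (suc n) (const ∘ x ∘ suc) α}
          (P.sym (RingLawsProperties.^-homo (Series.const-laws (MultiSeries n)) (x zero) k)) (power-const (x ∘ suc) α))
        (P.sym (C.*-homo _ _))

      t^k : ∀ k x m → (t P.^ k P.* const x) m S′.≈ (if does (k ℕ.≟ m) then x else S′.0#)
      t^k zero    x zero    = P.*-identityˡ (const x) 0
      t^k zero    x (suc m) = P.*-identityˡ (const x) (suc m)
      t^k (suc k) x zero    = S′.trans (P.*-assoc t (t P.^ k) (const x) 0) (Series.t-*-0 (MultiSeries n) (t P.^ k P.* const x))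
      t^k (suc k) x (suc m) = S′.trans (P.*-assoc t (t P.^ k) (const x) (suc m))
        (S′.trans (Series.t-*-suc (MultiSeries n) (t P.^ k P.* const x) m) (t^k k x m))

      term-suc : ∀ c k (α : Vec ℕ n) → Ev.term (suc n) indeterminate (c , k ∷ α) P.≈
        t P.^ k P.* const (Ev.term n (indeterminate {n}) (c , α))
      term-suc c k α = P.begin
        const σ P.* (t P.^ k P.* Ev.power (suc n) (const ∘ indeterminate {n}) α)
          P.≈⟨ P.*-congˡ {const σ} (P.*-congˡ {t P.^ k} (power-const (indeterminate {n}) α)) ⟩
        const σ P.* (t P.^ k P.* const x)
          P.≈⟨ P.*-swapˡ (const σ) (t P.^ k) (const x) ⟩
        t P.^ k P.* (const σ P.* const x)
          P.≈⟨ P.*-congˡ {t P.^ k} (C.*-homo σ x) ⟨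
        t P.^ k P.* const (σ S′.* x) P.∎
        where
          σ = scalarSeries n c
          x = Ev.power n (indeterminate {n}) α

  coefficient-term : ∀ n c (α β : Vec ℕ n) → coefficient n (Ev.term n (indeterminate {n}) (c , α)) β R.≈
    (if does (Vec.≡-dec ℕ._≟_ α β) then c else R.0#)
  coefficient-term zero    c []      []      = R.*-identityʳ c
  coefficient-term (suc n) c (k ∷ α) (l ∷ β) = R.trans
    (coefficient-cong n (S.trans n (term-suc n c k α l) (t^k n k (Ev.term n (indeterminate {n}) (c , α)) l)) β)
    (select (does (k ℕ.≟ l)) (coefficient-term n c α β))
    where
      select : ∀ b {x} → coefficient n x β R.≈ (if does (Vec.≡-dec ℕ._≟_ α β) then c else R.0#) →
        coefficient n (if b then x else S.0# n) β R.≈ (if b ∧ does (Vec.≡-dec ℕ._≟_ α β) then c else R.0#)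
      select true  e = e
      select false e = coefficient-0 n β

  module _ (n : ℕ) where
    open Polynomials R.rawRing n using (Poly; coeff) renaming (rawRing to polyRaw; const to constP)
    private module P = RawRing polyRaw

    embed : Poly → S.Carrier n
    embed = Ev.eval n (indeterminate {n})

    -- `coeff` adds up repeated monomials just as `embed` adds up terms. Hence equality of
    -- polynomials is equality of their images, which makes `embed` well defined and injective.
    coefficient-embed : ∀ p α → coefficient n (embed p) α R.≈ coeff p α
    coefficient-embed []            α = coefficient-0 n α
    coefficient-embed ((c , β) ∷ p) α = R.trans (coefficient-+ n (Ev.term n (indeterminate {n}) (c , β)) (embed p) α)
      (R.trans (R.+-cong (coefficient-term n c β α) (coefficient-embed p α)) (merge (does (Vec.≡-dec ℕ._≟_ β α))))
      where
        merge : ∀ b {x} → (if b then c else R.0#) R.+ x R.≈ (if b then c R.+ x else x)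
        merge true  = R.refl
        merge false = R.+-identityˡ _

    embed-cong : ∀ p q → p P.≈ q → S._≈_ n (embed p) (embed q)
    embed-cong p q e = coefficient-ext n λ α →
      R.trans (coefficient-embed p α) (R.trans (e α) (R.sym (coefficient-embed q α)))

    embed-injective : ∀ p q → S._≈_ n (embed p) (embed q) → p P.≈ q
    embed-injective p q e α =
      R.trans (R.sym (coefficient-embed p α)) (R.trans (coefficient-cong n e α) (coefficient-embed q α))

    private module L = RingLaws (Ev.eval-laws n (indeterminate {n}))

    embed-isRingMonomorphism : IsRingMonomorphism polyRaw (S.rawRing n) embed
    embed-isRingMonomorphism = record
      { isRingHomomorphism = record
        { isSemiringHomomorphism = record
          { isNearSemiringHomomorphism = record
            { +-isMonoidHomomorphism = record
              { isMagmaHomomorphism = record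
                { isRelHomomorphism = record { cong = λ {p} {q} → embed-cong p q }
                ; homo = L.+-homo
                }
              ; ε-homo = L.0#-homo
              }
            ; *-homo = L.*-homo
            }
          ; 1#-homo = L.1#-homo
          }
        ; -‿homo = L.-‿homo
        }
      ; injective = λ {p} {q} → embed-injective p q
      }

    polynomialRing : CommutativeRing c ℓ
    polynomialRing = record
      { isCommutativeRing = RingMonomorphism.isCommutativeRing embed-isRingMonomorphism (S.isCommutativeRing n) }

    constP-laws : RingLaws R.rawRing polynomialRing constP
    constP-laws = record
      { 0#-homo = inj (c.0#-homo)
      ; 1#-homo = λ _ → R.refl
      ; +-homo  = λ x y → embed-injective (constP (x R.+ y)) (constP x P.+ constP y) (S.trans n (lift (x R.+ y)) (S.trans n (c.+-homo x y)
          (S.trans n (S.+-cong n (S.sym n (lift x)) (S.sym n (lift y))) (S.sym n (L.+-homo (constP x) (constP y))))))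
      ; *-homo  = λ x y → embed-injective (constP (x R.* y)) (constP x P.* constP y) (S.trans n (lift (x R.* y)) (S.trans n (c.*-homo x y)
          (S.trans n (S.*-cong n (S.sym n (lift x)) (S.sym n (lift y))) (S.sym n (L.*-homo (constP x) (constP y))))))
      ; -‿homo  = λ x → embed-injective (constP (R.- x)) (P.- constP x) (S.trans n (lift (R.- x)) (S.trans n (c.-‿homo x)
          (S.trans n (S.-‿cong n (S.sym n (lift x))) (S.sym n (L.-‿homo (constP x))))))
      }
      where
        module c = RingLaws (scalarSeries-laws n)
        lift : ∀ x → S._≈_ n (embed (constP x)) (scalarSeries n x)
        lift = Ev.eval-const n (indeterminate {n})
        inj : S._≈_ n (scalarSeries n R.0#) (S.0# n) → constP R.0# P.≈ P.0#
        inj e = embed-injective (constP R.0#) P.0# (S.trans n (lift R.0#) e)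

    constP-cong : ∀ {x y} → x R.≈ y → constP x P.≈ constP y
    constP-cong e α with does (Vec.≡-dec ℕ._≟_ (replicate n 0) α)
    ... | true  = R.+-congʳ e
    ... | false = R.refl

    constP-scalars : ∀ {ι} → LogScalars R ι → LogScalars polynomialRing (constP ∘ ι)
    constP-scalars {ι} s k = K.begin
      suc k K.· constP x                  K.≈⟨ L′.×-homo (suc k) x ⟨
      constP (suc k R.· x)                K.≈⟨ constP-cong (s k) ⟩
      constP ((R.- R.1#) R.^ k)           K.≈⟨ L′.sign-homo k ⟩
      (K.- K.1#) K.^ k                    K.∎
      where
        x = ι ((ℤ.-1ℤ ℤ.^ k) ℚ./ suc k)
        module K = RingKit polynomialRing
        module L′ = RingLawsProperties constP-laws

-- Normalised fractions do not compute for a variable denominator, so sums and cancellations are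
-- checked on unnormalised ones: adding k + 1 copies brings k + 1 into the numerator, where it
-- cancels.
ℚ-scalars : LogScalars ℚ.+-*-commutativeRing id
ℚ-scalars k = ≡.trans (×-/ (suc k) (ℤ.-1ℤ ℤ.^ k)) (≡.trans (cancel (ℤ.-1ℤ ℤ.^ k)) (sign k))
  where
    open Sums ℚ.+-*-rawRing using (_·_; _^_)

    fraction : ∀ i n → ℚ.toℚᵘ (i ℚ./ suc n) ℚᵘ.≃ ℚᵘ.mkℚᵘ i n
    fraction i n = ℚ.toℚᵘ-fromℚᵘ (ℚᵘ.mkℚᵘ i n)

    +-/ : ∀ i j → i ℚ./ suc k ℚ.+ j ℚ./ suc k ≡ (i ℤ.+ j) ℚ./ suc k
    +-/ i j = ℚ.toℚᵘ-injective (ℚᵘ.≃-trans (ℚ.toℚᵘ-homo-+ (i ℚ./ suc k) (j ℚ./ suc k))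
      (ℚᵘ.≃-trans (ℚᵘ.+-cong (fraction i k) (fraction j k))
      (ℚᵘ.≃-trans (ℚᵘ.*≡* (identity i j (ℤ.+ suc k))) (ℚᵘ.≃-sym (fraction (i ℤ.+ j) k)))))
      where
        identity : ∀ i j d → (i ℤ.* d ℤ.+ j ℤ.* d) ℤ.* d ≡ (i ℤ.+ j) ℤ.* (d ℤ.* d)
        identity = ℤ-Solver.solve-∀

    ×-/ : ∀ m i → m · (i ℚ./ suc k) ≡ (ℤ.+ m ℤ.* i) ℚ./ suc k
    ×-/ zero    i = ℚ.toℚᵘ-injective (ℚᵘ.≃-trans (ℚᵘ.*≡* ≡.refl) (ℚᵘ.≃-sym (fraction ℤ.0ℤ k)))
    ×-/ (suc m) i = ≡.trans (≡.cong (i ℚ./ suc k ℚ.+_) (×-/ m i)) (≡.trans (+-/ i (ℤ.+ m ℤ.* i))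
      (≡.cong (ℚ._/ suc k) (≡.sym (ℤ.suc-* (ℤ.+ m) i))))

    cancel : ∀ i → (ℤ.+ suc k ℤ.* i) ℚ./ suc k ≡ i ℚ./ 1
    cancel i = ℚ.toℚᵘ-injective (ℚᵘ.≃-trans (fraction (ℤ.+ suc k ℤ.* i) k)
      (ℚᵘ.≃-trans (ℚᵘ.*≡* (≡.trans (ℤ.*-identityʳ _) (ℤ.*-comm (ℤ.+ suc k) i))) (ℚᵘ.≃-sym (fraction i 0))))

    *-/1 : ∀ i j → (i ℤ.* j) ℚ./ 1 ≡ (i ℚ./ 1) ℚ.* (j ℚ./ 1)
    *-/1 i j = ℚ.toℚᵘ-injective (ℚᵘ.≃-trans (fraction (i ℤ.* j) 0) (ℚᵘ.≃-sym
      (ℚᵘ.≃-trans (ℚ.toℚᵘ-homo-* (i ℚ./ 1) (j ℚ./ 1)) (ℚᵘ.*-cong (fraction i 0) (fraction j 0)))))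

    sign : ∀ k → (ℤ.-1ℤ ℤ.^ k) ℚ./ 1 ≡ (ℚ.- ℚ.1ℚ) ^ k
    sign zero    = ≡.refl
    sign (suc k) = ≡.trans (*-/1 ℤ.-1ℤ (ℤ.-1ℤ ℤ.^ k)) (≡.cong (ℚ.- ℚ.1ℚ ℚ.*_) (sign k))

-- From series over polynomials to the squarefree quotient

module _ (K : CommutativeRing c ℓ) (ι : ℚ → CommutativeRing.Carrier K) (scalars : LogScalars K ι) where
  private module K = RingKit K
  open Squarefree K
  open LogDet K ι scalars

  module _ {n : ℕ} (a : Fin n → Fin n → K.Carrier) where
    private
      module Px = Polynomials K.rawRing n
      module Pxt = PowerSeries Px.rawRing
      module M = Matrices Pxt.rawRing
      module T = RawRing Pxt.rawRing
      module S = SF n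
      module P where
        open PSF n public
        open PowerSeries S.rawRing public using (const; t)
        open Series (SF n) public using (t-*-0; t-*-suc)
      module Ev = Evaluation (scalar-laws n)
      reduce-laws : RingLaws Px.rawRing (SF n) (reduce n)
      reduce-laws = Ev.eval-laws (gen {n})
      module Red = SeriesLift reduce-laws
      module Ser = RingLawsProperties Red.series-laws
      module SerL = RingLaws Red.series-laws

    series-I-tXA : M.Matrix n
    series-I-tXA = M.I M.-ᴹ Pxt.t M.*ˢ (M.diag (λ v → Pxt.const (Px.var v)) M.*ᴹ (λ u v → Pxt.const (Px.const (a u v))))

    private
      reduce-if : ∀ b x → reduce n ∘ (if b then x else T.0#) P.≈ (if b then reduce n ∘ x else P.0#)
      reduce-if true  x m = S.refl
      reduce-if false x m = SerL.0#-homo m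

      XA : M.Matrix n
      XA = M.diag (λ v → Pxt.const (Px.var v)) M.*ᴹ (λ u v → Pxt.const (Px.const (a u v)))

      reduce-XA : ∀ i j → reduce n ∘ XA i j P.≈ P.const (gen i S.* scalar n (a i j))
      reduce-XA i j = P.begin
        reduce n ∘ XA i j
          P.≈⟨ Ser.∑-map-homo (λ k → (if does (i Fin.≟ k) then Pxt.const (Px.var i) else T.0#) T.*
                 Pxt.const (Px.const (a k j))) (allFin n) ⟩
        P.∑ (map (λ k → reduce n ∘ ((if does (i Fin.≟ k) then Pxt.const (Px.var i) else T.0#) T.* Pxt.const (Px.const (a k j)))) (allFin n))
          P.≈⟨ P.∑-cong (allFin n) (λ k → P.trans
                 {reduce n ∘ ((if does (i Fin.≟ k) then Pxt.const (Px.var i) else T.0#) T.* Pxt.const (Px.const (a k j)))}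
                 (SerL.*-homo (if does (i Fin.≟ k) then Pxt.const (Px.var i) else T.0#) (Pxt.const (Px.const (a k j)))) (P.*-cong
                 {reduce n ∘ (if does (i Fin.≟ k) then Pxt.const (Px.var i) else T.0#)}
                 {if does (i Fin.≟ k) then P.const (gen i) else P.0#}
                 {reduce n ∘ Pxt.const (Px.const (a k j))} {P.const (scalar n (a k j))}
                 (P.trans {reduce n ∘ (if does (i Fin.≟ k) then Pxt.const (Px.var i) else T.0#)}
                   (reduce-if (does (i Fin.≟ k)) (Pxt.const (Px.var i))) (if-cong (does (i Fin.≟ k)) (reduce-var i)))
                 (reduce-scalar (a k j)))) ⟩
        P.∑ (map (λ k → (if does (i Fin.≟ k) then P.const (gen i) else P.0#) P.* P.const (scalar n (a k j))) (allFin n))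
          P.≈⟨ Diagonal.∑-diagˡ (Series.seriesRing (SF n)) (P.const (gen i)) (λ k → P.const (scalar n (a k j))) i ⟩
        P.const (gen i) P.* P.const (scalar n (a i j))
          P.≈⟨ RingLaws.*-homo (Series.const-laws (SF n)) (gen i) (scalar n (a i j)) ⟨
        P.const (gen i S.* scalar n (a i j)) P.∎
        where
          const-cong : ∀ {x y} → x S.≈ y → P.const x P.≈ P.const y
          const-cong e zero    = e
          const-cong e (suc m) = S.refl
          reduce-var : ∀ i → reduce n ∘ Pxt.const (Px.var i) P.≈ P.const (gen i)
          reduce-var i = P.trans {reduce n ∘ Pxt.const (Px.var i)} (Red.const-homo (Px.var i)) (const-cong (Ev.eval-var (gen {n}) i))
          reduce-scalar : ∀ k → reduce n ∘ Pxt.const (Px.const k) P.≈ P.const (scalar n k)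
          reduce-scalar k = P.trans {reduce n ∘ Pxt.const (Px.const k)} (Red.const-homo (Px.const k)) (const-cong (Ev.eval-const (gen {n}) k))
          if-cong : ∀ b {x y : P.Carrier} → x P.≈ y → (if b then x else P.0#) P.≈ (if b then y else P.0#)
          if-cong true  e = e
          if-cong false e = P.refl

      reduce-entry : ∀ i j → reduce n ∘ series-I-tXA i j P.≈ I-tXA n a i j
      reduce-entry i j = P.trans {reduce n ∘ series-I-tXA i j} split (λ
        { 0 → S.trans (S.+-cong (δ-0 (does (i Fin.≟ j))) (S.trans (S.-‿cong (P.t-*-0 x)) S.-0#≈0#)) (S.+-identityʳ _)
        ; 1 → S.trans (S.+-cong (δ-suc (does (i Fin.≟ j)) 0) (S.-‿cong (P.t-*-suc x 0))) (S.+-identityˡ _)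
        ; (suc (suc m)) → S.trans (S.+-cong (δ-suc (does (i Fin.≟ j)) (suc m))
            (S.trans (S.-‿cong (P.t-*-suc x (suc m))) S.-0#≈0#)) (S.+-identityˡ _) })
        where
          x : P.Carrier
          x = P.const (gen i S.* scalar n (a i j))
          δ : Bool → P.Carrier
          δ b = if b then P.1# else P.0#
          δ-0 : ∀ b → δ b 0 S.≈ (if b then S.1# else S.0#)
          δ-0 true  = S.refl
          δ-0 false = S.refl
          δ-suc : ∀ b m → δ b (suc m) S.≈ S.0#
          δ-suc true  m = S.refl
          δ-suc false m = S.refl
          δ-homo : ∀ b → reduce n ∘ (if b then T.1# else T.0#) P.≈ δ b
          δ-homo true  = SerL.1#-homo
          δ-homo false = SerL.0#-homo
          split : reduce n ∘ series-I-tXA i j P.≈ δ (does (i Fin.≟ j)) P.+ P.- (P.t P.* x)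
          split = P.trans {reduce n ∘ series-I-tXA i j} (SerL.+-homo (M.I i j) (T.- (Pxt.t T.* XA i j)))
            (P.+-cong {reduce n ∘ M.I i j} {δ (does (i Fin.≟ j))} {reduce n ∘ (T.- (Pxt.t T.* XA i j))} {P.- (P.t P.* x)}
              (δ-homo (does (i Fin.≟ j)))
              (P.trans {reduce n ∘ (T.- (Pxt.t T.* XA i j))} (SerL.-‿homo (Pxt.t T.* XA i j))
                (P.-‿cong {reduce n ∘ (Pxt.t T.* XA i j)} {P.t P.* x}
                (P.trans {reduce n ∘ (Pxt.t T.* XA i j)} (SerL.*-homo Pxt.t (XA i j))
                  (P.*-cong {reduce n ∘ Pxt.t} {P.t} {reduce n ∘ XA i j} {x} Red.t-homo (reduce-XA i j))))))

    -- Reduction passes through `log`, then `det`, down to the entries. Congruence is invoked only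
    -- in the target, where the ring laws are available.
    sq-logdet : ∀ m → Px.sq (T.-_ (Pxt.log (Px.const ∘ ι) (M.det series-I-tXA)) m) K.≈ total n (S.- logdet n a m)
    sq-logdet m = K.trans (sq≈total n (T.-_ L m)) (total-cong n (S.trans (RingLaws.-‿homo reduce-laws (L m)) (S.-‿cong (S.trans
      (LogLift.log-homo reduce-laws (Px.const ∘ ι) (scalar n ∘ ι) (λ q → Ev.eval-const (gen {n}) (ι q)) (M.det series-I-tXA) m)
      (log-cong (SF n) (scalar n ∘ ι) {reduce n ∘ M.det series-I-tXA} {Matrices.det P.rawRing (I-tXA n a)}
        (P.trans {reduce n ∘ M.det series-I-tXA} (Ser.det-homo series-I-tXA)
          (Determinants.det-cong (Series.seriesRing (SF n)) {M = λ i j → reduce n ∘ series-I-tXA i j} {I-tXA n a} reduce-entry)) m)))))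
      where
        L : T.Carrier
        L = Pxt.log (Px.const ∘ ι) (M.det series-I-tXA)

-- Sums over cycles

words-length : ∀ {n} m {s : List (Fin n)} → s ∈ words n m → length s ≡ m
words-length zero    (here ≡.refl) = ≡.refl
words-length {n} (suc m) s∈ with ∈-cartesianProductWith⁻ _∷_ (allFin n) (words n m) s∈
... | _ , _ , _ , s∈′ , ≡.refl = ≡.cong suc (words-length m s∈′)

∈-words : ∀ {n} (s : List (Fin n)) → s ∈ words n (length s)
∈-words []      = here ≡.refl
∈-words (v ∷ s) = ∈-cartesianProductWith⁺ _∷_ (∈-allFin v) (∈-words s)

words-unique : ∀ n m → Unique (words n m)
words-unique n zero    = [] ∷ []
words-unique n (suc m) = UniqueSetoid.cartesianProductWith⁺ (≡.setoid _) (≡.setoid _) (≡.setoid _)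
  _∷_ List.∷-injective (Unique.allFin⁺ n) (words-unique n m)

unique-length : ∀ {n} {s : List (Fin n)} → Unique s → length s ℕ.≤ n
unique-length {n} {s} u with length s ℕ.≤? n
... | yes ≤n = ≤n
... | no  ≰n with Fin.pigeonhole (ℕ.≰⇒> ≰n) (List.lookup s)
... | i , j , i<j , e = contradiction e (distinct u i<j)
  where
    distinct : ∀ {s : List (Fin n)} → Unique s → ∀ {i j} → i Fin.< j → ¬ List.lookup s i ≡ List.lookup s j
    distinct {s = _ ∷ s} (v∉ ∷ u) {zero}  {suc j} _         = All.lookup v∉ (∈-lookup {xs = s} j)
    distinct {s = _ ∷ _} (_ ∷ u)  {suc i} {suc j} (s≤s i<j) = distinct u i<j

canonical⇒unique : ∀ {n} {s : List (Fin n)} → Canonical s → Unique s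
canonical⇒unique {s = v ∷ s} (v< , u) = All.map (λ v<k v≡k → Fin.<-irrefl v≡k v<k) v< ∷ u

-- The decision procedure is a parameter so that the lists below coincide definitionally with those
-- of `Cycles`, up to replacing `sequences` by `words`.
module CycleSums
  (K : CommutativeRing c ℓ) {n : ℕ} (wt : Fin n → Fin n → CommutativeRing.Carrier K)
  (wt-sym : ∀ u v → CommutativeRing._≈_ K (wt u v) (wt v u))
  (Adjacent : Fin n × Fin n → Set) (adjacent-sym : ∀ {e} → Adjacent e → Adjacent (swap e))
  (adjacent? : Decidable Adjacent)
  (wt-0 : ∀ u v → ¬ Adjacent (u , v) → CommutativeRing._≈_ K (wt u v) (CommutativeRing.0# K))
  (isCycle? : Decidable (λ c → Unique c × All Adjacent (cyclicSteps c)))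
  where
  open RingKit K
  open WordSums K
  open DecMembership (List.≡-dec (Fin._≟_ {n})) using (_∈?_)

  cycles directed undirected : ℕ → List (List (Fin n))
  cycles m     = filter isCycle? (words n m)
  directed m   = deduplicate (λ c d → d ∈? rotationList c) (cycles m)
  undirected m = deduplicate (λ c d → (d ∈? rotationList c) ⊎-dec (d ∈? rotationList (reverse c))) (cycles m)

  weightOf : List (Fin n) → Carrier
  weightOf c = ∏ (map (uncurry wt) (cyclicSteps c))

  private
    IsCycle : List (Fin n) → Set
    IsCycle c = Unique c × All Adjacent (cyclicSteps c)

    ∏-↭ : ∀ {xs ys : List (Fin n × Fin n)} → xs ↭ ys → ∏ (map (uncurry wt) xs) ≈ ∏ (map (uncurry wt) ys)
    ∏-↭ Perm.refl         = refl
    ∏-↭ (Perm.prep x p)   = *-congˡ (∏-↭ p)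
    ∏-↭ (Perm.swap x y p) = trans (*-swapˡ _ _ _) (*-congˡ (*-congˡ (∏-↭ p)))
    ∏-↭ (Perm.trans p q)  = trans (∏-↭ p) (∏-↭ q)

    ∏-swap : ∀ xs → ∏ (map (uncurry wt) (map swap xs)) ≈ ∏ (map (uncurry wt) xs)
    ∏-swap []             = refl
    ∏-swap ((u , v) ∷ xs) = *-cong (wt-sym v u) (∏-swap xs)

    weight-rotation : ∀ {c d} → Rotation c d → weightOf c ≈ weightOf d
    weight-rotation r = ∏-↭ (cyclicSteps-rotation r)

    weight-reverse : ∀ c → weightOf (reverse c) ≈ weightOf c
    weight-reverse c = trans (∏-↭ (cyclicSteps-reverse c)) (∏-swap (cyclicSteps c))

    ∏-¬adjacent : ∀ xs → ¬ All Adjacent xs → ∏ (map (uncurry wt) xs) ≈ 0#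
    ∏-¬adjacent []             ¬all = contradiction [] ¬all
    ∏-¬adjacent ((u , v) ∷ xs) ¬all with adjacent? (u , v)
    ... | yes e = trans (*-congˡ (∏-¬adjacent xs (λ es → ¬all (e ∷ es)))) (zeroʳ _)
    ... | no ¬e = trans (*-congʳ (wt-0 u v ¬e)) (zeroˡ _)

    module _ (m : ℕ) where
      cycle⇒ : ∀ {c} → c ∈ cycles m → length c ≡ m × IsCycle c
      cycle⇒ c∈ with ∈-filter⁻ isCycle? {xs = words n m} c∈
      ... | c∈′ , cyc = words-length m c∈′ , cyc

      cycle⇐ : ∀ {c} → length c ≡ m → IsCycle c → c ∈ cycles m
      cycle⇐ {c} ≡.refl cyc = ∈-filter⁺ isCycle? (∈-words c) cyc

      cycle-rotation : ∀ {c d} → Rotation c d → c ∈ cycles m → d ∈ cycles m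
      cycle-rotation r c∈ with cycle⇒ c∈
      ... | len , u , adj = cycle⇐ (≡.trans (≡.sym (Perm.↭-length (rotation-↭ r))) len)
        (unique-↭ (rotation-↭ r) u , Perm.All-resp-↭ (cyclicSteps-rotation r) adj)

      cycle-reverse : ∀ {c} → c ∈ cycles m → reverse c ∈ cycles m
      cycle-reverse {c} c∈ with cycle⇒ c∈
      ... | len , u , adj = cycle⇐ (≡.trans (List.length-reverse c) len)
        ( unique-↭ (↭-sym (Perm.↭-reverse c)) u
        , Perm.All-resp-↭ (↭-sym (cyclicSteps-reverse c)) (All.map⁺ (All.map adjacent-sym adj)))

    ≢[] : ∀ {c d : List (Fin n)} → Rotation c d → ¬ c ≡ [] → ¬ d ≡ []
    ≢[] {[]}    r c≢[] = contradiction ≡.refl c≢[]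
    ≢[] {_ ∷ _} r c≢[] ≡.refl = contradiction (Perm.↭-length (rotation-↭ r)) λ ()

    reverse≢[] : ∀ {c : List (Fin n)} → ¬ c ≡ [] → ¬ reverse c ≡ []
    reverse≢[] {c} c≢[] e = c≢[] (≡.trans (≡.sym (List.reverse-involutive c)) (≡.cong reverse e))

    ∈⇒≢[] : ∀ {c d : List (Fin n)} → d ∈ rotationList c → ¬ c ≡ []
    ∈⇒≢[] {[]}    ()
    ∈⇒≢[] {_ ∷ _} _ ()

    ∈-rotation-trans : ∀ {c d e : List (Fin n)} → d ∈ rotationList c → e ∈ rotationList d → e ∈ rotationList c
    ∈-rotation-trans d∈ e∈ = ∈-rotationList⁺ (∈⇒≢[] d∈) (rotation-trans (∈-rotationList⁻ d∈) (∈-rotationList⁻ e∈))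

    ∈-rotation-sym : ∀ {c d : List (Fin n)} → d ∈ rotationList c → c ∈ rotationList d
    ∈-rotation-sym d∈ = ∈-rotationList⁺ (≢[] (∈-rotationList⁻ d∈) (∈⇒≢[] d∈)) (rotation-sym (∈-rotationList⁻ d∈))

    _∼_ : List (Fin n) → List (Fin n) → Set
    c ∼ d = d ∈ rotationList c ⊎ d ∈ rotationList (reverse c)

    _∼?_ : Binary.Decidable _∼_
    c ∼? d = (d ∈? rotationList c) ⊎-dec (d ∈? rotationList (reverse c))

    ∼-from : ∀ {c d} → c ∼ d → ¬ c ≡ [] × (Rotation c d ⊎ Rotation (reverse c) d)
    ∼-from (inj₁ d∈) = ∈⇒≢[] d∈ , inj₁ (∈-rotationList⁻ d∈)
    ∼-from (inj₂ d∈) = (λ { ≡.refl → ∈⇒≢[] d∈ ≡.refl }) , inj₂ (∈-rotationList⁻ d∈)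

    ∼-to : ∀ {c d} → ¬ c ≡ [] → Rotation c d ⊎ Rotation (reverse c) d → c ∼ d
    ∼-to c≢[] = Sum.map (∈-rotationList⁺ c≢[]) (∈-rotationList⁺ (reverse≢[] c≢[]))

    ∼-trans : Transitive _∼_
    ∼-trans {c} {d} {e} c∼d d∼e with ∼-from c∼d | ∼-from d∼e
    ... | c≢[] , inj₁ r | _ , inj₁ s = ∼-to c≢[] (inj₁ (rotation-trans r s))
    ... | c≢[] , inj₁ r | _ , inj₂ s = ∼-to c≢[] (inj₂ (rotation-trans (rotation-reverse r) s))
    ... | c≢[] , inj₂ r | _ , inj₁ s = ∼-to c≢[] (inj₂ (rotation-trans r s))
    ... | c≢[] , inj₂ r | _ , inj₂ s = ∼-to c≢[] (inj₁
      (rotation-trans (≡.subst (λ b → Rotation b (reverse d)) (List.reverse-involutive c) (rotation-reverse r)) s))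

    ∼-sym : Symmetric _∼_
    ∼-sym {c} {d} c∼d with ∼-from c∼d
    ... | c≢[] , inj₁ r = ∼-to (≢[] r c≢[]) (inj₁ (rotation-sym r))
    ... | c≢[] , inj₂ r = ∼-to (≢[] r (reverse≢[] c≢[])) (inj₂
      (rotation-sym (≡.subst (λ b → Rotation b (reverse d)) (List.reverse-involutive c) (rotation-reverse r))))

    weight-∼ : ∀ {c d} → c ∼ d → weightOf c ≈ weightOf d
    weight-∼ {c} (inj₁ d∈) = weight-rotation (∈-rotationList⁻ d∈)
    weight-∼ {c} (inj₂ d∈) = trans (sym (weight-reverse c)) (weight-rotation (∈-rotationList⁻ d∈))

    module _ (m : ℕ) where
      nonempty : ∀ {c} → c ∈ cycles (suc m) → ¬ c ≡ []
      nonempty c∈ ≡.refl = contradiction (proj₁ (cycle⇒ (suc m) c∈)) λ ()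

      -- Some representative is kept for c, and two of them would be rotations of each other, which
      -- `deduplicate-pairs` forbids.
      directed-one : ∀ {c} → c ∈ cycles (suc m) → length (filter (_∈? rotationList c) (directed (suc m))) ≡ 1
      directed-one {c} c∈ = length-filter-1 (_∈? rotationList c)
        (AllPairs.map (λ ¬d∼e (d∈ , e∈) → ¬d∼e (∈-rotation-trans (∈-rotation-sym d∈) e∈))
          (deduplicate-pairs (λ c d → d ∈? rotationList c) (cycles (suc m))))
        (Any.map ∈-rotation-sym (deduplicate-represents (λ c d → d ∈? rotationList c) ∈-rotation-trans
          (cycles (suc m)) (∈-rotationList⁺ (nonempty c∈) (rotation-refl c)) c∈))

      canonicals : List (List (Fin n))
      canonicals = filter canonical? (cycles (suc m))

      canonical-one : ∀ {d} → d ∈ directed (suc m) → length (filter (_∈? rotationList d) canonicals) ≡ 1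
      canonical-one {d} d∈ = length-filter-unique (_∈? rotationList d)
        (Unique.filter⁺ canonical? (Unique.filter⁺ isCycle? (words-unique n (suc m))))
        (λ x∈ y∈ x∈d y∈d → canonical-unique
          (proj₂ (∈-filter⁻ canonical? {xs = cycles (suc m)} x∈)) (proj₂ (∈-filter⁻ canonical? {xs = cycles (suc m)} y∈))
          (rotation-trans (rotation-sym (∈-rotationList⁻ x∈d)) (∈-rotationList⁻ y∈d)))
        some
        where
          d∈′ : d ∈ cycles (suc m)
          d∈′ = ∈-deduplicate⁻ (λ c d → d ∈? rotationList c) (cycles (suc m)) d∈
          some : Any.Any (_∈ rotationList d) canonicals
          some with canonical-exists (nonempty d∈′) (proj₁ (proj₂ (cycle⇒ (suc m) d∈′)))
          ... | e , r , can = Any.map (λ { ≡.refl → ∈-rotationList⁺ (nonempty d∈′) r })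
            (∈-filter⁺ canonical? (cycle-rotation (suc m) r d∈′) can)

    cyclic≈weight : ∀ v s → weightOf (v ∷ s) ≈ cyclic wt (v ∷ s)
    cyclic≈weight v s = trans (reflexive (≡.cong (∏ ∘ map (uncurry wt)) (cyclicSteps-∷ v s))) (go v s)
      where
        go : ∀ u s → ∏ (map (uncurry wt) (trail u s v)) ≈ path wt u s v
        go u []      = *-identityʳ _
        go u (k ∷ s) = *-congˡ (go k s)

  -- Rotation matches the representatives kept by `deduplicate` one to one with the canonical
  -- cycles, and it preserves weights.
  ∑-directed : ∀ m → ∑ (map weightOf (directed (suc m))) ≈ canonicalSum n wt (suc m)
  ∑-directed m = begin
    ∑ (map weightOf (directed (suc m)))
      ≈⟨ +-identityʳ _ ⟨
    1 · ∑ (map weightOf (directed (suc m)))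
      ≈⟨ ∑-double-count K (λ c d → d ∈? rotationList c) (λ d∈ → weight-rotation (∈-rotationList⁻ d∈)) 1 1
           {directed (suc m)} {canonicals m} (canonical-one m) column ⟩
    1 · ∑ (map weightOf (canonicals m))
      ≈⟨ +-identityʳ _ ⟩
    ∑ (map weightOf (canonicals m))
      ≈⟨ trans (∑-filter canonical? weightOf (cycles (suc m))) (∑-filter isCycle? _ (words n (suc m))) ⟩
    ∑ (map (λ s → if does (isCycle? s) then (if does (canonical? s) then weightOf s else 0#) else 0#) (words n (suc m)))
      ≈⟨ ∑-cong (words n (suc m)) (λ s → select s (isCycle? s) (canonical? s)) ⟩
    canonicalSum n wt (suc m) ∎
    where
      column : ∀ {e} → e ∈ canonicals m → length (filter (λ d → e ∈? rotationList d) (directed (suc m))) ≡ 1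
      column {e} e∈ = ≡.trans
        (≡.cong length (List.filter-≐ (λ d → e ∈? rotationList d) (_∈? rotationList e)
          (∈-rotation-sym , ∈-rotation-sym) (directed (suc m))))
        (directed-one m (proj₁ (∈-filter⁻ canonical? {xs = cycles (suc m)} e∈)))

      select : ∀ s (cyc? : Dec (IsCycle s)) (can? : Dec (Canonical s)) →
        (if does cyc? then (if does can? then weightOf s else 0#) else 0#) ≈ (if does can? then cyclic wt s else 0#)
      select []      cyc?     (yes ())
      select (v ∷ s) (yes _)  (yes _)   = cyclic≈weight v s
      select s       (yes _)  (no _)    = refl
      select s       (no _)   (no _)    = refl
      -- `canonicalSum` ranges over all words, adjacent or not. A canonical word that is no cycle
      -- has a step along a non-edge, whose weight 0 annihilates the product.
      select (v ∷ s) (no ¬cyc) (yes can) = trans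
        (sym (∏-¬adjacent (cyclicSteps (v ∷ s)) (λ adj → ¬cyc (canonical⇒unique can , adj)))) (cyclic≈weight v s)

  -- A directed representative belongs to one unoriented class. Conversely, the rotations of c and
  -- of its reversal contain one directed representative each, and `chiral` keeps these two apart.
  ∑-undirected : ∀ m → ∑ (map weightOf (directed (3 ℕ.+ m))) ≈ 2 · ∑ (map weightOf (undirected (3 ℕ.+ m)))
  ∑-undirected m = trans (sym (+-identityʳ _))
    (∑-double-count K (λ d c → c ∼? d) (λ c∼d → sym (weight-∼ c∼d)) 1 2 {directed (3 ℕ.+ m)} {undirected (3 ℕ.+ m)} row column)
    where
      row : ∀ {d} → d ∈ directed (3 ℕ.+ m) → length (filter (_∼? d) (undirected (3 ℕ.+ m))) ≡ 1
      row {d} d∈ = length-filter-1 (_∼? d)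
        (AllPairs.map (λ ¬c∼e (c∼d , e∼d) → ¬c∼e (∼-trans c∼d (∼-sym e∼d))) (deduplicate-pairs _∼?_ (cycles (3 ℕ.+ m))))
        (deduplicate-represents _∼?_ ∼-trans (cycles (3 ℕ.+ m)) (∼-to (nonempty (2 ℕ.+ m) d∈′) (inj₁ (rotation-refl d))) d∈′)
        where
          d∈′ : d ∈ cycles (3 ℕ.+ m)
          d∈′ = ∈-deduplicate⁻ (λ c d → d ∈? rotationList c) (cycles (3 ℕ.+ m)) d∈

      column : ∀ {c} → c ∈ undirected (3 ℕ.+ m) → length (filter (c ∼?_) (directed (3 ℕ.+ m))) ≡ 2
      column {c} c∈ = ≡.trans
        (length-filter-⊎ (_∈? rotationList c) (_∈? rotationList (reverse c))
          (λ d d∈ d∈ᵣ → chiral (≡.subst (3 ℕ.≤_) (≡.sym (proj₁ (cycle⇒ (3 ℕ.+ m) c∈′))) (s≤s (s≤s (s≤s z≤n))))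
            (proj₁ (proj₂ (cycle⇒ (3 ℕ.+ m) c∈′)))
            (rotation-trans (∈-rotationList⁻ d∈) (rotation-sym (∈-rotationList⁻ d∈ᵣ)))) (directed (3 ℕ.+ m)))
        (≡.cong₂ ℕ._+_ (directed-one (2 ℕ.+ m) c∈′) (directed-one (2 ℕ.+ m) (cycle-reverse (3 ℕ.+ m) c∈′)))
        where
          c∈′ : c ∈ cycles (3 ℕ.+ m)
          c∈′ = ∈-deduplicate⁻ _∼?_ (cycles (3 ℕ.+ m)) c∈

-- By the pigeonhole principle a longer word repeats a vertex. This makes the series terminate.
canonicalSum-long : ∀ (K : CommutativeRing c ℓ) n wt m → n ℕ.< m →
  CommutativeRing._≈_ K (WordSums.canonicalSum K n wt m) (CommutativeRing.0# K)
canonicalSum-long K n wt m n<m = ∑-zero-All (All.tabulate λ {s} s∈ → off s (words-length m s∈) (canonical? s))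
  where
    open RingKit K
    open WordSums K
    ∑-zero-All : ∀ {f : List (Fin n) → Carrier} {xs} → All (λ x → f x ≈ 0#) xs → ∑ (map f xs) ≈ 0#
    ∑-zero-All {xs = xs} e = trans (∑-cong-All e) (∑-zero xs (λ _ → refl))
    off : ∀ s → length s ≡ m → (can? : Dec (Canonical s)) → (if does can? then cyclic wt s else 0#) ≈ 0#
    off s len (yes can) = contradiction (unique-length (canonical⇒unique can)) (ℕ.<⇒≱ (≡.subst (n ℕ.<_) (≡.sym len) n<m))
    off s len (no _)    = refl

-- Tait graphs

ℚ[w,r]-ring : CommutativeRing _ _
ℚ[w,r]-ring = PolynomialRing.polynomialRing ℚ.+-*-commutativeRing 2

private module K = RingKit ℚ[w,r]-ring

ℚ[w,r]-scalars : LogScalars ℚ[w,r]-ring ℚ[w,r].const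
ℚ[w,r]-scalars = PolynomialRing.constP-scalars ℚ.+-*-commutativeRing 2 {id} ℚ-scalars

module _ (s : Fin 2 → Weight) where
  open ℚ[w,r] using (_⟦_⟧; var)
  private
    const-laws = PolynomialRing.constP-laws ℚ.+-*-commutativeRing 2
    module Ev = Evaluation const-laws

    ⟦⟧≈eval : ∀ p → p ⟦ s ⟧ K.≈ Ev.eval s p
    ⟦⟧≈eval p = K.∑-cong p λ (k , α) → K.*-congˡ {ℚ[w,r].const k} {product α} {Ev.power s α}
      (K.sym {Ev.power s α} {product α} (Ev.power≈∏ s α))
      where
        product : Vec ℕ 2 → Weight
        product α = K.∏ (map (λ i → s i K.^ lookup α i) (allFin 2))

  ⟦⟧-var : ∀ i → var i ⟦ s ⟧ K.≈ s i
  ⟦⟧-var i = K.trans {var i ⟦ s ⟧} {Ev.eval s (var i)} {s i} (⟦⟧≈eval (var i)) (Ev.eval-var s i)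

  ⟦⟧-laws : RingLaws ℚ[w,r].rawRing ℚ[w,r]-ring (_⟦ s ⟧)
  ⟦⟧-laws = record
    { 0#-homo = L.0#-homo
    ; 1#-homo = K.trans {K.1# ⟦ s ⟧} {Ev.eval s K.1#} {K.1#} (⟦⟧≈eval K.1#) L.1#-homo
    ; +-homo  = λ x y → K.begin
        (x K.+ y) ⟦ s ⟧               K.≈⟨ ⟦⟧≈eval (x K.+ y) ⟩
        Ev.eval s (x K.+ y)           K.≈⟨ L.+-homo x y ⟩
        Ev.eval s x K.+ Ev.eval s y
          K.≈⟨ K.+-cong {x ⟦ s ⟧} {Ev.eval s x} {y ⟦ s ⟧} {Ev.eval s y} (⟦⟧≈eval x) (⟦⟧≈eval y) ⟨
        x ⟦ s ⟧ K.+ y ⟦ s ⟧           K.∎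
    ; *-homo  = λ x y → K.begin
        (x K.* y) ⟦ s ⟧               K.≈⟨ ⟦⟧≈eval (x K.* y) ⟩
        Ev.eval s (x K.* y)           K.≈⟨ L.*-homo x y ⟩
        Ev.eval s x K.* Ev.eval s y
          K.≈⟨ K.*-cong {x ⟦ s ⟧} {Ev.eval s x} {y ⟦ s ⟧} {Ev.eval s y} (⟦⟧≈eval x) (⟦⟧≈eval y) ⟨
        x ⟦ s ⟧ K.* y ⟦ s ⟧           K.∎
    ; -‿homo  = λ x → K.begin
        (K.- x) ⟦ s ⟧                 K.≈⟨ ⟦⟧≈eval (K.- x) ⟩
        Ev.eval s (K.- x)             K.≈⟨ L.-‿homo x ⟩
        K.- Ev.eval s x               K.≈⟨ K.-‿cong {x ⟦ s ⟧} {Ev.eval s x} (⟦⟧≈eval x) ⟨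
        K.- (x ⟦ s ⟧)                 K.∎
    }
    where module L = RingLaws (Ev.eval-laws s)

open ℚ[w,r] using (_[w²,r²]; w; r)

squares : Fin 2 → Weight
squares 0F = w K.* w
squares 1F = r K.* r

squaring-laws : RingLaws ℚ[w,r].rawRing ℚ[w,r]-ring _[w²,r²]
squaring-laws = ⟦⟧-laws squares

-- Substituting w², r² squares the weights because these are monomials.
SquareWeight : Weight → Set
SquareWeight ω = ω [w²,r²] K.≈ ω K.* ω

w-square : SquareWeight w
w-square = ⟦⟧-var squares 0F

r-square : SquareWeight r
r-square = ⟦⟧-var squares 1F

∏-square : ∀ {ωs} → All SquareWeight ωs → SquareWeight (K.∏ ωs)
∏-square []                  = K.trans {K.1# [w²,r²]} {K.1#} {K.1# K.* K.1#}
  (RingLaws.1#-homo squaring-laws) (K.sym {K.1# K.* K.1#} {K.1#} (K.*-identityˡ K.1#))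
∏-square {ω ∷ ωs} (sq ∷ sqs) = K.begin
  (ω K.* K.∏ ωs) [w²,r²]                    K.≈⟨ RingLaws.*-homo squaring-laws ω (K.∏ ωs) ⟩
  ω [w²,r²] K.* K.∏ ωs [w²,r²]
    K.≈⟨ K.*-cong {ω [w²,r²]} {ω K.* ω} {K.∏ ωs [w²,r²]} {K.∏ ωs K.* K.∏ ωs} sq (∏-square sqs) ⟩
  (ω K.* ω) K.* (K.∏ ωs K.* K.∏ ωs)         K.≈⟨ K.*-interchange ω ω (K.∏ ωs) (K.∏ ωs) ⟩
  (ω K.* K.∏ ωs) K.* (ω K.* K.∏ ωs)         K.∎

parallelProduct-square : ∀ {ωs ω} → All SquareWeight ωs → parallelProduct ωs ≡ just ω → SquareWeight ω
parallelProduct-square {_ ∷ _} sqs ≡.refl = ∏-square sqs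

tait-square : ∀ p D κ e → SquareWeight (MultiGraph.wg (proj₁ (tait p D κ)) e)
tait-square p record { diagram = circle } κ ()
tait-square p record { diagram = crossed D ; reduced = crossed _ } κ e with CrossedDiagram.sign D e
... | Sign.+ = w-square
... | Sign.- = r-square

G*-square : ∀ p D κ u v {ω} → SimpleGraph.weight (G* p D κ) u v ≡ just ω → SquareWeight ω
G*-square p D κ u v = parallelProduct-square (All.map⁺ (All.universal (tait-square p D κ) _))

module _ (K : CommutativeRing c ℓ) {n : ℕ} (wt : Fin n → Fin n → CommutativeRing.Carrier K) where
  open RingKit K
  open WordSums K

  canonicalSum-1 : (∀ v → wt v v ≈ 0#) → canonicalSum n wt 1 ≈ 0#
  canonicalSum-1 loopless = trans (∑-words {n} _ 0) (∑-zero (allFin n) λ v → trans (+-identityʳ _) (loopless v))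

  -- For two letters canonical means increasing, so each unordered pair occurs once, as in
  -- `edgeWeights`.
  canonicalSum-2 : canonicalSum n wt 2 ≈
    ∑ (map (λ (u , v) → wt u v * wt v u) (filter (λ (u , v) → u Fin.<? v) (cartesianProduct (allFin n) (allFin n))))
  canonicalSum-2 = begin
    canonicalSum n wt 2
      ≈⟨ ∑-words F 1 ⟩
    ∑ (map (λ u → ∑ (map (λ s → F (u ∷ s)) (words n 1))) (allFin n))
      ≈⟨ ∑-cong (allFin n) (λ u → trans (∑-words (λ s → F (u ∷ s)) 0)
           (∑-cong (allFin n) λ v → trans (+-identityʳ _) (increasing u v))) ⟩
    ∑ (map (λ u → ∑ (map (λ v → if does (u Fin.<? v) then wt u v * wt v u else 0#) (allFin n))) (allFin n))
      ≈⟨ ∑-cartesianProductWith (λ (u , v) → if does (u Fin.<? v) then wt u v * wt v u else 0#) _,_ (allFin n) (allFin n) ⟨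
    ∑ (map (λ (u , v) → if does (u Fin.<? v) then wt u v * wt v u else 0#) (cartesianProduct (allFin n) (allFin n)))
      ≈⟨ ∑-filter (λ (u , v) → u Fin.<? v) (λ (u , v) → wt u v * wt v u) (cartesianProduct (allFin n) (allFin n)) ⟨
    _ ∎
    where
      F : List (Fin n) → Carrier
      F s = if does (canonical? s) then cyclic wt s else 0#
      increasing : ∀ u v → F (u ∷ v ∷ []) ≈ (if does (u Fin.<? v) then wt u v * wt v u else 0#)
      increasing u v = reflexive (≡.cong (λ b → if b then wt u v * wt v u else 0#)
        (does-⇔ (mk⇔ (λ { (u<v ∷ [] , _) → u<v }) (λ u<v → u<v ∷ [] , [] ∷ [])) (canonical? (u ∷ v ∷ [])) (u Fin.<? v)))

-- The two evaluations for a single weighted graph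

module GraphSums (G : SimpleGraph) (square : ∀ u v {ω} → SimpleGraph.weight G u v ≡ just ω → SquareWeight ω) where
  open SimpleGraph G renaming (order to n)
  open Cycles weight using (sequences; isCycle?; directedCycles; undirectedCycles; cycleWeight)
  open WordSums ℚ[w,r]-ring using (canonicalSum)

  private
    wt : Fin n → Fin n → Weight
    wt = adjacency G

    Adjacent : Fin n × Fin n → Set
    Adjacent (u , v) = Is-just (weight u v)

    wt-0 : ∀ u v → ¬ Adjacent (u , v) → wt u v K.≈ K.0#
    wt-0 u v ¬adj with weight u v
    ... | just _  = contradiction (MaybeAny.just tt) ¬adj
    ... | nothing = K.refl {K.0#}

    wt-sym : ∀ u v → wt u v K.≈ wt v u
    wt-sym u v = K.reflexive (≡.cong (fromMaybe K.0#) (symm u v))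

    adjacent-sym : ∀ {e} → Adjacent e → Adjacent (swap e)
    adjacent-sym {u , v} = ≡.subst Is-just (symm u v)

    adjacent? : Decidable Adjacent
    adjacent? (u , v) = MaybeAny.dec (λ _ → yes tt) (weight u v)

    module C = CycleSums ℚ[w,r]-ring wt wt-sym Adjacent adjacent-sym adjacent? wt-0 isCycle?

    sequences≡words : ∀ m → sequences m ≡ words n m
    sequences≡words zero    = ≡.refl
    sequences≡words (suc m) = ≡.cong (cartesianProductWith _∷_ (allFin n)) (sequences≡words m)

    directed≡ : ∀ m → directedCycles m ≡ C.directed m
    directed≡ m = ≡.cong (λ ws → deduplicate _ (filter isCycle? ws)) (sequences≡words m)

    undirected≡ : ∀ m → undirectedCycles m ≡ C.undirected m
    undirected≡ m = ≡.cong (λ ws → deduplicate _ (filter isCycle? ws)) (sequences≡words m)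

    dir : ℕ → Weight
    dir m = K.∑ (map cycleWeight (directedCycles m))

    dir≈canonical : ∀ m → dir (suc m) K.≈ canonicalSum n wt (suc m)
    dir≈canonical m = K.begin
      dir (suc m)                                              K.≡⟨ ≡.cong (K.∑ ∘ map cycleWeight) (directed≡ (suc m)) ⟩
      K.∑ (map C.weightOf (C.directed (suc m)))                K.≈⟨ C.∑-directed m ⟩
      canonicalSum n wt (suc m)                                K.∎

    dir-long : ∀ m → dir (3 ℕ.+ m) K.≈ 2 K.· cycleSum G (3 ℕ.+ m)
    dir-long m = K.begin
      dir (3 ℕ.+ m)                                            K.≡⟨ ≡.cong (K.∑ ∘ map cycleWeight) (directed≡ (3 ℕ.+ m)) ⟩
      K.∑ (map C.weightOf (C.directed (3 ℕ.+ m)))              K.≈⟨ C.∑-undirected m ⟩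
      2 K.· K.∑ (map C.weightOf (C.undirected (3 ℕ.+ m)))
        K.≡⟨ ≡.cong (λ cs → 2 K.· K.∑ (map cycleWeight cs)) (undirected≡ (3 ℕ.+ m)) ⟨
      2 K.· cycleSum G (3 ℕ.+ m)                               K.∎

    dir-1 : dir 1 K.≈ K.0#
    dir-1 = K.trans {dir 1} {canonicalSum n wt 1} {K.0#} (dir≈canonical 0)
      (canonicalSum-1 ℚ[w,r]-ring wt (λ v → K.reflexive (≡.cong (fromMaybe K.0#) (loopless v))))

    -- A directed 2-cycle traverses its edge both ways and so has the squared weight; `square` says
    -- that the substitution does the same to each summand.
    dir-2 : cycleSum G 2 [w²,r²] K.≈ dir 2
    dir-2 = K.begin
      K.∑ (edgeWeights G) [w²,r²]
        K.≈⟨ RingLawsProperties.∑-homo squaring-laws (edgeWeights G) ⟩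
      K.∑ (map _[w²,r²] (edgeWeights G))
        K.≈⟨ K.∑-mapMaybe _[w²,r²] (uncurry weight) pairs ⟩
      K.∑ (map (maybe _[w²,r²] K.0# ∘ uncurry weight) pairs)
        K.≈⟨ K.∑-cong pairs (λ (u , v) → squared u v) ⟩
      K.∑ (map (λ (u , v) → wt u v K.* wt v u) pairs)
        K.≈⟨ canonicalSum-2 ℚ[w,r]-ring wt ⟨
      canonicalSum n wt 2
        K.≈⟨ dir≈canonical 1 ⟨
      dir 2 K.∎
      where
        pairs : List (Fin n × Fin n)
        pairs = filter (λ (u , v) → u Fin.<? v) (cartesianProduct (allFin n) (allFin n))

        squared : ∀ u v → maybe _[w²,r²] K.0# (weight u v) K.≈ wt u v K.* wt v u
        squared u v = K.trans {maybe _[w²,r²] K.0# (weight u v)} {wt u v K.* wt u v} {wt u v K.* wt v u} (by-cases (weight u v) ≡.refl)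
          (K.reflexive (≡.cong (λ m → wt u v K.* fromMaybe K.0# m) (symm u v)))
          where
            by-cases : ∀ m → weight u v ≡ m → maybe _[w²,r²] K.0# m K.≈ fromMaybe K.0# m K.* fromMaybe K.0# m
            by-cases (just ω) e = square u v e
            by-cases nothing  e = K.sym {K.0# K.* K.0#} {K.0#} (K.zeroˡ K.0#)

    dir-beyond : ∀ m → n ℕ.< suc m → dir (suc m) K.≈ K.0#
    dir-beyond m n<m = K.trans {dir (suc m)} {canonicalSum n wt (suc m)} {K.0#} (dir≈canonical m) (canonicalSum-long ℚ[w,r]-ring n wt (suc m) n<m)

    ∑-applyUpTo-2 : ∀ (f : ℕ → Weight) j → K.∑ (applyUpTo (λ k → 2 K.· f k) j) K.≈ 2 K.· K.∑ (applyUpTo f j)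
    ∑-applyUpTo-2 f j = K.begin
      K.∑ (applyUpTo (λ k → 2 K.· f k) j)                 K.≡⟨ ≡.cong K.∑ (List.map-upTo (λ k → 2 K.· f k) j) ⟨
      K.∑ (map (λ k → 2 K.· f k) (upTo j))
        K.≈⟨ K.∑-cong (upTo j) (λ k → K.+-congˡ {f k} {f k K.+ K.0#} {f k} (K.+-identityʳ (f k))) ⟩
      K.∑ (map (λ k → f k K.+ f k) (upTo j))              K.≈⟨ K.∑-+ f f (upTo j) ⟩
      K.∑ (map f (upTo j)) K.+ K.∑ (map f (upTo j))       K.≡⟨ ≡.cong (λ xs → K.∑ xs K.+ K.∑ xs) (List.map-upTo f j) ⟩
      K.∑ (applyUpTo f j) K.+ K.∑ (applyUpTo f j)
        K.≈⟨ K.+-congˡ {K.∑ (applyUpTo f j)} {K.∑ (applyUpTo f j) K.+ K.0#} {K.∑ (applyUpTo f j)}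
               (K.+-identityʳ (K.∑ (applyUpTo f j))) ⟨
      2 K.· K.∑ (applyUpTo f j)                           K.∎

    -- The right-hand side always contains `dir 2`, whereas the left-hand sum stops before it when N
    -- is 0 or 1; `beyond` says that `dir 2` is then 0. Loops are excluded by `dir-1`.
    regroup : ∀ N → (∀ m → N ℕ.< suc m → dir (suc m) K.≈ K.0#) →
      K.∑ (applyUpTo (dir ∘ suc) N) K.≈ dir 2 K.+ 2 K.· K.∑ (applyUpTo (λ k → cycleSum G (3 ℕ.+ k)) (N ∸ 2))
    regroup zero beyond = K.begin
      K.0#                       K.≈⟨ beyond 1 (s≤s z≤n) ⟨
      dir 2                      K.≈⟨ K.+-identityʳ (dir 2) ⟨
      dir 2 K.+ K.0#             K.∎
    regroup 1 beyond = K.begin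
      dir 1 K.+ K.0#             K.≈⟨ K.+-congʳ {K.0#} {dir 1} {dir 2}
                                   (K.trans {dir 1} {K.0#} {dir 2} dir-1 (K.sym {dir 2} {K.0#} (beyond 1 (s≤s (s≤s z≤n))))) ⟩
      dir 2 K.+ K.0#             K.∎
    regroup (suc (suc j)) beyond = K.begin
      dir 1 K.+ (dir 2 K.+ K.∑ (applyUpTo (λ k → dir (3 ℕ.+ k)) j))
        K.≈⟨ K.+-congʳ {dir 2 K.+ K.∑ (applyUpTo (λ k → dir (3 ℕ.+ k)) j)} {dir 1} {K.0#} dir-1 ⟩
      K.0# K.+ (dir 2 K.+ K.∑ (applyUpTo (λ k → dir (3 ℕ.+ k)) j))
        K.≈⟨ K.+-identityˡ (dir 2 K.+ K.∑ (applyUpTo (λ k → dir (3 ℕ.+ k)) j)) ⟩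
      dir 2 K.+ K.∑ (applyUpTo (λ k → dir (3 ℕ.+ k)) j)
        K.≈⟨ K.+-congˡ {dir 2} {K.∑ (applyUpTo (λ k → dir (3 ℕ.+ k)) j)}
               {K.∑ (applyUpTo (λ k → 2 K.· cycleSum G (3 ℕ.+ k)) j)}
               (K.∑-applyUpTo-cong (λ k → dir (3 ℕ.+ k)) (λ k → 2 K.· cycleSum G (3 ℕ.+ k)) j (λ k _ → dir-long k)) ⟩
      dir 2 K.+ K.∑ (applyUpTo (λ k → 2 K.· cycleSum G (3 ℕ.+ k)) j)
        K.≈⟨ K.+-congˡ {dir 2} {K.∑ (applyUpTo (λ k → 2 K.· cycleSum G (3 ℕ.+ k)) j)}
               {2 K.· K.∑ (applyUpTo (λ k → cycleSum G (3 ℕ.+ k)) j)} (∑-applyUpTo-2 (λ k → cycleSum G (3 ℕ.+ k)) j) ⟩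
      dir 2 K.+ 2 K.· K.∑ (applyUpTo (λ k → cycleSum G (3 ℕ.+ k)) j) K.∎

  directed-splits : directedCycleSum (bidirect G) K.≈ cycleSum G 2 [w²,r²] K.+ 2 K.· longCycleSum G
  directed-splits = K.begin
    K.∑ (applyUpTo (dir ∘ suc) n)                       K.≈⟨ regroup n dir-beyond ⟩
    dir 2 K.+ 2 K.· longCycleSum G                      K.≈⟨ K.+-congʳ {2 K.· longCycleSum G} {cycleSum G 2 [w²,r²]} {dir 2} dir-2 ⟨
    cycleSum G 2 [w²,r²] K.+ 2 K.· longCycleSum G       K.∎

  private
    module LD = LogDet ℚ[w,r]-ring ℚ[w,r].const ℚ[w,r]-scalars
    module SQ = Squarefree ℚ[w,r]-ring

    sq≈ : ∀ m → sq[-log-det] G m K.≈ SQ.total n (SQ.SF.-_ n (LD.logdet n wt m))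
    sq≈ = sq-logdet ℚ[w,r]-ring ℚ[w,r].const ℚ[w,r]-scalars wt

  sq-zero : sq[-log-det] G 0 K.≈ K.0#
  sq-zero = K.trans {sq[-log-det] G 0} {SQ.total n (SQ.SF.-_ n (LD.logdet n wt 0))} {K.0#} (sq≈ 0)
    (K.trans {SQ.total n (SQ.SF.-_ n (LD.logdet n wt 0))} {SQ.total n (SQ.SF.0# n)} {K.0#} (SQ.total-cong n (SQ.SF.-0#≈0# n)) (SQ.total-0 n))

  sq-suc : ∀ m → sq[-log-det] G (suc m) K.≈ dir (suc m)
  sq-suc m = K.begin
    sq[-log-det] G (suc m)                                   K.≈⟨ sq≈ (suc m) ⟩
    SQ.total n (SQ.SF.-_ n (LD.logdet n wt (suc m)))
      K.≈⟨ LogDetTotal.total-logdet ℚ[w,r]-ring ℚ[w,r].const ℚ[w,r]-scalars n wt m ⟩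
    canonicalSum n wt (suc m)                                K.≈⟨ dir≈canonical m ⟨
    dir (suc m)                                              K.∎

  terminates : Terminates (sq[-log-det] G)
  -- With the bound n, `atOne` sums degrees 0 to n. After the zero constant term these match the
  -- lengths 1 to n in `directedCycleSum`.
  terminates = n , λ { zero    ()
                     ; (suc m) n<m → K.trans {sq[-log-det] G (suc m)} {dir (suc m)} {K.0#} (sq-suc m) (dir-beyond m n<m) }

  atOne≈directed : atOne (sq[-log-det] G) terminates K.≈ directedCycleSum (bidirect G)
  atOne≈directed = K.begin
    sq[-log-det] G 0 K.+ K.∑ (applyUpTo (sq[-log-det] G ∘ suc) n)
      K.≈⟨ K.+-cong {sq[-log-det] G 0} {K.0#} {K.∑ (applyUpTo (sq[-log-det] G ∘ suc) n)} {K.∑ (applyUpTo (dir ∘ suc) n)} sq-zero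
             (K.∑-applyUpTo-cong (sq[-log-det] G ∘ suc) (dir ∘ suc) n (λ k _ → sq-suc k)) ⟩
    K.0# K.+ K.∑ (applyUpTo (dir ∘ suc) n)
      K.≈⟨ K.+-identityˡ (K.∑ (applyUpTo (dir ∘ suc) n)) ⟩
    directedCycleSum (bidirect G) K.∎

  atOne≈cycleSums : atOne (sq[-log-det] G) terminates K.≈ cycleSum G 2 [w²,r²] K.+ 2 K.· longCycleSum G
  atOne≈cycleSums = K.trans {atOne (sq[-log-det] G) terminates} {directedCycleSum (bidirect G)}
    {cycleSum G 2 [w²,r²] K.+ 2 K.· longCycleSum G} atOne≈directed directed-splits

corollary4p6 :
    (p : Rule) (D : ReducedAlternatingDiagram) →
    let open ℚ[w,r]
        sB = sq[-log-det] (G* p D black)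
        sW = sq[-log-det] (G* p D white)
    in
    Σ[ polyB ∈ Terminates sB ] Σ[ polyW ∈ Terminates sW ]
      (atOne sB polyB ≈ CB p D 2 [w²,r²] + 2 · ∑CB>2 p D)
      × (atOne sW polyW ≈ CW p D 2 [w²,r²] + 2 · ∑CW>2 p D)
      × ((atOne sB polyB , atOne sW polyW) ≈ᵘ WRP p D)
corollary4p6 p D = B.terminates , W.terminates , B.atOne≈cycleSums , W.atOne≈cycleSums
  -- The unordered pairs agree already in the given order, colour by colour.
  , inj₁ (B.atOne≈directed , W.atOne≈directed)
  where
    module B = GraphSums (G* p D black) (G*-square p D black)
    module W = GraphSums (G* p D white) (G*-square p D white)
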